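{- Let $n$ be a positive integer coprime with $6$. Then $$ \sum_{k=0}^{n-1}\frac{(q;q^2)_k^2 (q;q^2)_{2k}}{(q^2;q^2)_{2k}(q^6;q^6)_k^2}[8k+1]q^{2k^2} \equiv q^{ -(n-1)/2}[n]\biggl(\frac{ -3}{n}\biggr) \pmod{[n]\Phi_n(q)^2}. $$
   Context: $(a;q)_k=\prod_{j=0}^{k-1}(1-aq^j)$ for integers $k\ge0$; $[n]=[n]_q=(1-q^n)/(1-q)$; $\Phi_n(q)=\prod_{1\le j\le n,\ \gcd(j,n)=1}(q-e^{2\pi ij/n})\in\mathbb Z[q]$ is the $n$-th cyclotomic polynomial; $\bigl(\frac{ -3}{n}\bigr)$ is the Jacobi--Kronecker symbol. Congruence convention: for polynomials $A_1,A_2,P\in\mathbb Z[q]$, $A_1/A_2\equiv0\pmod{P}$ means $P$ divides $A_1$ and $P$ is coprime with $A_2$; for rational functions $A,B$, $A\equiv B\pmod P$ means $A-B\equiv0\pmod P$. -}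

module Defs where

open import Data.Nat as ℕ using (ℕ; zero; suc)
open import Data.Nat.Divisibility using (_∣?_)
open import Data.Integer as ℤ using (ℤ; +_; -[1+_]; 0ℤ; 1ℤ; -1ℤ)
open import Data.Integer.DivMod using (_%ℕ_)
open import Data.List using (List; []; _∷_; [_]; map; foldr; reverse; length; upTo; filter; replicate; _++_)
open import Data.Bool.ListAction using (any)
open import Data.Bool using (Bool; true; false; if_then_else_)
open import Data.Product using (Σ; ∃; _×_; _,_)
open import Data.Sum using (_⊎_)
open import Relation.Nullary using (¬_; does)
open import Relation.Binary.PropositionalEquality using (_≡_)

-- Polynomials in ℤ[q]: coefficient lists, constant term first.
-- Trailing zeros are allowed; equality is coefficientwise (_≈ₚ_).

Poly : Set
Poly = List ℤ

coeff : Poly → ℕ → ℤ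
coeff []       _       = 0ℤ
coeff (a ∷ p)  zero    = a
coeff (a ∷ p)  (suc i) = coeff p i

infix 4 _≈ₚ_
_≈ₚ_ : Poly → Poly → Set
p ≈ₚ r = ∀ i → coeff p i ≡ coeff r i

const : ℤ → Poly
const c = [ c ]

0ₚ 1ₚ : Poly
0ₚ = []
1ₚ = const 1ℤ

infixl 6 _+ₚ_ _-ₚ_
infixl 7 _*ₚ_

_+ₚ_ : Poly → Poly → Poly
[]      +ₚ r       = r
(a ∷ p) +ₚ []      = a ∷ p
(a ∷ p) +ₚ (b ∷ r) = (a ℤ.+ b) ∷ (p +ₚ r)

-ₚ_ : Poly → Poly
-ₚ p = map ℤ.-_ p

_-ₚ_ : Poly → Poly → Poly
p -ₚ r = p +ₚ (-ₚ r)

_*ₚ_ : Poly → Poly → Poly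
[]      *ₚ r = []
(a ∷ p) *ₚ r = map (a ℤ.*_) r +ₚ (0ℤ ∷ (p *ₚ r))

qpow : ℕ → Poly
qpow m = replicate m 0ℤ ++ [ 1ℤ ]

_^ₚ_ : Poly → ℕ → Poly
p ^ₚ zero  = 1ₚ
p ^ₚ suc m = p *ₚ (p ^ₚ m)

prodₚ : List Poly → Poly
prodₚ = foldr _*ₚ_ 1ₚ

sumₚ : List Poly → Poly
sumₚ = foldr _+ₚ_ 0ₚ

poch : Poly → Poly → ℕ → Poly
poch a b k = prodₚ (map (λ j → 1ₚ -ₚ a *ₚ (b ^ₚ j)) (upTo k))

qint : ℕ → Poly
qint m = sumₚ (map qpow (upTo m))

infix 4 _∣ₚ_
_∣ₚ_ : Poly → Poly → Set
d ∣ₚ p = ∃ λ c → p ≈ₚ c *ₚ d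

IsUnitₚ : Poly → Set
IsUnitₚ u = (u ≈ₚ const 1ℤ) ⊎ (u ≈ₚ const -1ℤ)

Coprimeₚ : Poly → Poly → Set
Coprimeₚ p r = ∀ d → d ∣ₚ p → d ∣ₚ r → IsUnitₚ d

NonZeroₚ : Poly → Set
NonZeroₚ p = ¬ (p ≈ₚ 0ₚ)

-- Cyclotomic polynomials, via q^n - 1 = ∏_{d ∣ n} Φ_d(q), i.e.
-- Φ_n = (q^n - 1) / ∏_{d ∣ n, d < n} Φ_d  (exact division by a monic polynomial)

private
  dropZerosRev : List ℤ → List ℤ
  dropZerosRev []           = []
  dropZerosRev ((+ zero) ∷ xs) = dropZerosRev xs
  dropZerosRev (x ∷ xs)     = x ∷ xs

  lastOr0 : List ℤ → ℤ
  lastOr0 []           = 0ℤ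
  lastOr0 (x ∷ [])     = x
  lastOr0 (x ∷ y ∷ xs) = lastOr0 (y ∷ xs)

normalize : Poly → Poly
normalize p = reverse (dropZerosRev (reverse p))

divMonicF : ℕ → Poly → Poly → Poly
divMonicF zero    a b = []
divMonicF (suc f) a b =
  let a' = normalize a
      b' = normalize b
      da = length a'
      db = length b'
  in if does (da ℕ.<? db) then []
     else (let t = replicate (da ℕ.∸ db) 0ℤ ++ [ lastOr0 a' ]
           in t +ₚ divMonicF f (a' -ₚ t *ₚ b') b')

divMonic : Poly → Poly → Poly
divMonic a b = divMonicF (suc (length a)) a b

properDivisors : ℕ → List ℕ
properDivisors n = filter (λ d → d ∣? n) (map suc (upTo (n ℕ.∸ 1)))

cycF : ℕ → ℕ → Poly
cycF zero    n = 1ₚ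
cycF (suc f) n = divMonic (qpow n -ₚ 1ₚ) (prodₚ (map (cycF f) (properDivisors n)))

Φ : ℕ → Poly
Φ n = normalize (cycF n n)

legendre : ℤ → ℕ → ℤ
legendre a zero = 0ℤ
legendre a p@(suc m) =
  if does ((a %ℕ p) ℕ.≟ 0) then 0ℤ
  else (if any (λ x → does (((+ (x ℕ.* x)) ℤ.- a) %ℕ p ℕ.≟ 0)) (upTo p)
        then 1ℤ else -1ℤ)

leastDivF : ℕ → ℕ → ℕ → ℕ
leastDivF zero    d n = n
leastDivF (suc f) d n = if does (d ∣? n) then d else leastDivF f (suc d) n

leastPrimeDiv : ℕ → ℕ
leastPrimeDiv n = leastDivF n 2 n

private
  quot : ℕ → ℕ → ℕ
  quot n zero    = n
  quot n (suc m) = n ℕ./ suc m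

jacobiF : ℕ → ℤ → ℕ → ℤ
jacobiF zero    a n = 1ℤ
jacobiF (suc f) a n =
  if does (n ℕ.≤? 1) then 1ℤ
  else (let p = leastPrimeDiv n
        in legendre a p ℤ.* jacobiF f a (quot n p))

jacobi : ℤ → ℕ → ℤ
jacobi a n = jacobiF n a n

-- Rational functions in q as fractions num / den (den ≠ 0 in all uses)

record Frac : Set where
  constructor _／_
  field
    num : Poly
    den : Poly
open Frac public

infixl 6 _+f_ _-f_
_+f_ : Frac → Frac → Frac
(a ／ b) +f (c ／ d) = (a *ₚ d +ₚ c *ₚ b) ／ (b *ₚ d)

_-f_ : Frac → Frac → Frac
(a ／ b) -f (c ／ d) = (a *ₚ d -ₚ c *ₚ b) ／ (b *ₚ d)

infix 4 _≈f_
_≈f_ : Frac → Frac → Set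
(a ／ b) ≈f (c ／ d) = a *ₚ d ≈ₚ c *ₚ b

sumF : List Frac → Frac
sumF = foldr _+f_ (0ₚ ／ 1ₚ)

_≡_modₚ_ : Frac → Frac → Poly → Set
A ≡ B modₚ P = Σ Poly λ A₁ → Σ Poly λ A₂ →
  NonZeroₚ A₂ × (P ∣ₚ A₁) × Coprimeₚ P A₂ × ((A -f B) ≈f (A₁ ／ A₂))

q¹ q² q⁶ : Poly
q¹ = qpow 1
q² = qpow 2
q⁶ = qpow 6

term : ℕ → Frac
term k =
  (((poch q¹ q² k) ^ₚ 2) *ₚ poch q¹ q² (2 ℕ.* k) *ₚ qint (8 ℕ.* k ℕ.+ 1) *ₚ qpow (2 ℕ.* k ℕ.* k))
  ／ (poch q² q² (2 ℕ.* k) *ₚ ((poch q⁶ q⁶ k) ^ₚ 2))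

lhs : ℕ → Frac
lhs n = sumF (map term (upTo n))

rhs : ℕ → Frac
rhs n = (const (jacobi (ℤ.- (+ 3)) n) *ₚ qint n) ／ qpow ((n ℕ.∸ 1) ℕ./ 2)

-- Put ⟨i,m⟩ = (q^m − q^i)(1 − q^(m+i)), the determinant of the vectors (q^m, 1 + q^2m) and (q^i, 1 + q^2i).  Replacing
-- the factors (1 − q^i)² that come from (q;q²)_k² and (q⁶;q⁶)_k² by ⟨i,m⟩ deforms the sum into S(m), with S(0) the
-- original one.  For odd m the sum terminates, and a Wilf–Zeilberger pair with step m ↦ m + 6 gives
-- S(m) = (−3/m) q^(−(m−1)/2) [m].  Multiplied by C(m) = ∏_{0<j<n} ⟨6j,m⟩ it is a form of degree n − 1 in (q^m, 1 + q^2m),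
-- so Lagrange interpolation at m = 1, 3, …, 2n − 1 yields
--   S(0) = Σ_m S(m) C(m)/C(0) ∏_{m′≠m} ⟨0,m′⟩/⟨m,m′⟩.
-- For d ∣ n, d > 1, counting the multiples of d in arithmetic progressions of length n shows that the summand at m has
-- order at least 3 at Φ_d when d ∤ m and at least 1 when d ∣ m.  For d = n this leaves m = n, whose weight is
-- ≡ 1 mod Φ_n² because ⟨i,n⟩ ≡ q^n ⟨i,0⟩ mod (1 − q^n)².  The symbol (−3/p) is read off from the cycles of maps of
-- order 3 on the residues modulo p.

module Submission where

import Algebra.Properties.Semiring.Exp
import Data.Integer.Properties as ℤ
import Data.Nat.Divisibility as ℕ
import Data.Nat.DivMod as ℕ
import Data.Nat.Properties as ℕ
import Relation.Binary.PropositionalEquality as ≡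
import Relation.Binary.Reasoning.Setoid
open import Algebra.Bundles using (CommutativeRing)
open import Data.Empty using (⊥-elim)
open import Data.Integer as ℤ using (ℤ; +_; -[1+_]; 0ℤ; 1ℤ; -1ℤ)
open import Data.Integer.Tactic.RingSolver using (solve-∀)
open import Data.Nat as ℕ using (ℕ; zero; suc; _≤_; _<_; s≤s; z≤n)
open import Data.Nat.Tactic.RingSolver using () renaming (solve-∀ to solveℕ-∀)
open import Data.Product using (∃; _×_; _,_; proj₁; proj₂)
open import Data.Sum using (_⊎_; inj₁; inj₂; [_,_]′)
open import Function using (case_of_)
open import Level using (0ℓ)
open import Relation.Nullary using (yes; no; ¬_; does)
open import Relation.Nullary.Decidable using (dec-true; dec-false)
open ≡ using (_≡_; _≢_)
open import Data.Maybe using (Maybe; just; nothing)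

-- A congruence of fractions asks for a denominator coprime with the modulus in ℤ[q], and the given
-- denominators fail this: (q²;q²)_2k shares factors with qⁿ - 1. Central q-binomial coefficients
-- absorb these factors and leave products of 1 + q^j and 1 + q^2j + q^4j, which divide 2 and 3
-- modulo qⁿ - 1. A common divisor with the modulus is then a constant, and it is ±1 because qⁿ - 1
-- has constant term -1. The order 3 is 2 + 1. C(0) lacks the bracket j = 0, which would count with
-- order 2, and the Lagrange denominator at m lacks the bracket of m with itself, which would count
-- with order 1 when d ∤ m. Orders at Φ_d live in the total ring of fractions of ℤ[q]; the
-- admissible local denominators are the elements regular modulo Φ_d, and squarefreeness of q^i - 1,
-- proved with the formal derivative, supplies them. All sums are multiplied by 1 - q, so that
-- [8k+1] becomes 1 - q^(8k+1); this costs a factor Φ_1, which is restored at the end.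

-- Ring solver with integer coefficients over a commutative ring

module IntegerCoefficients (R : CommutativeRing 0ℓ 0ℓ) where
  open import Data.Integer using (_⊖_)
  open CommutativeRing R
  open import Algebra.Properties.Ring ring using (-‿distribˡ-*; -‿distribʳ-*)
  open import Algebra.Properties.AbelianGroup +-abelianGroup using (⁻¹-involutive; ε⁻¹≈ε; ⁻¹-∙-comm)
  open import Algebra.Properties.Semiring.Mult.TCOptimised semiring renaming (_×_ to _⋅_)
  open import Algebra.Solver.Ring.AlmostCommutativeRing
  open import Relation.Binary.Reasoning.Setoid setoid

  ⟦_⟧ℤ : ℤ → Carrier
  ⟦ + n ⟧ℤ      = n ⋅ 1#
  ⟦ -[1+ n ] ⟧ℤ = - (suc n ⋅ 1#)

  private
    cancel : ∀ x a b → a - b ≈ (x + a) - (x + b)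
    cancel x a b = sym (begin
      (x + a) - (x + b)       ≈⟨ +-congˡ (⁻¹-∙-comm x b) ⟨
      (x + a) + (- x + - b)   ≈⟨ +-congʳ (+-comm x a) ⟩
      (a + x) + (- x + - b)   ≈⟨ +-assoc a x _ ⟩
      a + (x + (- x + - b))   ≈⟨ +-congˡ (+-assoc x (- x) (- b)) ⟨
      a + ((x - x) - b)       ≈⟨ +-congˡ (+-congʳ (-‿inverseʳ x)) ⟩
      a + (0# - b)            ≈⟨ +-congˡ (+-identityˡ (- b)) ⟩
      a - b                   ∎)

  ⊖-homo : ∀ m n → ⟦ m ⊖ n ⟧ℤ ≈ m ⋅ 1# - n ⋅ 1#
  ⊖-homo m zero = trans (sym (+-identityʳ _)) (+-congˡ (sym ε⁻¹≈ε))
  ⊖-homo zero (suc n) = sym (+-identityˡ _)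
  ⊖-homo (suc m) (suc n) = begin
    ⟦ suc m ⊖ suc n ⟧ℤ                ≡⟨ ≡.cong ⟦_⟧ℤ (ℤ.[1+m]⊖[1+n]≡m⊖n m n) ⟩
    ⟦ m ⊖ n ⟧ℤ                        ≈⟨ ⊖-homo m n ⟩
    m ⋅ 1# - n ⋅ 1#                   ≈⟨ cancel 1# _ _ ⟩
    (1# + m ⋅ 1#) - (1# + n ⋅ 1#)     ≈⟨ +-cong (1+× m 1#) (-‿cong (1+× n 1#)) ⟨
    suc m ⋅ 1# - suc n ⋅ 1#           ∎

  +-homo : ∀ i j → ⟦ i ℤ.+ j ⟧ℤ ≈ ⟦ i ⟧ℤ + ⟦ j ⟧ℤ
  +-homo (+ m) (+ n) = ×-homo-+ 1# m n
  +-homo (+ m) -[1+ n ] = ⊖-homo m (suc n)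
  +-homo -[1+ m ] (+ n) = trans (⊖-homo n (suc m)) (+-comm _ _)
  +-homo -[1+ m ] -[1+ n ] = begin
    - (suc (suc (m ℕ.+ n)) ⋅ 1#)        ≡⟨ ≡.cong (λ k → - (k ⋅ 1#)) (≡.cong suc (≡.sym (ℕ.+-suc m n))) ⟩
    - ((suc m ℕ.+ suc n) ⋅ 1#)          ≈⟨ -‿cong (×-homo-+ 1# (suc m) (suc n)) ⟩
    - (suc m ⋅ 1# + suc n ⋅ 1#)         ≈⟨ ⁻¹-∙-comm _ _ ⟨
    - (suc m ⋅ 1#) + - (suc n ⋅ 1#)     ∎

  -‿homo : ∀ i → ⟦ ℤ.- i ⟧ℤ ≈ - ⟦ i ⟧ℤ
  -‿homo (+ zero) = sym ε⁻¹≈ε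
  -‿homo (+ suc n) = refl
  -‿homo -[1+ n ] = sym (⁻¹-involutive _)

  private
    pos*neg : ∀ m n → ⟦ + m ℤ.* (ℤ.- (+ n)) ⟧ℤ ≈ (m ⋅ 1#) * - (n ⋅ 1#)
    pos*neg m n = begin
      ⟦ + m ℤ.* (ℤ.- (+ n)) ⟧ℤ   ≡⟨ ≡.cong ⟦_⟧ℤ (≡.trans (≡.sym (ℤ.neg-distribʳ-* (+ m) (+ n))) (≡.cong ℤ.-_ (≡.sym (ℤ.pos-* m n)))) ⟩
      ⟦ ℤ.- (+ (m ℕ.* n)) ⟧ℤ     ≈⟨ -‿homo (+ (m ℕ.* n)) ⟩
      - ((m ℕ.* n) ⋅ 1#)         ≈⟨ -‿cong (×1-homo-* m n) ⟩
      - ((m ⋅ 1#) * (n ⋅ 1#))    ≈⟨ -‿distribʳ-* _ _ ⟩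
      (m ⋅ 1#) * - (n ⋅ 1#)      ∎

  *-homo : ∀ i j → ⟦ i ℤ.* j ⟧ℤ ≈ ⟦ i ⟧ℤ * ⟦ j ⟧ℤ
  *-homo (+ m) (+ n) = trans (reflexive (≡.cong ⟦_⟧ℤ (≡.sym (ℤ.pos-* m n)))) (×1-homo-* m n)
  *-homo (+ m) -[1+ n ] = pos*neg m (suc n)
  *-homo -[1+ m ] (+ n) = begin
    ⟦ -[1+ m ] ℤ.* + n ⟧ℤ    ≡⟨ ≡.cong ⟦_⟧ℤ (ℤ.*-comm -[1+ m ] (+ n)) ⟩
    ⟦ + n ℤ.* -[1+ m ] ⟧ℤ    ≈⟨ pos*neg n (suc m) ⟩
    (n ⋅ 1#) * - (suc m ⋅ 1#) ≈⟨ *-comm _ _ ⟩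
    - (suc m ⋅ 1#) * (n ⋅ 1#) ∎
  *-homo -[1+ m ] -[1+ n ] = begin
    ⟦ -[1+ m ] ℤ.* -[1+ n ] ⟧ℤ            ≈⟨ ×1-homo-* (suc m) (suc n) ⟩
    (suc m ⋅ 1#) * (suc n ⋅ 1#)           ≈⟨ ⁻¹-involutive _ ⟨
    - - ((suc m ⋅ 1#) * (suc n ⋅ 1#))     ≈⟨ -‿cong (-‿distribʳ-* _ _) ⟩
    - ((suc m ⋅ 1#) * - (suc n ⋅ 1#))     ≈⟨ -‿distribˡ-* _ _ ⟩
    - (suc m ⋅ 1#) * - (suc n ⋅ 1#)       ∎

  morphism : ℤ.+-*-rawRing -Raw-AlmostCommutative⟶ fromCommutativeRing R
  morphism = record
    { ⟦_⟧ = ⟦_⟧ℤ ; +-homo = +-homo ; *-homo = *-homo ; -‿homo = -‿homo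
    ; 0-homo = refl ; 1-homo = refl }

  -- Coefficients are compared in ℤ, where equality is decidable; in R it may not be.
  _coeff≟_ : ∀ i j → Maybe (⟦ i ⟧ℤ ≈ ⟦ j ⟧ℤ)
  i coeff≟ j with i ℤ.≟ j
  ... | yes i≡j = just (reflexive (≡.cong ⟦_⟧ℤ i≡j))
  ... | no _    = nothing

  open import Algebra.Solver.Ring ℤ.+-*-rawRing (fromCommutativeRing R) morphism _coeff≟_ public
    using (solve; _:=_; con; _:+_; _:*_; _:-_; :-_; _:^_; Polynomial)

-- Finite sums, finite products and units

module Ranges (R : CommutativeRing 0ℓ 0ℓ) where
  open CommutativeRing R
  open IntegerCoefficients R
  open import Algebra.Properties.Semiring.Exp semiring using (_^_)
  open import Relation.Binary.Reasoning.Setoid setoid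

  ∑ ∏ : (ℕ → Carrier) → ℕ → Carrier
  ∑ f zero    = 0#
  ∑ f (suc n) = ∑ f n + f n
  ∏ f zero    = 1#
  ∏ f (suc n) = ∏ f n * f n

  ∑-cong : ∀ {f g} n → (∀ i → i < n → f i ≈ g i) → ∑ f n ≈ ∑ g n
  ∑-cong zero    eq = refl
  ∑-cong (suc n) eq = +-cong (∑-cong n (λ i i<n → eq i (ℕ.m<n⇒m<1+n i<n))) (eq n ℕ.≤-refl)

  ∏-cong : ∀ {f g} n → (∀ i → i < n → f i ≈ g i) → ∏ f n ≈ ∏ g n
  ∏-cong zero    eq = refl
  ∏-cong (suc n) eq = *-cong (∏-cong n (λ i i<n → eq i (ℕ.m<n⇒m<1+n i<n))) (eq n ℕ.≤-refl)

  *-distribˡ-∑ : ∀ x f n → x * ∑ f n ≈ ∑ (λ i → x * f i) n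
  *-distribˡ-∑ x f zero    = zeroʳ x
  *-distribˡ-∑ x f (suc n) = trans (distribˡ x _ _) (+-congʳ (*-distribˡ-∑ x f n))

  ∑-+ : ∀ f g n → ∑ (λ i → f i + g i) n ≈ ∑ f n + ∑ g n
  ∑-+ f g zero    = sym (+-identityˡ 0#)
  ∑-+ f g (suc n) = trans (+-congʳ (∑-+ f g n))
    (solve 4 (λ a b c d → (a :+ b) :+ (c :+ d) := (a :+ c) :+ (b :+ d)) refl _ _ _ _)

  ∏-* : ∀ f g n → ∏ (λ i → f i * g i) n ≈ ∏ f n * ∏ g n
  ∏-* f g zero    = sym (*-identityˡ 1#)
  ∏-* f g (suc n) = trans (*-congʳ (∏-* f g n))
    (solve 4 (λ a b c d → (a :* b) :* (c :* d) := (a :* c) :* (b :* d)) refl _ _ _ _)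

  ∑-front : ∀ f n → ∑ f (suc n) ≈ f 0 + ∑ (λ i → f (suc i)) n
  ∑-front f zero    = +-comm _ _
  ∑-front f (suc n) = trans (+-congʳ (∑-front f n)) (+-assoc _ _ _)

  ∏-front : ∀ f n → ∏ f (suc n) ≈ f 0 * ∏ (λ i → f (suc i)) n
  ∏-front f zero    = *-comm _ _
  ∏-front f (suc n) = trans (*-congʳ (∏-front f n)) (*-assoc _ _ _)

  ∑-comm : ∀ (f : ℕ → ℕ → Carrier) m n → ∑ (λ i → ∑ (f i) n) m ≈ ∑ (λ j → ∑ (λ i → f i j) m) n
  ∑-comm f zero    n = sym (∑-zero n)
    where
    ∑-zero : ∀ n → ∑ (λ _ → 0#) n ≈ 0#
    ∑-zero zero    = refl
    ∑-zero (suc n) = trans (+-identityʳ _) (∑-zero n)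
  ∑-comm f (suc m) n = trans (+-congʳ (∑-comm f m n)) (sym (∑-+ _ _ n))

  ∏-+ : ∀ f m n → ∏ f (m ℕ.+ n) ≈ ∏ f m * ∏ (λ i → f (m ℕ.+ i)) n
  ∏-+ f m zero    = trans (reflexive (≡.cong (∏ f) (ℕ.+-identityʳ m))) (sym (*-identityʳ _))
  ∏-+ f m (suc n) = begin
    ∏ f (m ℕ.+ suc n)                                 ≡⟨ ≡.cong (∏ f) (ℕ.+-suc m n) ⟩
    ∏ f (m ℕ.+ n) * f (m ℕ.+ n)                       ≈⟨ *-congʳ (∏-+ f m n) ⟩
    (∏ f m * ∏ (λ i → f (m ℕ.+ i)) n) * f (m ℕ.+ n)   ≈⟨ *-assoc _ _ _ ⟩
    ∏ f m * ∏ (λ i → f (m ℕ.+ i)) (suc n)             ∎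

  ∑-truncate : ∀ f {N} n → N ≤ n → (∀ k → N ≤ k → f k ≈ 0#) → ∑ f n ≈ ∑ f N
  ∑-truncate f n N≤n f≈0 with ℕ.m≤n⇒m<n∨m≡n N≤n
  ∑-truncate f n N≤n f≈0 | inj₂ ≡.refl = refl
  ∑-truncate f (suc n) N≤n f≈0 | inj₁ (s≤s N≤n′) =
    trans (+-cong (∑-truncate f n N≤n′ f≈0) (f≈0 n N≤n′)) (+-identityʳ _)

  Unit : Carrier → Set
  Unit x = ∃ λ y → x * y ≈ 1#

  unit-resp : ∀ {x y} → x ≈ y → Unit x → Unit y
  unit-resp x≈y (z , xz≈1) = z , trans (*-congʳ (sym x≈y)) xz≈1

  unit-* : ∀ {x y} → Unit x → Unit y → Unit (x * y)
  unit-* {x} {y} (u , xu) (v , yv) = u * v , (begin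
    (x * y) * (u * v) ≈⟨ solve 4 (λ x y u v → (x :* y) :* (u :* v) := (x :* u) :* (y :* v)) refl x y u v ⟩
    (x * u) * (y * v) ≈⟨ *-cong xu yv ⟩
    1# * 1#           ≈⟨ *-identityˡ 1# ⟩
    1#                ∎)

  unit-- : ∀ {x} → Unit x → Unit (- x)
  unit-- {x} (u , xu) = - u , trans (solve 2 (λ x u → (:- x) :* (:- u) := x :* u) refl x u) xu

  unit-1 : Unit 1#
  unit-1 = 1# , *-identityˡ 1#

  unit-cancel : ∀ {u x y} → Unit u → x * u ≈ y * u → x ≈ y
  unit-cancel {u} {x} {y} (v , uv) xu≈yu = begin
    x             ≈⟨ lemma x ⟨
    (x * u) * v   ≈⟨ *-congʳ xu≈yu ⟩
    (y * u) * v   ≈⟨ lemma y ⟩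
    y             ∎
    where
    lemma : ∀ x → (x * u) * v ≈ x
    lemma x = trans (*-assoc x u v) (trans (*-congˡ uv) (*-identityʳ x))

  unit-^ : ∀ {x} → Unit x → ∀ k → Unit (x ^ k)
  unit-^ u zero    = unit-1
  unit-^ u (suc k) = unit-* u (unit-^ u k)

  unit-∏ : ∀ f n → (∀ i → i < n → Unit (f i)) → Unit (∏ f n)
  unit-∏ f zero    _ = unit-1
  unit-∏ f (suc n) u = unit-* (unit-∏ f n (λ i i<n → u i (ℕ.m<n⇒m<1+n i<n))) (u n ℕ.≤-refl)

-- The deformed sum and its evaluation at odd exponents

module CubicSum (R : CommutativeRing 0ℓ 0ℓ) (q : CommutativeRing.Carrier R) where
  open CommutativeRing R
  open IntegerCoefficients R
  open Ranges R
  open import Algebra.Properties.Semiring.Exp semiring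
  open import Relation.Binary.Reasoning.Setoid setoid

  private
    T : ℕ → Carrier
    T k = q ^ k

  -- With t = q^k and y = q^m, `num y t` over `den y t` is the ratio of the summands at k + 1 and k.
  -- The factors `num₀` and `den₀` come from q^(2k²) (q;q²)_2k / (q²;q²)_2k; the others are the
  -- brackets ⟨2k+1,m⟩ and ⟨6k+6,m⟩.
  num₀ den₀ : Carrier → Carrier
  num₀ t = q ^ 2 * t ^ 4 * ((1# - q * t ^ 4) * (1# - q ^ 3 * t ^ 4))
  den₀ t = (1# - q ^ 2 * t ^ 4) * (1# - q ^ 4 * t ^ 4)

  num den : Carrier → Carrier → Carrier
  num y t = num₀ t * ((y - q * t ^ 2) * (1# - y * (q * t ^ 2)))
  den y t = den₀ t * ((y - q ^ 6 * t ^ 6) * (1# - y * (q ^ 6 * t ^ 6)))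

  -- This is (1 - q)[8k + 1]; the factor 1 - q makes it a polynomial in q and q^k.
  weight : ℕ → Carrier
  weight k = 1# - q * T k ^ 8

  -- A hypergeometric sequence with term ratio n/d, cross-multiplied so that it makes sense in every
  -- ring; it terminates where n vanishes, provided that all d are units.
  record HTerm (n d : ℕ → Carrier) (h : ℕ → Carrier) : Set where
    field
      h-zero : h 0 ≈ 1#
      h-suc  : ∀ k → h (suc k) * d k ≈ h k * n k
  open HTerm

  hterm : ∀ n d → (∀ k → Unit (d k)) → ∃ (HTerm n d)
  hterm n d u = h , record { h-zero = refl ; h-suc = λ k → begin
      ((h k * n k) * proj₁ (u k)) * d k ≈⟨ solve 3 (λ a b c → (a :* b) :* c := a :* (c :* b)) refl _ _ _ ⟩
      (h k * n k) * (d k * proj₁ (u k)) ≈⟨ *-congˡ (proj₂ (u k)) ⟩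
      (h k * n k) * 1#                  ≈⟨ *-identityʳ _ ⟩
      h k * n k                         ∎ }
    where
    h : ℕ → Carrier
    h zero    = 1#
    h (suc k) = (h k * n k) * proj₁ (u k)

  hterm-vanishes : ∀ {n d h} → HTerm n d h → (∀ k → Unit (d k)) →
                   ∀ {k₀} → n k₀ ≈ 0# → ∀ k → k₀ < k → h k ≈ 0#
  hterm-vanishes {n} {d} {h} H u {k₀} n≈0 (suc k) (s≤s k₀≤k) = unit-cancel (u k) (begin
    h (suc k) * d k ≈⟨ h-suc H k ⟩
    h k * n k       ≈⟨ zero-factor (ℕ.m≤n⇒m<n∨m≡n k₀≤k) ⟩
    0#              ≈⟨ zeroˡ _ ⟨
    0# * d k        ∎)
    where
    zero-factor : _ → h k * n k ≈ 0#
    zero-factor (inj₁ k₀<k)   = trans (*-congʳ (hterm-vanishes H u n≈0 k k₀<k)) (zeroˡ _)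
    zero-factor (inj₂ ≡.refl) = trans (*-congˡ n≈0) (zeroʳ _)

  Summand : Carrier → (ℕ → Carrier) → Set
  Summand y = HTerm (λ k → num y (T k)) (λ k → den y (T k))

  cubicSum : (ℕ → Carrier) → ℕ → Carrier
  cubicSum h = ∑ (λ k → weight k * h k)

  -- Wilf–Zeilberger step y ↦ q⁶y.  Both summands are polynomial multiples of H, so the certificate has no denominators
  -- that vanish where the sums terminate.
  module Step (y : Carrier) (units₁ : ∀ i → Unit (1# - y * q ^ i)) (units₂ : ∀ i → Unit (y - q ^ (2 ℕ.* i)))
              (unit-q : Unit q) (units-den₀ : ∀ k → Unit (den₀ (T k)))
              {A B : ℕ → Carrier} (hA : Summand (y * q ^ 6) A) (hB : Summand y B) where

    -- The value of `pA` at t = 1; that of `pB` is -q⁶ `Π`.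
    Π : Carrier
    Π = (1# - y * q) * (1# - y * q ^ 3) * (1# - y * q ^ 5)

    -- `H` takes one half of its numerator from each summand: yq⁵ - t² from `A`, up to a power of q,
    -- and 1 - yqt² from `B`. The remaining numerator factors of `A` and `B` are these same factors
    -- moved by three indices, because q⁶ = (q²)³, and the denominators are moved by one index. So
    -- the quotients `A`/`H` and `B`/`H` collapse to finitely many factors: `pA`, `pB`, y - t⁶ and 1
    -- - yq⁶t⁶.
    pA pB numH denH : Carrier → Carrier
    pA t = (1# - y * (q * t ^ 2)) * (1# - y * (q ^ 3 * t ^ 2)) * (1# - y * (q ^ 5 * t ^ 2))
    pB t = (y * q ^ 5 - t ^ 2) * (y * q ^ 5 - q ^ 2 * t ^ 2) * (y * q ^ 5 - q ^ 4 * t ^ 2)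
    numH t = num₀ t * ((y * q ^ 5 - t ^ 2) * (1# - y * (q * t ^ 2)))
    denH t = den₀ t * (q ^ 5 * ((y - q ^ 6 * t ^ 6) * (1# - y * (q ^ 6 * t ^ 6))))

    T-pow : ∀ a b k → q ^ (a ℕ.+ k ℕ.* b) ≈ q ^ a * T k ^ b
    T-pow a b k = trans (^-homo-* q a (k ℕ.* b)) (*-congˡ (sym (^-assocʳ q k b)))

    unit-q^ : ∀ k → Unit (q ^ k)
    unit-q^ = unit-^ unit-q

    unit₁ : ∀ k a → Unit (1# - y * (q ^ a * T k ^ 6))
    unit₁ k a = unit-resp (+-congˡ (-‿cong (*-congˡ (T-pow a 6 k)))) (units₁ (a ℕ.+ k ℕ.* 6))

    unit₂ : ∀ k → Unit (y - T k ^ 6)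
    unit₂ k = unit-resp (+-congˡ (-‿cong (trans (^-congʳ q (≡.trans (≡.sym (ℕ.*-assoc 2 k 3))
        (≡.trans (≡.cong (ℕ._* 3) (ℕ.*-comm 2 k)) (ℕ.*-assoc k 2 3)))) (sym (^-assocʳ q k 6)))))
      (units₂ (k ℕ.* 3))

    unit₃ : ∀ k → Unit (y - q ^ 6 * T k ^ 6)
    unit₃ k = unit-resp (+-congˡ (-‿cong
      (solve 2 (λ q t → (q :* t) :^ 6 := q :^ 6 :* t :^ 6) refl q (T k)))) (unit₂ (suc k))

    unit-denH : ∀ k → Unit (denH (T k))
    unit-denH k = unit-* (units-den₀ k) (unit-* (unit-q^ 5) (unit-* (unit₃ k) (unit₁ k 6)))

    unit-denB : ∀ k → Unit (den y (T k))
    unit-denB k = unit-* (units-den₀ k) (unit-* (unit₃ k) (unit₁ k 6))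

    unit-denA : ∀ k → Unit (den (y * q ^ 6) (T k))
    unit-denA k = unit-* (units-den₀ k) (unit-*
      (unit-resp (solve 3 (λ q y t → q :^ 6 :* (y :- t :^ 6) := y :* q :^ 6 :- q :^ 6 :* t :^ 6) refl q y (T k))
        (unit-* (unit-q^ 6) (unit₂ k)))
      (unit-resp (solve 3 (λ q y t → con (+ 1) :- y :* (q :^ 12 :* t :^ 6) := con (+ 1) :- y :* q :^ 6 :* (q :^ 6 :* t :^ 6))
          refl q y (T k)) (unit₁ k 12)))

    H : ℕ → Carrier
    H = proj₁ (hterm (λ k → numH (T k)) (λ k → denH (T k)) unit-denH)
    hH : HTerm (λ k → numH (T k)) (λ k → denH (T k)) H
    hH = proj₂ (hterm (λ k → numH (T k)) (λ k → denH (T k)) unit-denH)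

    module _ {h n d} (hh : HTerm n d h) (unit-d : ∀ k → Unit (d k)) where
      -- Both sides satisfy the same recurrence of order one. The fraction p/r is the quotient of
      -- `h` by `H` up to the constant c, which fixes the value at 0.
      proportional : ∀ c (p r : ℕ → Carrier) → c * r 0 ≈ p 0 →
        (∀ k → p k * n k * r (suc k) * denH (T k) ≈ p (suc k) * numH (T k) * r k * d k) →
        (∀ k → Unit (r k)) →
        ∀ k → h k * c * r k ≈ H k * p k
      proportional c p r base step unit-r zero = begin
        h 0 * c * r 0   ≈⟨ *-assoc _ _ _ ⟩
        h 0 * (c * r 0) ≈⟨ *-cong (h-zero hh) base ⟩
        1# * p 0        ∎
      proportional c p r base step unit-r (suc k) = unit-cancel (unit-* (unit-* (unit-d k) (unit-denH k)) (unit-r k)) (begin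
        h (suc k) * c * r (suc k) * ((d k * denH (T k)) * r k)
          ≈⟨ solve 6 (λ x c r′ d e r → x :* c :* r′ :* ((d :* e) :* r) := (x :* d) :* (c :* r′ :* e :* r)) refl _ _ _ _ _ _ ⟩
        (h (suc k) * d k) * (c * r (suc k) * denH (T k) * r k)
          ≈⟨ *-congʳ (h-suc hh k) ⟩
        (h k * n k) * (c * r (suc k) * denH (T k) * r k)
          ≈⟨ solve 6 (λ x c r′ n e r → (x :* n) :* (c :* r′ :* e :* r) := (x :* c :* r) :* (n :* r′ :* e)) refl _ _ _ _ _ _ ⟩
        (h k * c * r k) * (n k * r (suc k) * denH (T k))
          ≈⟨ *-congʳ (proportional c p r base step unit-r k) ⟩
        (H k * p k) * (n k * r (suc k) * denH (T k))
          ≈⟨ solve 5 (λ x p r′ n e → (x :* p) :* (n :* r′ :* e) := x :* (p :* n :* r′ :* e)) refl _ _ _ _ _ ⟩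
        H k * (p k * n k * r (suc k) * denH (T k))
          ≈⟨ *-congˡ (step k) ⟩
        H k * (p (suc k) * numH (T k) * r k * d k)
          ≈⟨ solve 5 (λ x p n r d → x :* (p :* n :* r :* d) := (x :* n) :* (p :* r :* d)) refl _ _ _ _ _ ⟩
        (H k * numH (T k)) * (p (suc k) * r k * d k)
          ≈⟨ *-congʳ (h-suc hH k) ⟨
        (H (suc k) * denH (T k)) * (p (suc k) * r k * d k)
          ≈⟨ solve 5 (λ x e p r d → (x :* e) :* (p :* r :* d) := (x :* p) :* ((d :* e) :* r)) refl _ _ _ _ _ ⟩
        (H (suc k) * p (suc k)) * ((d k * denH (T k)) * r k) ∎)

    B≈H : ∀ k → B k * (- (q ^ 6) * Π) * 1# ≈ H k * pB (T k)
    B≈H = proportional hB unit-denB (- (q ^ 6) * Π) (λ k → pB (T k)) (λ _ → 1#)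
      (solve 2 (λ q y → let i = con (+ 1) in
        (:- (q :^ 6) :* ((i :- y :* q) :* (i :- y :* q :^ 3) :* (i :- y :* q :^ 5))) :* i
          := (y :* q :^ 5 :- i :^ 2) :* (y :* q :^ 5 :- q :^ 2 :* i :^ 2) :* (y :* q :^ 5 :- q :^ 4 :* i :^ 2)) refl q y)
      (λ k → solve 5 (λ q y t n₀ d₀ → let
          i = con (+ 1)
          e = (y :- q :^ 6 :* t :^ 6) :* (i :- y :* (q :^ 6 :* t :^ 6)) in
        (y :* q :^ 5 :- t :^ 2) :* (y :* q :^ 5 :- q :^ 2 :* t :^ 2) :* (y :* q :^ 5 :- q :^ 4 :* t :^ 2)
          :* (n₀ :* ((y :- q :* t :^ 2) :* (i :- y :* (q :* t :^ 2)))) :* i :* (d₀ :* (q :^ 5 :* e))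
        := (y :* q :^ 5 :- (q :* t) :^ 2) :* (y :* q :^ 5 :- q :^ 2 :* (q :* t) :^ 2) :* (y :* q :^ 5 :- q :^ 4 :* (q :* t) :^ 2)
          :* (n₀ :* ((y :* q :^ 5 :- t :^ 2) :* (i :- y :* (q :* t :^ 2)))) :* i :* (d₀ :* e)) refl q y (T k) (num₀ (T k)) (den₀ (T k)))
      (λ _ → unit-1)

    A≈H : ∀ k → A k * (Π * (y - 1#)) * (1# - y * (q ^ 6 * T k ^ 6)) ≈ H k * (pA (T k) * (y - T k ^ 6) * (1# - y * q ^ 6))
    A≈H = proportional hA unit-denA (Π * (y - 1#)) (λ k → pA (T k) * (y - T k ^ 6) * (1# - y * q ^ 6))
      (λ k → 1# - y * (q ^ 6 * T k ^ 6))
      (solve 2 (λ q y → let i = con (+ 1) in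
        ((i :- y :* q) :* (i :- y :* q :^ 3) :* (i :- y :* q :^ 5)) :* (y :- i) :* (i :- y :* (q :^ 6 :* i :^ 6))
        := ((i :- y :* (q :* i :^ 2)) :* (i :- y :* (q :^ 3 :* i :^ 2)) :* (i :- y :* (q :^ 5 :* i :^ 2)))
           :* (y :- i :^ 6) :* (i :- y :* q :^ 6)) refl q y)
      (λ k → solve 6 (λ q y t n₀ d₀ z → let
          i = con (+ 1)
          u = (y :- q :^ 6 :* t :^ 6) in
        ((i :- y :* (q :* t :^ 2)) :* (i :- y :* (q :^ 3 :* t :^ 2)) :* (i :- y :* (q :^ 5 :* t :^ 2)) :* (y :- t :^ 6) :* z)
          :* (n₀ :* ((y :* q :^ 6 :- q :* t :^ 2) :* (i :- y :* q :^ 6 :* (q :* t :^ 2))))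
          :* (i :- y :* (q :^ 6 :* (q :* t) :^ 6)) :* (d₀ :* (q :^ 5 :* (u :* (i :- y :* (q :^ 6 :* t :^ 6)))))
        := ((i :- y :* (q :* (q :* t) :^ 2)) :* (i :- y :* (q :^ 3 :* (q :* t) :^ 2)) :* (i :- y :* (q :^ 5 :* (q :* t) :^ 2))
             :* (y :- (q :* t) :^ 6) :* z)
          :* (n₀ :* ((y :* q :^ 5 :- t :^ 2) :* (i :- y :* (q :* t :^ 2))))
          :* (i :- y :* (q :^ 6 :* t :^ 6))
          :* (d₀ :* ((y :* q :^ 6 :- q :^ 6 :* t :^ 6) :* (i :- y :* q :^ 6 :* (q :^ 6 :* t :^ 6))))) refl q y (T k) (num₀ (T k)) (den₀ (T k))
            (1# - y * q ^ 6))
      (λ k → unit₁ k 6)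

    -- The Wilf-Zeilberger equation divided by `H` and `s`, and multiplied by q⁶(1 - yq⁶t⁶) to clear
    -- denominators: the difference of the two weighted summands is the increment of `c` `Z` `H`.
    -- The left side is the new value of that product, rewritten by the recurrence of `H`.
    certificate : ∀ q y t → let
        w = 1# - q * t ^ 8
        z = y * q ^ 5 in
      q * (1# - y ^ 2 * q ^ 6) * (q ^ 3 * (q ^ 2 * t ^ 4 * ((1# - q * t ^ 4) * (1# - q ^ 3 * t ^ 4)) * ((z - t ^ 2) * (1# - y * (q * t ^ 2)))))
      ≈ w * ((1# - y * (q ^ 6 * t ^ 6)) * ((z - t ^ 2) * (z - q ^ 2 * t ^ 2) * (z - q ^ 4 * t ^ 2)))
      - w * (q ^ 9 * ((1# - y * (q * t ^ 2)) * (1# - y * (q ^ 3 * t ^ 2)) * (1# - y * (q ^ 5 * t ^ 2)) * (y - t ^ 6)))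
      + q * (1# - y ^ 2 * q ^ 6) * ((1# - t ^ 4) * (q ^ 2 - t ^ 4) * (y - t ^ 6) * (q ^ 6 * (1# - y * (q ^ 6 * t ^ 6))))
    certificate = solve 3 (λ q y t → let
        i = con (+ 1)
        w = i :- q :* t :^ 8
        z = y :* q :^ 5 in
      q :* (i :- y :^ 2 :* q :^ 6) :* (q :^ 3 :* (q :^ 2 :* t :^ 4 :* ((i :- q :* t :^ 4) :* (i :- q :^ 3 :* t :^ 4)) :* ((z :- t :^ 2) :* (i :- y :* (q :* t :^ 2)))))
      := w :* ((i :- y :* (q :^ 6 :* t :^ 6)) :* ((z :- t :^ 2) :* (z :- q :^ 2 :* t :^ 2) :* (z :- q :^ 4 :* t :^ 2)))
      :- w :* (q :^ 9 :* ((i :- y :* (q :* t :^ 2)) :* (i :- y :* (q :^ 3 :* t :^ 2)) :* (i :- y :* (q :^ 5 :* t :^ 2)) :* (y :- t :^ 6)))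
      :+ q :* (i :- y :^ 2 :* q :^ 6) :* ((i :- t :^ 4) :* (q :^ 2 :- t :^ 4) :* (y :- t :^ 6) :* (q :^ 6 :* (i :- y :* (q :^ 6 :* t :^ 6))))) refl

    -- Up to a power of q and the factor 1 - yq⁶t⁶, `Z (q * t)` is `denH t`, so that `Z` at k + 1
    -- cancels the denominator in `H (suc k)`. The factor 1 - t⁴ makes the boundary term at k = 0
    -- vanish.
    Z : Carrier → Carrier
    Z t = (1# - t ^ 4) * (q ^ 2 - t ^ 4) * (y - t ^ 6)

    s c : Carrier
    s = 1# - y * q ^ 6
    c = q * (1# - y ^ 2 * q ^ 6)

    telescope : ∀ K → q ^ 3 * (1# - y) * Π * cubicSum A K - s * Π * cubicSum B K ≈ s * (c * (H K * Z (T K)))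
    telescope zero = solve 6 (λ q y p h s c → let i = con (+ 1) in
      q :^ 3 :* (i :- y) :* p :* con (+ 0) :- s :* p :* con (+ 0)
        := s :* (c :* (h :* ((i :- i :^ 4) :* (q :^ 2 :- i :^ 4) :* (y :- i :^ 6))))) refl q y Π (H 0) s c
    telescope (suc k) = begin
      q ^ 3 * (1# - y) * Π * (cubicSum A k + weight k * A k) - s * Π * (cubicSum B k + weight k * B k)
        ≈⟨ solve 8 (λ g y p a x s b z → g :* (con (+ 1) :- y) :* p :* (a :+ x) :- s :* p :* (b :+ z)
             := (g :* (con (+ 1) :- y) :* p :* a :- s :* p :* b) :+ (g :* (con (+ 1) :- y) :* p :* x :- s :* p :* z)) refl
             (q ^ 3) y Π (cubicSum A k) (weight k * A k) s (cubicSum B k) (weight k * B k) ⟩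
      (q ^ 3 * (1# - y) * Π * cubicSum A k - s * Π * cubicSum B k) + (q ^ 3 * (1# - y) * Π * (weight k * A k) - s * Π * (weight k * B k))
        ≈⟨ +-congʳ (telescope k) ⟩
      s * (c * (H k * Z (T k))) + (q ^ 3 * (1# - y) * Π * (weight k * A k) - s * Π * (weight k * B k))
        ≈⟨ unit-cancel (unit-* (unit-q^ 6) (unit₁ k 6)) step ⟩
      s * (c * (H (suc k) * Z (T (suc k)))) ∎
      where
      t = T k
      r = 1# - y * (q ^ 6 * t ^ 6)
      step : (s * (c * (H k * Z t)) + (q ^ 3 * (1# - y) * Π * (weight k * A k) - s * Π * (weight k * B k))) * (q ^ 6 * r)
           ≈ s * (c * (H (suc k) * Z (q * t))) * (q ^ 6 * r)
      step = begin
        (s * (c * (H k * Z t)) + (q ^ 3 * (1# - y) * Π * (weight k * A k) - s * Π * (weight k * B k))) * (q ^ 6 * r)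
          ≈⟨ solve 9 (λ q y p a b w s x r → (s :* x :+ (q :^ 3 :* (con (+ 1) :- y) :* p :* (w :* a) :- s :* p :* (w :* b))) :* (q :^ 6 :* r)
              := s :* x :* (q :^ 6 :* r) :+ (:- (q :^ 9 :* w :* (a :* (p :* (y :- con (+ 1))) :* r)) :+ s :* w :* r :* (b :* (:- (q :^ 6) :* p) :* con (+ 1)))) refl
              q y Π (A k) (B k) (weight k) s (c * (H k * Z t)) r ⟩
        s * (c * (H k * Z t)) * (q ^ 6 * r) + (- (q ^ 9 * weight k * (A k * (Π * (y - 1#)) * r)) + s * weight k * r * (B k * (- (q ^ 6) * Π) * 1#))
          ≈⟨ +-congˡ (+-cong (-‿cong (*-congˡ (A≈H k))) (*-congˡ (B≈H k))) ⟩
        s * (c * (H k * Z t)) * (q ^ 6 * r) + (- (q ^ 9 * weight k * (H k * (pA t * (y - t ^ 6) * s))) + s * weight k * r * (H k * pB t))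
          ≈⟨ solve 10 (λ s c h z g₆ r g₉ w a b → s :* (c :* (h :* z)) :* (g₆ :* r) :+ (:- (g₉ :* w :* (h :* (a :* s))) :+ s :* w :* r :* (h :* b))
              := s :* (h :* (w :* (r :* b) :- w :* (g₉ :* a) :+ c :* (z :* (g₆ :* r))))) refl
              s c (H k) (Z t) (q ^ 6) r (q ^ 9) (weight k) (pA t * (y - t ^ 6)) (pB t) ⟩
        s * (H k * (weight k * (r * pB t) - weight k * (q ^ 9 * (pA t * (y - t ^ 6))) + c * (Z t * (q ^ 6 * r))))
          ≈⟨ *-congˡ (*-congˡ (certificate q y t)) ⟨
        s * (H k * (c * (q ^ 3 * numH t)))
          ≈⟨ solve 5 (λ s h c g n → s :* (h :* (c :* (g :* n))) := s :* c :* g :* (h :* n)) refl _ _ _ _ _ ⟩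
        s * c * q ^ 3 * (H k * numH t)
          ≈⟨ *-congˡ (h-suc hH k) ⟨
        s * c * q ^ 3 * (H (suc k) * denH t)
          ≈⟨ solve 6 (λ q y t s c h → let i = con (+ 1) in
               s :* c :* q :^ 3 :* (h :* ((i :- q :^ 2 :* t :^ 4) :* (i :- q :^ 4 :* t :^ 4) :* (q :^ 5 :* ((y :- q :^ 6 :* t :^ 6) :* (i :- y :* (q :^ 6 :* t :^ 6))))))
               := s :* (c :* (h :* ((i :- (q :* t) :^ 4) :* (q :^ 2 :- (q :* t) :^ 4) :* (y :- (q :* t) :^ 6)))) :* (q :^ 6 :* (i :- y :* (q :^ 6 :* t :^ 6)))) refl
               q y t s c (H (suc k)) ⟩
        s * (c * (H (suc k) * Z (q * t))) * (q ^ 6 * r) ∎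

    unit-Π : Unit Π
    unit-Π = unit-* (unit-* (unit-resp (+-congˡ (-‿cong (*-congˡ (*-identityʳ q)))) (units₁ 1)) (units₁ 3)) (units₁ 5)

    -- Beyond k₀ the boundary term dies with `H`. The ratio that remains is that of q^(-(m-1)/2) (1
    -- - q^m) at m + 6 and at m, where y = q^m.
    shift : ∀ {k₀} → y * q ^ 5 ≈ T k₀ ^ 2 → ∀ {K} → k₀ < K →
            cubicSum A K * (q ^ 3 * (1# - y)) ≈ cubicSum B K * s
    shift {k₀} y≈ {K} k₀<K = unit-cancel unit-Π (begin
      cubicSum A K * (q ^ 3 * (1# - y)) * Π
        ≈⟨ solve 6 (λ a g y p s b → a :* (g :* (con (+ 1) :- y)) :* p
             := (g :* (con (+ 1) :- y) :* p :* a :- s :* p :* b) :+ b :* s :* p) refl _ _ _ _ s (cubicSum B K) ⟩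
      (q ^ 3 * (1# - y) * Π * cubicSum A K - s * Π * cubicSum B K) + cubicSum B K * s * Π
        ≈⟨ +-congʳ (telescope K) ⟩
      s * (c * (H K * Z (T K))) + cubicSum B K * s * Π
        ≈⟨ +-congʳ (*-congˡ (*-congˡ (*-congʳ (hterm-vanishes hH unit-denH numH≈0 K k₀<K)))) ⟩
      s * (c * (0# * Z (T K))) + cubicSum B K * s * Π
        ≈⟨ solve 4 (λ s c z x → s :* (c :* (con (+ 0) :* z)) :+ x := x) refl s c (Z (T K)) _ ⟩
      cubicSum B K * s * Π ∎)
      where
      numH≈0 : numH (T k₀) ≈ 0#
      numH≈0 = begin
        num₀ (T k₀) * ((y * q ^ 5 - T k₀ ^ 2) * (1# - y * (q * T k₀ ^ 2))) ≈⟨ *-congˡ (*-congʳ (+-congʳ y≈)) ⟩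
        num₀ (T k₀) * ((T k₀ ^ 2 - T k₀ ^ 2) * (1# - y * (q * T k₀ ^ 2)))  ≈⟨ solve 3 (λ a b c → a :* ((b :- b) :* c) := con (+ 0)) refl _ _ _ ⟩
        0# ∎

  -- The symbol (-3/(2i+1)), which has period 3 in i.
  χ : ℕ → ℤ
  χ 0 = + 1
  χ 1 = + 0
  χ 2 = ℤ.- (+ 1)
  χ (suc (suc (suc i))) = χ i

  module Evaluation (unit-q : Unit q) (unit-1-q^ : ∀ i → Unit (1# - q ^ suc i)) where

    unit-q^ : ∀ k → Unit (q ^ k)
    unit-q^ = unit-^ unit-q

    unit-1-q^* : ∀ m i → Unit (1# - q ^ suc m * q ^ i)
    unit-1-q^* m i = unit-resp (+-congˡ (-‿cong (^-homo-* q (suc m) i))) (unit-1-q^ (m ℕ.+ i))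

    unit-den₀ : ∀ k → Unit (den₀ (T k))
    unit-den₀ k = unit-* (f 1) (f 3)
      where
      f : ∀ i → Unit (1# - q ^ suc i * T k ^ 4)
      f i = unit-resp (+-congˡ (-‿cong (*-congˡ (sym (^-assocʳ q k 4))))) (unit-1-q^* i (k ℕ.* 4))

    unit-q^-q^ : ∀ i j → i ≡.≢ j → Unit (q ^ i - q ^ j)
    unit-q^-q^ zero zero i≢j = ⊥-elim (i≢j ≡.refl)
    unit-q^-q^ zero (suc j) _ = unit-1-q^ j
    unit-q^-q^ (suc i) zero _ = unit-resp (solve 1 (λ x → :- (con (+ 1) :- x) := x :- con (+ 1)) refl _) (unit-- (unit-1-q^ i))
    unit-q^-q^ (suc i) (suc j) i≢j = unit-resp (solve 3 (λ q x y → q :* (x :- y) := q :* x :- q :* y) refl q (q ^ i) (q ^ j))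
      (unit-* unit-q (unit-q^-q^ i j (λ i≡j → i≢j (≡.cong suc i≡j))))

    -- The point q^m with m = 2i + 1, where the numerator factor y - qt² vanishes at k = i and ends
    -- the sum.
    node : ℕ → Carrier
    node i = q ^ suc (2 ℕ.* i)

    unit₂ : ∀ i j → Unit (node i - q ^ (2 ℕ.* j))
    unit₂ i j = unit-q^-q^ _ _ (λ eq → ℕ.even≢odd j i (≡.sym eq))

    unit-den : ∀ i k → Unit (den (node i) (T k))
    unit-den i k = unit-* (unit-den₀ k) (unit-*
      (unit-resp (+-congˡ (-‿cong q^6T^6)) (unit₂ i (3 ℕ.* suc k)))
      (unit-resp (+-congˡ (-‿cong (*-congˡ q^6T^6))) (unit-1-q^* (2 ℕ.* i) (2 ℕ.* (3 ℕ.* suc k)))))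
      where
      q^6T^6 : q ^ (2 ℕ.* (3 ℕ.* suc k)) ≈ q ^ 6 * T k ^ 6
      q^6T^6 = begin
        q ^ (2 ℕ.* (3 ℕ.* suc k)) ≡⟨ ≡.cong (q ^_) (≡.trans (≡.sym (ℕ.*-assoc 2 3 (suc k))) (ℕ.*-comm 6 (suc k))) ⟩
        q ^ (suc k ℕ.* 6)         ≈⟨ ^-assocʳ q (suc k) 6 ⟨
        (q * T k) ^ 6             ≈⟨ solve 2 (λ q t → (q :* t) :^ 6 := q :^ 6 :* t :^ 6) refl q (T k) ⟩
        q ^ 6 * T k ^ 6           ∎

    summand-resp : ∀ {y y′ h} → y ≈ y′ → Summand y h → Summand y′ h
    summand-resp y≈ hh = record { h-zero = h-zero hh ; h-suc = λ k →
      trans (*-congˡ (*-congˡ (*-cong (+-congʳ (sym y≈)) (+-congˡ (-‿cong (*-congʳ (sym y≈)))))))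
      (trans (h-suc hh k) (*-congˡ (*-congˡ (*-cong (+-congʳ y≈) (+-congˡ (-‿cong (*-congʳ y≈))))))) }

    summand-vanishes : ∀ i {h} → Summand (node i) h → ∀ k → i < k → h k ≈ 0#
    summand-vanishes i hh = hterm-vanishes hh (unit-den i) (begin
        num₀ (T i) * ((node i - q * T i ^ 2) * (1# - node i * (q * T i ^ 2)))
          ≈⟨ *-congˡ (*-congʳ (+-congʳ (*-congˡ (trans (^-congʳ q (ℕ.*-comm 2 i)) (sym (^-assocʳ q i 2)))))) ⟩
        num₀ (T i) * ((q * T i ^ 2 - q * T i ^ 2) * (1# - node i * (q * T i ^ 2)))
          ≈⟨ solve 3 (λ a b c → a :* ((b :- b) :* c) := con (+ 0)) refl _ _ _ ⟩
        0# ∎)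

    -- The terms k = 0, 1 that survive at m = 3, over their common denominator.
    evaluation₁ : (1# - q) * den (q ^ 3) 1# + (1# - q ^ 9) * num (q ^ 3) 1# ≈ 0#
    evaluation₁ = solve 1 (λ q → let
        i = con (+ 1)
        y = q :^ 3 in
      (i :- q) :* ((i :- q :^ 2 :* i :^ 4) :* (i :- q :^ 4 :* i :^ 4) :* ((y :- q :^ 6 :* i :^ 6) :* (i :- y :* (q :^ 6 :* i :^ 6))))
      :+ (i :- q :^ 9) :* (q :^ 2 :* i :^ 4 :* ((i :- q :* i :^ 4) :* (i :- q :^ 3 :* i :^ 4)) :* ((y :- q :* i :^ 2) :* (i :- y :* (q :* i :^ 2))))
      := con (+ 0)) refl q

    -- The terms k = 0, 1, 2 that survive at m = 5, over their common denominator; the sign on the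
    -- right is `χ 2`.
    evaluation₂ : q ^ 2 * ((1# - q) * (den (q ^ 5) 1# * den (q ^ 5) (T 1)) + (1# - q ^ 9) * (num (q ^ 5) 1# * den (q ^ 5) (T 1))
                    + (1# - q ^ 17) * (num (q ^ 5) 1# * num (q ^ 5) (T 1)))
                  ≈ - 1# * (1# - q ^ 5) * (den (q ^ 5) 1# * den (q ^ 5) (T 1))
    evaluation₂ = solve 1 (λ q → let
        i = con (+ 1)
        y = q :^ 5
        t = q :* i
        n₀ = q :^ 2 :* i :^ 4 :* ((i :- q :* i :^ 4) :* (i :- q :^ 3 :* i :^ 4)) :* ((y :- q :* i :^ 2) :* (i :- y :* (q :* i :^ 2)))
        d₀ = (i :- q :^ 2 :* i :^ 4) :* (i :- q :^ 4 :* i :^ 4) :* ((y :- q :^ 6 :* i :^ 6) :* (i :- y :* (q :^ 6 :* i :^ 6)))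
        n₁ = q :^ 2 :* t :^ 4 :* ((i :- q :* t :^ 4) :* (i :- q :^ 3 :* t :^ 4)) :* ((y :- q :* t :^ 2) :* (i :- y :* (q :* t :^ 2)))
        d₁ = (i :- q :^ 2 :* t :^ 4) :* (i :- q :^ 4 :* t :^ 4) :* ((y :- q :^ 6 :* t :^ 6) :* (i :- y :* (q :^ 6 :* t :^ 6))) in
      q :^ 2 :* ((i :- q) :* (d₀ :* d₁) :+ (i :- q :^ 9) :* (n₀ :* d₁) :+ (i :- q :^ 17) :* (n₀ :* n₁))
      := (:- i) :* (i :- q :^ 5) :* (d₀ :* d₁)) refl q

    truncated : ∀ i {h} → Summand (node i) h → ∀ {K} → i < K → cubicSum h K ≈ cubicSum h (suc i)
    truncated i hh {K} i<K = ∑-truncate _ K i<K (λ k i<k → trans (*-congˡ (summand-vanishes i hh k i<k)) (zeroʳ _))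

    -- A step of three in i is a step of six in m, so `shift` leaves m = 1, 3, 5 as base cases.
    evaluation : ∀ i {h} → Summand (node i) h → ∀ {K} → i < K →
                 cubicSum h K * q ^ i ≈ ⟦ χ i ⟧ℤ * (1# - node i)
    evaluation 0 {h} hh {K} 0<K = begin
      cubicSum h K * 1#                      ≈⟨ *-congʳ (truncated 0 hh 0<K) ⟩
      (0# + (1# - q * 1# ^ 8) * h 0) * 1#    ≈⟨ *-congʳ (+-congˡ (*-congˡ (h-zero hh))) ⟩
      (0# + (1# - q * 1# ^ 8) * 1#) * 1#     ≈⟨ solve 1 (λ q → let i = con (+ 1) in
                                                  (con (+ 0) :+ (i :- q :* i :^ 8) :* i) :* i := i :* (i :- q :* i)) refl q ⟩
      1# * (1# - q * 1#)                     ∎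
    evaluation 1 {h} hh {K} 1<K = unit-cancel (unit-den 1 0) (begin
      cubicSum h K * q ^ 1 * d₀
        ≈⟨ *-congʳ (*-congʳ (truncated 1 hh 1<K)) ⟩
      (0# + (1# - q * 1# ^ 8) * h 0 + (1# - q * (q * 1#) ^ 8) * h 1) * q ^ 1 * d₀
        ≈⟨ solve 4 (λ q h₀ h₁ d₀ → let i = con (+ 1) in
             (con (+ 0) :+ (i :- q :* i :^ 8) :* h₀ :+ (i :- q :* (q :* i) :^ 8) :* h₁) :* q :^ 1 :* d₀
             := q :* ((i :- q) :* h₀ :* d₀ :+ (i :- q :^ 9) :* (h₁ :* d₀))) refl q (h 0) (h 1) d₀ ⟩
      q * ((1# - q) * h 0 * d₀ + (1# - q ^ 9) * (h 1 * d₀))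
        ≈⟨ *-congˡ (+-congˡ (*-congˡ (h-suc hh 0))) ⟩
      q * ((1# - q) * h 0 * d₀ + (1# - q ^ 9) * (h 0 * n₀))
        ≈⟨ solve 6 (λ q w h₀ d₀ z n₀ → q :* (w :* h₀ :* d₀ :+ z :* (h₀ :* n₀)) := q :* h₀ :* (w :* d₀ :+ z :* n₀)) refl _ _ _ _ _ _ ⟩
      q * h 0 * ((1# - q) * d₀ + (1# - q ^ 9) * n₀)
        ≈⟨ *-congˡ evaluation₁ ⟩
      q * h 0 * 0#
        ≈⟨ solve 3 (λ a y d → a :* con (+ 0) := con (+ 0) :* y :* d) refl _ _ _ ⟩
      0# * (1# - node 1) * d₀ ∎)
      where
      n₀ = num (node 1) (T 0)
      d₀ = den (node 1) (T 0)
    evaluation 2 {h} hh {K} 2<K = unit-cancel (unit-* (unit-den 2 0) (unit-den 2 1)) (begin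
      cubicSum h K * q ^ 2 * (d₀ * d₁)
        ≈⟨ *-congʳ (*-congʳ (truncated 2 hh 2<K)) ⟩
      (0# + (1# - q * 1# ^ 8) * h 0 + (1# - q * (q * 1#) ^ 8) * h 1 + (1# - q * (q * (q * 1#)) ^ 8) * h 2) * q ^ 2 * (d₀ * d₁)
        ≈⟨ solve 6 (λ q h₀ h₁ h₂ d₀ d₁ → let i = con (+ 1) in
             (con (+ 0) :+ (i :- q :* i :^ 8) :* h₀ :+ (i :- q :* (q :* i) :^ 8) :* h₁ :+ (i :- q :* (q :* (q :* i)) :^ 8) :* h₂) :* q :^ 2 :* (d₀ :* d₁)
             := q :^ 2 :* ((i :- q) :* (h₀ :* d₀ :* d₁) :+ (i :- q :^ 9) :* ((h₁ :* d₀) :* d₁) :+ (i :- q :^ 17) :* (h₂ :* d₁ :* d₀))) refl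
             q (h 0) (h 1) (h 2) d₀ d₁ ⟩
      q ^ 2 * ((1# - q) * (h 0 * d₀ * d₁) + (1# - q ^ 9) * ((h 1 * d₀) * d₁) + (1# - q ^ 17) * (h 2 * d₁ * d₀))
        ≈⟨ *-congˡ (+-cong (+-cong (*-congˡ (*-congʳ (*-congʳ (h-zero hh)))) (*-congˡ (*-congʳ h₁d₀))) (*-congˡ h₂d₁d₀)) ⟩
      q ^ 2 * ((1# - q) * (1# * d₀ * d₁) + (1# - q ^ 9) * (n₀ * d₁) + (1# - q ^ 17) * (n₀ * n₁))
        ≈⟨ *-congˡ (+-congʳ (+-congʳ (*-congˡ (*-congʳ (*-identityˡ d₀))))) ⟩
      q ^ 2 * ((1# - q) * (d₀ * d₁) + (1# - q ^ 9) * (n₀ * d₁) + (1# - q ^ 17) * (n₀ * n₁))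
        ≈⟨ evaluation₂ ⟩
      - 1# * (1# - node 2) * (d₀ * d₁) ∎)
      where
      n₀ = num (node 2) (T 0)
      d₀ = den (node 2) (T 0)
      n₁ = num (node 2) (T 1)
      d₁ = den (node 2) (T 1)
      h₁d₀ : h 1 * d₀ ≈ n₀
      h₁d₀ = trans (h-suc hh 0) (trans (*-congʳ (h-zero hh)) (*-identityˡ n₀))
      h₂d₁d₀ : h 2 * d₁ * d₀ ≈ n₀ * n₁
      h₂d₁d₀ = begin
        h 2 * d₁ * d₀   ≈⟨ *-congʳ (h-suc hh 1) ⟩
        h 1 * n₁ * d₀   ≈⟨ solve 3 (λ a b c → a :* b :* c := a :* c :* b) refl _ _ _ ⟩
        h 1 * d₀ * n₁   ≈⟨ *-congʳ h₁d₀ ⟩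
        n₀ * n₁         ∎
    -- `shift` brings in the factor 1 - q^m of the smaller exponent m, a unit.
    evaluation (suc (suc (suc i))) {h} hh {K} i<K = unit-cancel (unit-1-q^ (2 ℕ.* i)) (begin
      cubicSum h K * q ^ (3 ℕ.+ i) * (1# - node i)
        ≈⟨ solve 4 (λ a q z y → a :* (q :* (q :* (q :* z))) :* (con (+ 1) :- y) := a :* (q :^ 3 :* (con (+ 1) :- y)) :* z) refl _ q (q ^ i) (node i) ⟩
      cubicSum h K * (q ^ 3 * (1# - node i)) * q ^ i
        ≈⟨ *-congʳ (Step.shift (node i) (unit-1-q^* (2 ℕ.* i)) (unit₂ i) unit-q unit-den₀ (summand-resp node+3 hh) hB {3 ℕ.+ i} y≈ i<K) ⟩
      cubicSum B K * (1# - node i * q ^ 6) * q ^ i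
        ≈⟨ solve 3 (λ a b c → a :* b :* c := a :* c :* b) refl _ _ _ ⟩
      cubicSum B K * q ^ i * (1# - node i * q ^ 6)
        ≈⟨ *-cong (evaluation i hB (ℕ.<-trans (ℕ.m<n+m i (s≤s z≤n)) i<K)) (+-congˡ (-‿cong (sym node+3))) ⟩
      ⟦ χ i ⟧ℤ * (1# - node i) * (1# - node (3 ℕ.+ i))
        ≈⟨ solve 3 (λ a b c → a :* b :* c := a :* c :* b) refl _ _ _ ⟩
      ⟦ χ i ⟧ℤ * (1# - node (3 ℕ.+ i)) * (1# - node i) ∎)
      where
      B = proj₁ (hterm (λ k → num (node i) (T k)) _ (unit-den i))
      hB : Summand (node i) B
      hB = proj₂ (hterm (λ k → num (node i) (T k)) _ (unit-den i))
      node+3 : node (3 ℕ.+ i) ≈ node i * q ^ 6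
      node+3 = trans (^-congʳ q (≡.cong suc (≡.trans (ℕ.*-distribˡ-+ 2 3 i) (ℕ.+-comm 6 (2 ℕ.* i))))) (^-homo-* q (suc (2 ℕ.* i)) 6)
      y≈ : node i * q ^ 5 ≈ T (3 ℕ.+ i) ^ 2
      y≈ = begin
        node i * q ^ 5             ≈⟨ ^-homo-* q (suc (2 ℕ.* i)) 5 ⟨
        q ^ (suc (2 ℕ.* i) ℕ.+ 5)  ≡⟨ ≡.cong (q ^_) (≡.trans (≡.trans (≡.cong suc (ℕ.+-comm (2 ℕ.* i) 5)) (≡.sym (ℕ.*-distribˡ-+ 2 3 i))) (ℕ.*-comm 2 (3 ℕ.+ i))) ⟩
        q ^ ((3 ℕ.+ i) ℕ.* 2)      ≈⟨ ^-assocʳ q (3 ℕ.+ i) 2 ⟨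
        T (3 ℕ.+ i) ^ 2            ∎

-- Lagrange interpolation of products of brackets

module Lagrange (R : CommutativeRing 0ℓ 0ℓ) where
  open CommutativeRing R
  open IntegerCoefficients R
  open Ranges R
  open import Relation.Binary.Reasoning.Setoid setoid

  replace : ℕ → Carrier → (ℕ → Carrier) → ℕ → Carrier
  replace i a f j with i ℕ.≟ j
  ... | yes _ = a
  ... | no _  = f j

  replace-≡ : ∀ i a f → replace i a f i ≈ a
  replace-≡ i a f with i ℕ.≟ i
  ... | yes _  = refl
  ... | no i≢i = ⊥-elim (i≢i ≡.refl)

  replace-≢ : ∀ {i j} a f → i ≢ j → replace i a f j ≈ f j
  replace-≢ {i} {j} a f i≢j with i ℕ.≟ j
  ... | yes i≡j = ⊥-elim (i≢j i≡j)
  ... | no _    = refl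

  replace-cong : ∀ i {a b} {f g : ℕ → Carrier} n → a ≈ b → (∀ j → j < n → i ≢ j → f j ≈ g j) →
                 ∀ j → j < n → replace i a f j ≈ replace i b g j
  replace-cong i n a≈b f≈g j j<n with i ℕ.≟ j
  ... | yes _  = a≈b
  ... | no i≢j = f≈g j j<n i≢j

  ∏-replace : ∀ {i} n a f → i < n → ∏ (replace i a f) n ≈ a * ∏ (replace i 1# f) n
  ∏-replace {i} (suc n) a f (s≤s i≤n) with ℕ.m≤n⇒m<n∨m≡n i≤n
  ... | inj₁ i<n = begin
    ∏ (replace i a f) n * replace i a f n            ≈⟨ *-cong (∏-replace n a f i<n) (trans (replace-≢ a f i≢n) (sym (replace-≢ 1# f i≢n))) ⟩
    (a * ∏ (replace i 1# f) n) * replace i 1# f n    ≈⟨ *-assoc _ _ _ ⟩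
    a * (∏ (replace i 1# f) n * replace i 1# f n)    ∎
    where i≢n = ℕ.<⇒≢ i<n
  ... | inj₂ ≡.refl = begin
    ∏ (replace i a f) i * replace i a f i            ≈⟨ *-cong (∏-cong i (λ j j<i → trans (replace-≢ a f (ℕ.>⇒≢ j<i)) (sym (replace-≢ 1# f (ℕ.>⇒≢ j<i))))) (replace-≡ i a f) ⟩
    ∏ (replace i 1# f) i * a                         ≈⟨ *-comm _ _ ⟩
    a * ∏ (replace i 1# f) i                         ≈⟨ *-congˡ (trans (*-congˡ (replace-≡ i 1# f)) (*-identityʳ _)) ⟨
    a * (∏ (replace i 1# f) i * replace i 1# f i)    ∎

  ∑-replace : ∀ {i} n f → i < n → ∑ f n ≈ f i + ∑ (replace i 0# f) n
  ∑-replace {i} (suc n) f (s≤s i≤n) with ℕ.m≤n⇒m<n∨m≡n i≤n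
  ... | inj₁ i<n = begin
    ∑ f n + f n                                    ≈⟨ +-cong (∑-replace n f i<n) (sym (replace-≢ 0# f (ℕ.<⇒≢ i<n))) ⟩
    (f i + ∑ (replace i 0# f) n) + replace i 0# f n ≈⟨ +-assoc _ _ _ ⟩
    f i + (∑ (replace i 0# f) n + replace i 0# f n) ∎
  ... | inj₂ ≡.refl = begin
    ∑ f i + f i                                    ≈⟨ +-comm _ _ ⟩
    f i + ∑ f i                                    ≈⟨ +-congˡ (∑-cong i (λ j j<i → sym (replace-≢ 0# f (ℕ.>⇒≢ j<i)))) ⟩
    f i + ∑ (replace i 0# f) i                     ≈⟨ +-congˡ (trans (+-congˡ (replace-≡ i 0# f)) (+-identityʳ _)) ⟨
    f i + (∑ (replace i 0# f) i + replace i 0# f i) ∎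

  -- The determinant of the vectors (y, 1 + y²) and (x, 1 + x²).
  bracket : Carrier → Carrier → Carrier
  bracket x y = (y - x) * (1# - y * x)

  bracket-cong : ∀ {x x′ y y′} → x ≈ x′ → y ≈ y′ → bracket x y ≈ bracket x′ y′
  bracket-cong x≈ y≈ = *-cong (+-cong y≈ (-‿cong x≈)) (+-congˡ (-‿cong (*-cong y≈ x≈)))

  bracket-antisym : ∀ x y → bracket x y ≈ - bracket y x
  bracket-antisym = solve 2 (λ x y → (y :- x) :* (con (+ 1) :- y :* x) := :- ((x :- y) :* (con (+ 1) :- x :* y))) refl

  -- The three-term Plücker relation for four vectors (x, 1 + x²) of the plane.
  plücker : ∀ i m p z → bracket i m * bracket p z ≈ bracket i p * bracket m z + bracket i z * bracket p m
  plücker = solve 4 (λ i m p z → let b = λ x y → (y :- x) :* (con (+ 1) :- y :* x) in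
    b i m :* b p z := b i p :* b m z :+ b i z :* b p m) refl

  module Interpolation (y : ℕ → Carrier) (b⁻¹ : ℕ → ℕ → Carrier)
                       (inverse : ∀ {i j} → i ≢ j → bracket (y i) (y j) * b⁻¹ i j ≈ 1#) where

    -- The factors of the Lagrange basis form of node i, which is 1 at `y i` and 0 at the other
    -- nodes.
    ratio : Carrier → ℕ → ℕ → Carrier
    ratio p i = replace i 1# (λ j → bracket p (y j) * b⁻¹ i j)

    b⁻¹-antisym : ∀ {i j} → i ≢ j → b⁻¹ j i ≈ - b⁻¹ i j
    b⁻¹-antisym {i} {j} i≢j = unit-cancel {bracket (y i) (y j)} (_ , inverse i≢j) (begin
      b⁻¹ j i * bracket (y i) (y j)     ≈⟨ *-congˡ (bracket-antisym _ _) ⟩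
      b⁻¹ j i * - bracket (y j) (y i)   ≈⟨ solve 2 (λ a b → a :* (:- b) := :- (b :* a)) refl _ _ ⟩
      - (bracket (y j) (y i) * b⁻¹ j i) ≈⟨ -‿cong (inverse (λ j≡i → i≢j (≡.sym j≡i))) ⟩
      - 1#                              ≈⟨ -‿cong (inverse i≢j) ⟨
      - (bracket (y i) (y j) * b⁻¹ i j) ≈⟨ solve 2 (λ a b → :- (a :* b) := (:- b) :* a) refl _ _ ⟩
      - b⁻¹ i j * bracket (y i) (y j)   ∎)

    -- As a function of p, a form of degree n in (p, 1 + p²), given by its linear factors.
    form : (ℕ → Carrier) → ℕ → Carrier → Carrier
    form g n p = ∏ (λ k → bracket (g k) p) n

    -- For j ≠ i the bracket of `y N` with `y j` cancels between the two products. The factor j = i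
    -- leaves a quotient with i and N interchanged, and antisymmetry of its denominator gives the
    -- sign.
    exchange : ∀ p {N} i → i < N →
      ∏ (ratio (y N) i) N * ∏ (ratio p N) N ≈ - (∏ (ratio p i) N * (bracket p (y i) * b⁻¹ i N))
    exchange p {N} i i<N = begin
      ∏ (ratio (y N) i) N * ∏ (ratio p N) N
        ≈⟨ ∏-* _ _ N ⟨
      ∏ (λ j → ratio (y N) i j * ratio p N j) N
        ≈⟨ ∏-cong N pointwise ⟩
      ∏ (replace i (bracket p (y i) * b⁻¹ N i) (λ j → bracket p (y j) * b⁻¹ i j)) N
        ≈⟨ ∏-replace N _ _ i<N ⟩
      (bracket p (y i) * b⁻¹ N i) * ∏ (ratio p i) N
        ≈⟨ *-congʳ (*-congˡ (b⁻¹-antisym (ℕ.<⇒≢ i<N))) ⟩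
      (bracket p (y i) * - b⁻¹ i N) * ∏ (ratio p i) N
        ≈⟨ solve 3 (λ a b c → (a :* (:- b)) :* c := :- (c :* (a :* b))) refl _ _ _ ⟩
      - (∏ (ratio p i) N * (bracket p (y i) * b⁻¹ i N)) ∎
      where
      pointwise : ∀ j → j < N → ratio (y N) i j * ratio p N j
                ≈ replace i (bracket p (y i) * b⁻¹ N i) (λ j → bracket p (y j) * b⁻¹ i j) j
      pointwise j j<N with i ℕ.≟ j | N ℕ.≟ j
      ... | _          | yes ≡.refl = ⊥-elim (ℕ.<-irrefl ≡.refl j<N)
      ... | yes ≡.refl | no N≢j = *-identityˡ _
      ... | no i≢j     | no N≢j = begin
        (bracket (y N) (y j) * b⁻¹ i j) * (bracket p (y j) * b⁻¹ N j)
          ≈⟨ solve 4 (λ a b c d → (a :* b) :* (c :* d) := (a :* d) :* (c :* b)) refl _ _ _ _ ⟩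
        (bracket (y N) (y j) * b⁻¹ N j) * (bracket p (y j) * b⁻¹ i j)
          ≈⟨ *-congʳ (inverse N≢j) ⟩
        1# * (bracket p (y j) * b⁻¹ i j)
          ≈⟨ *-identityˡ _ ⟩
        bracket p (y j) * b⁻¹ i j ∎

    -- Induction on the degree. For the new linear factor z and the new node `y N`, the Plücker
    -- relation splits each old summand in two (`inner`). The first parts add up to the old formula
    -- times the bracket of z and p. The second parts cancel against the summand of the new node, by
    -- the old formula at the point `y N` and `exchange` (`vanish`).
    interpolate : ∀ g n p → form g n p ≈ ∑ (λ i → form g n (y i) * ∏ (ratio p i) (suc n)) (suc n)
    interpolate g zero p = begin
      1#                        ≈⟨ solve 1 (λ x → con (+ 1) := con (+ 0) :+ con (+ 1) :* (con (+ 1) :* con (+ 1))) refl p ⟩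
      0# + 1# * (1# * 1#)       ≈⟨ +-congˡ (*-congˡ (*-congˡ (replace-≡ 0 1# (λ j → bracket p (y j) * b⁻¹ 0 j)))) ⟨
      0# + 1# * (1# * ratio p 0 0) ∎
    interpolate g (suc n) p = begin
      form g n p * bracket z p
        ≈⟨ solve 2 (λ a b → a :* b := b :* a :+ con (+ 0)) refl _ _ ⟩
      bracket z p * form g n p + 0#
        ≈⟨ +-cong (*-congˡ (interpolate g n p)) (sym vanish) ⟩
      bracket z p * ∑ (λ i → F i * P i) N + bracket z (y N) * (∑ (λ i → F i * P i * (bracket p (y i) * b⁻¹ i N)) N + form g n (y N) * ∏ (ratio p N) N)
        ≈⟨ solve 5 (λ a s b t u → a :* s :+ b :* (t :+ u) := (a :* s :+ b :* t) :+ b :* u) refl _ _ _ _ _ ⟩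
      (bracket z p * ∑ (λ i → F i * P i) N + bracket z (y N) * ∑ (λ i → F i * P i * (bracket p (y i) * b⁻¹ i N)) N)
        + bracket z (y N) * (form g n (y N) * ∏ (ratio p N) N)
        ≈⟨ +-cong (+-cong (*-distribˡ-∑ _ _ N) (*-distribˡ-∑ _ _ N)) last ⟩
      (∑ (λ i → bracket z p * (F i * P i)) N + ∑ (λ i → bracket z (y N) * (F i * P i * (bracket p (y i) * b⁻¹ i N))) N)
        + (form g n (y N) * bracket z (y N)) * (∏ (ratio p N) N * ratio p N N)
        ≈⟨ +-congʳ (∑-+ _ _ N) ⟨
      ∑ (λ i → bracket z p * (F i * P i) + bracket z (y N) * (F i * P i * (bracket p (y i) * b⁻¹ i N))) N
        + (form g n (y N) * bracket z (y N)) * (∏ (ratio p N) N * ratio p N N)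
        ≈⟨ +-congʳ (∑-cong N inner) ⟩
      ∑ (λ i → (F i * bracket z (y i)) * (P i * ratio p i N)) N + (form g n (y N) * bracket z (y N)) * (∏ (ratio p N) N * ratio p N N) ∎
      where
      N = suc n
      z = g n
      F P : ℕ → Carrier
      F i = form g n (y i)
      P i = ∏ (ratio p i) N

      vanish : bracket z (y N) * (∑ (λ i → F i * P i * (bracket p (y i) * b⁻¹ i N)) N + form g n (y N) * ∏ (ratio p N) N) ≈ 0#
      vanish = trans (*-congˡ (begin
        ∑ (λ i → F i * P i * (bracket p (y i) * b⁻¹ i N)) N + form g n (y N) * ∏ (ratio p N) N
          ≈⟨ +-congˡ (trans (*-comm _ _) (trans (*-congˡ (interpolate g n (y N))) (*-distribˡ-∑ _ _ N))) ⟩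
        ∑ (λ i → F i * P i * (bracket p (y i) * b⁻¹ i N)) N + ∑ (λ i → ∏ (ratio p N) N * (F i * ∏ (ratio (y N) i) N)) N
          ≈⟨ ∑-+ _ _ N ⟨
        ∑ (λ i → F i * P i * (bracket p (y i) * b⁻¹ i N) + ∏ (ratio p N) N * (F i * ∏ (ratio (y N) i) N)) N
          ≈⟨ ∑-cong N (λ i i<N → begin
               F i * P i * (bracket p (y i) * b⁻¹ i N) + ∏ (ratio p N) N * (F i * ∏ (ratio (y N) i) N)
                 ≈⟨ solve 5 (λ f r w a b → f :* r :* w :+ a :* (f :* b) := f :* (r :* w :+ b :* a)) refl _ _ _ _ _ ⟩
               F i * (P i * (bracket p (y i) * b⁻¹ i N) + ∏ (ratio (y N) i) N * ∏ (ratio p N) N)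
                 ≈⟨ *-congˡ (+-congˡ (exchange p i i<N)) ⟩
               F i * (P i * (bracket p (y i) * b⁻¹ i N) + - (P i * (bracket p (y i) * b⁻¹ i N)))
                 ≈⟨ solve 2 (λ f x → f :* (x :+ :- x) := con (+ 0) :* f) refl _ _ ⟩
               0# * F i ∎) ⟩
        ∑ (λ i → 0# * F i) N
          ≈⟨ *-distribˡ-∑ 0# F N ⟨
        0# * ∑ F N
          ≈⟨ zeroˡ _ ⟩
        0# ∎)) (zeroʳ _)

      last : bracket z (y N) * (form g n (y N) * ∏ (ratio p N) N) ≈ (form g n (y N) * bracket z (y N)) * (∏ (ratio p N) N * ratio p N N)
      last = begin
        bracket z (y N) * (form g n (y N) * ∏ (ratio p N) N)
          ≈⟨ solve 3 (λ a b c → a :* (b :* c) := (b :* a) :* (c :* con (+ 1))) refl _ _ _ ⟩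
        (form g n (y N) * bracket z (y N)) * (∏ (ratio p N) N * 1#)
          ≈⟨ *-congˡ (*-congˡ (replace-≡ N 1# _)) ⟨
        (form g n (y N) * bracket z (y N)) * (∏ (ratio p N) N * ratio p N N) ∎

      inner : ∀ i → i < N → bracket z p * (F i * P i) + bracket z (y N) * (F i * P i * (bracket p (y i) * b⁻¹ i N))
                          ≈ (F i * bracket z (y i)) * (P i * ratio p i N)
      inner i i<N = sym (begin
        (F i * bracket z (y i)) * (P i * ratio p i N)
          ≈⟨ *-congˡ (*-congˡ (replace-≢ 1# _ i≢N)) ⟩
        (F i * bracket z (y i)) * (P i * (bracket p (y N) * b⁻¹ i N))
          ≈⟨ solve 5 (λ f a r b w → (f :* a) :* (r :* (b :* w)) := f :* r :* (w :* (a :* b))) refl _ _ _ _ _ ⟩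
        F i * P i * (b⁻¹ i N * (bracket z (y i) * bracket p (y N)))
          ≈⟨ *-congˡ (*-congˡ (plücker z (y i) p (y N))) ⟩
        F i * P i * (b⁻¹ i N * (bracket z p * bracket (y i) (y N) + bracket z (y N) * bracket p (y i)))
          ≈⟨ solve 6 (λ x w a b c d → x :* (w :* (a :* b :+ c :* d)) := x :* (a :* (b :* w)) :+ c :* (x :* (d :* w))) refl _ _ _ _ _ _ ⟩
        F i * P i * (bracket z p * (bracket (y i) (y N) * b⁻¹ i N)) + bracket z (y N) * (F i * P i * (bracket p (y i) * b⁻¹ i N))
          ≈⟨ +-congʳ (*-congˡ (*-congˡ (inverse i≢N))) ⟩
        F i * P i * (bracket z p * 1#) + bracket z (y N) * (F i * P i * (bracket p (y i) * b⁻¹ i N))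
          ≈⟨ +-congʳ (solve 2 (λ x a → x :* (a :* con (+ 1)) := a :* x) refl _ _) ⟩
        bracket z p * (F i * P i) + bracket z (y N) * (F i * P i * (bracket p (y i) * b⁻¹ i N)) ∎)
        where i≢N = ℕ.<⇒≢ i<N

-- Interpolation of the deformed sum

module InterpolatedSum (R : CommutativeRing 0ℓ 0ℓ) (q : CommutativeRing.Carrier R)
  (unit-q : Ranges.Unit R q) (unit-1-q^ : ∀ i → Ranges.Unit R (CommutativeRing._-_ R (CommutativeRing.1# R)
     (Algebra.Properties.Semiring.Exp._^_ (CommutativeRing.semiring R) q (suc i)))) where
  open CommutativeRing R
  open IntegerCoefficients R
  open Ranges R
  open CubicSum R q
  open Evaluation unit-q unit-1-q^
  open HTerm
  open Lagrange R
  open import Algebra.Properties.Semiring.Exp semiring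
  open import Relation.Binary.Reasoning.Setoid setoid

  zeros poles : ℕ → Carrier
  zeros k = q * (q ^ k) ^ 2
  poles k = q ^ 6 * (q ^ k) ^ 6

  unit-bracket : ∀ {i j} → i ≢ j → Unit (bracket (node i) (node j))
  unit-bracket {i} {j} i≢j = unit-*
    (unit-q^-q^ _ _ (λ eq → i≢j (≡.sym (ℕ.*-cancelˡ-≡ j i 2 (ℕ.suc-injective eq)))))
    (unit-1-q^* (2 ℕ.* j) (suc (2 ℕ.* i)))

  b⁻¹ : ℕ → ℕ → Carrier
  b⁻¹ i j with i ℕ.≟ j
  -- A default: on the diagonal `ratio` is 1 and this value does not enter.
  ... | yes _  = 0#
  ... | no i≢j = proj₁ (unit-bracket i≢j)

  b⁻¹-inverse : ∀ {i j} → i ≢ j → bracket (node i) (node j) * b⁻¹ i j ≈ 1#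
  b⁻¹-inverse {i} {j} i≢j with i ℕ.≟ j
  ... | yes i≡j  = ⊥-elim (i≢j i≡j)
  ... | no i≢j′ = proj₂ (unit-bracket i≢j′)

  open Interpolation node b⁻¹ b⁻¹-inverse public

  -- The part of the summand that is free of y, namely q^(2k²) (q;q²)_2k / (q²;q²)_2k.
  β : ℕ → Carrier
  β zero    = 1#
  β (suc k) = β k * num₀ (q ^ k) * proj₁ (unit-den₀ k)

  summand-closed : ∀ {y h} → Summand y h → ∀ k → h k * form poles k y ≈ β k * form zeros k y
  summand-closed hh zero = *-congʳ (h-zero hh)
  summand-closed {y} {h} hh (suc k) = unit-cancel (unit-den₀ k) (begin
    h (suc k) * (form poles k y * bracket (poles k) y) * den₀ (q ^ k)
      ≈⟨ solve 4 (λ h f b d → h :* (f :* b) :* d := (h :* (d :* b)) :* f) refl _ _ _ _ ⟩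
    h (suc k) * (den₀ (q ^ k) * bracket (poles k) y) * form poles k y
      ≈⟨ *-congʳ (h-suc hh k) ⟩
    h k * (num₀ (q ^ k) * bracket (zeros k) y) * form poles k y
      ≈⟨ solve 4 (λ h n b f → h :* (n :* b) :* f := (h :* f) :* (n :* b)) refl _ _ _ _ ⟩
    (h k * form poles k y) * (num₀ (q ^ k) * bracket (zeros k) y)
      ≈⟨ *-congʳ (summand-closed hh k) ⟩
    (β k * form zeros k y) * (num₀ (q ^ k) * bracket (zeros k) y)
      ≈⟨ solve 4 (λ c f n b → (c :* f) :* (n :* b) := c :* n :* con (+ 1) :* (f :* b)) refl _ _ _ _ ⟩
    β k * num₀ (q ^ k) * 1# * (form zeros k y * bracket (zeros k) y)
      ≈⟨ *-congʳ (*-congˡ (proj₂ (unit-den₀ k))) ⟨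
    β k * num₀ (q ^ k) * (den₀ (q ^ k) * proj₁ (unit-den₀ k)) * (form zeros k y * bracket (zeros k) y)
      ≈⟨ solve 5 (λ c n d v f → c :* n :* (d :* v) :* f := c :* n :* v :* f :* d) refl _ _ _ _ _ ⟩
    β k * num₀ (q ^ k) * proj₁ (unit-den₀ k) * (form zeros k y * bracket (zeros k) y) * den₀ (q ^ k) ∎)

  -- Multiplying the k-th summand by all r poles leaves k zeros and r - k poles. In this way all
  -- summands become forms of the same degree r and can be interpolated at the same r + 1 nodes.
  mixed : ℕ → ℕ → Carrier
  mixed k i with i ℕ.<? k
  ... | yes _ = zeros i
  ... | no _  = poles i

  mixed-< : ∀ {k i} → i < k → mixed k i ≈ zeros i
  mixed-< {k} {i} i<k with i ℕ.<? k
  ... | yes _   = refl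
  ... | no ¬i<k = ⊥-elim (¬i<k i<k)

  mixed-≥ : ∀ {k i} → k ≤ i → mixed k i ≈ poles i
  mixed-≥ {k} {i} k≤i with i ℕ.<? k
  ... | yes i<k = ⊥-elim (ℕ.<⇒≱ i<k k≤i)
  ... | no _    = refl

  summand-cleared : ∀ {y h} → Summand y h → ∀ {k r} → k ≤ r → form poles r y * h k ≈ β k * form (mixed k) r y
  summand-cleared {y} {h} hh {k} {r} k≤r = begin
    form poles r y * h k
      ≈⟨ *-congʳ (split poles) ⟩
    (form poles k y * tail poles) * h k
      ≈⟨ solve 3 (λ a b c → (a :* b) :* c := (c :* a) :* b) refl _ _ _ ⟩
    (h k * form poles k y) * tail poles
      ≈⟨ *-congʳ (summand-closed hh k) ⟩
    (β k * form zeros k y) * tail poles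
      ≈⟨ *-assoc _ _ _ ⟩
    β k * (form zeros k y * tail poles)
      ≈⟨ *-congˡ (*-cong (∏-cong k (λ i i<k → bracket-cong (mixed-< i<k) refl))
                        (∏-cong (r ℕ.∸ k) (λ i _ → bracket-cong (mixed-≥ (ℕ.m≤m+n k i)) refl))) ⟨
    β k * (form (mixed k) k y * tail (mixed k))
      ≈⟨ *-congˡ (split (mixed k)) ⟨
    β k * form (mixed k) r y ∎
    where
    tail : (ℕ → Carrier) → Carrier
    tail g = ∏ (λ i → bracket (g (k ℕ.+ i)) y) (r ℕ.∸ k)
    split : ∀ g → form g r y ≈ form g k y * tail g
    split g = trans (reflexive (≡.cong (λ r → form g r y) (≡.sym (ℕ.m+[n∸m]≡n k≤r)))) (∏-+ (λ i → bracket (g i) y) k (r ℕ.∸ k))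

  cubicSum-cleared : ∀ {y h} → Summand y h → ∀ r →
    form poles r y * cubicSum h (suc r) ≈ ∑ (λ k → weight k * β k * form (mixed k) r y) (suc r)
  cubicSum-cleared hh r = trans (*-distribˡ-∑ _ _ (suc r)) (∑-cong (suc r) (λ k k<1+r → begin
    form poles r _ * (weight k * _)   ≈⟨ solve 3 (λ a b c → a :* (b :* c) := b :* (a :* c)) refl _ _ _ ⟩
    weight k * (form poles r _ * _)   ≈⟨ *-congˡ (summand-cleared hh (ℕ.≤-pred k<1+r)) ⟩
    weight k * (β k * form (mixed k) r _) ≈⟨ *-assoc _ _ _ ⟨
    weight k * β k * form (mixed k) r _ ∎))

  -- Here 1 - q times the expected value (-3/m) q^(-(m-1)/2) [m] at m = 2i + 1.
  nodeValue : ℕ → Carrier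
  nodeValue i = ⟦ χ i ⟧ℤ * (1# - node i) * proj₁ (unit-q^ i)

  -- The coefficients `weight k * β k` do not depend on the point, so interpolating each cleared
  -- summand and exchanging the two summations brings in the whole sums at the nodes. These
  -- terminate before r + 1 and are known by `evaluation`.
  interpolatedSum : ∀ {p h} → Summand p h → ∀ r →
    form poles r p * cubicSum h (suc r) ≈ ∑ (λ i → form poles r (node i) * nodeValue i * ∏ (ratio p i) (suc r)) (suc r)
  interpolatedSum {p} {h} hh r = begin
    form poles r p * cubicSum h n
      ≈⟨ cubicSum-cleared hh r ⟩
    ∑ (λ k → weight k * β k * form (mixed k) r p) n
      ≈⟨ ∑-cong n (λ k _ → trans (*-congˡ (interpolate (mixed k) r p)) (*-distribˡ-∑ _ _ n)) ⟩
    ∑ (λ k → ∑ (λ i → weight k * β k * (form (mixed k) r (node i) * L i)) n) n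
      ≈⟨ ∑-comm _ n n ⟩
    ∑ (λ i → ∑ (λ k → weight k * β k * (form (mixed k) r (node i) * L i)) n) n
      ≈⟨ ∑-cong n (λ i i<n → begin
        ∑ (λ k → weight k * β k * (form (mixed k) r (node i) * L i)) n
          ≈⟨ ∑-cong n (λ k _ → solve 4 (λ w b f l → w :* b :* (f :* l) := l :* (w :* b :* f)) refl _ _ _ _) ⟩
        ∑ (λ k → L i * (weight k * β k * form (mixed k) r (node i))) n
          ≈⟨ *-distribˡ-∑ _ _ n ⟨
        L i * ∑ (λ k → weight k * β k * form (mixed k) r (node i)) n
          ≈⟨ *-congˡ (cubicSum-cleared (hB i) r) ⟨
        L i * (form poles r (node i) * cubicSum (B i) n)
          ≈⟨ *-congˡ (*-congˡ (value i i<n)) ⟩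
        L i * (form poles r (node i) * nodeValue i)
          ≈⟨ *-comm _ _ ⟩
        form poles r (node i) * nodeValue i * L i ∎) ⟩
    ∑ (λ i → form poles r (node i) * nodeValue i * L i) n ∎
    where
    n = suc r
    L : ℕ → Carrier
    L i = ∏ (ratio p i) n
    B : ℕ → ℕ → Carrier
    B i = proj₁ (hterm (λ k → num (node i) (q ^ k)) _ (unit-den i))
    hB : ∀ i → Summand (node i) (B i)
    hB i = proj₂ (hterm (λ k → num (node i) (q ^ k)) _ (unit-den i))
    value : ∀ i → i < n → cubicSum (B i) n ≈ nodeValue i
    value i i<n = unit-cancel (unit-q^ i) (begin
      cubicSum (B i) n * q ^ i                                   ≈⟨ evaluation i (hB i) i<n ⟩
      ⟦ χ i ⟧ℤ * (1# - node i)                                   ≈⟨ *-identityʳ _ ⟨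
      ⟦ χ i ⟧ℤ * (1# - node i) * 1#                              ≈⟨ *-congˡ (proj₂ (unit-q^ i)) ⟨
      ⟦ χ i ⟧ℤ * (1# - node i) * (q ^ i * proj₁ (unit-q^ i))     ≈⟨ solve 3 (λ a b c → a :* (b :* c) := a :* c :* b) refl _ _ _ ⟩
      nodeValue i * q ^ i                                        ∎)

-- Multiples of d in arithmetic progressions

module NaturalSums where
  open import Data.Nat using (_+_)
  open import Data.Integer.Divisibility.Signed using (_∣_; _∣?_; ∣m∣n⇒∣m+n; ∣m∣n⇒∣m-n; ∣m⇒∣m*n; ∣n⇒∣m*n; ∣m⇒∣-m)
  open ≡ hiding ([_])

  sumℕ : (ℕ → ℕ) → ℕ → ℕ
  sumℕ f zero    = 0
  sumℕ f (suc n) = sumℕ f n + f n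

  sumℕ-cong : ∀ {f g} n → (∀ i → i < n → f i ≡ g i) → sumℕ f n ≡ sumℕ g n
  sumℕ-cong zero    eq = refl
  sumℕ-cong (suc n) eq = cong₂ _+_ (sumℕ-cong n (λ i i<n → eq i (ℕ.m<n⇒m<1+n i<n))) (eq n ℕ.≤-refl)

  sumℕ-suc : ∀ f n → sumℕ f (suc n) ≡ f 0 + sumℕ (λ i → f (suc i)) n
  sumℕ-suc f zero    = sym (ℕ.+-identityʳ (f 0))
  sumℕ-suc f (suc n) = trans (cong (λ z → z + f (suc n)) (sumℕ-suc f n)) (ℕ.+-assoc (f 0) _ _)

  sumℕ-+ : ∀ f g n → sumℕ (λ i → f i + g i) n ≡ sumℕ f n + sumℕ g n
  sumℕ-+ f g zero    = refl
  sumℕ-+ f g (suc n) = trans (cong (λ z → z + (f n + g n)) (sumℕ-+ f g n)) (interchange (sumℕ f n) (sumℕ g n) (f n) (g n))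
    where open import Algebra.Properties.CommutativeSemigroup ℕ.+-commutativeSemigroup using (interchange)

  skip : ℕ → (ℕ → ℕ) → ℕ → ℕ
  skip i f j with i ℕ.≟ j
  ... | yes _ = 0
  ... | no _  = f j

  sumℕ-skip : ∀ {i} n f → i < n → sumℕ f n ≡ f i + sumℕ (skip i f) n
  sumℕ-skip {i} (suc n) f (s≤s i≤n) with i ℕ.≟ n
  ... | yes refl = trans (ℕ.+-comm _ (f i)) (cong (λ z → f i + z) (trans (sumℕ-cong i below) (sym (ℕ.+-identityʳ _))))
    where
    below : ∀ j → j < i → f j ≡ skip i f j
    below j j<i with i ℕ.≟ j
    ... | yes i≡j = ⊥-elim (ℕ.<⇒≢ j<i (sym i≡j))
    ... | no _    = refl
  ... | no i≢n   = trans (cong (λ z → z + f n) (sumℕ-skip n f (ℕ.≤∧≢⇒< i≤n i≢n))) (ℕ.+-assoc (f i) _ _)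

  module Counting (d : ℕ) (n : ℕ) (d∣n : + d ∣ + n) where

    δ : ℤ → ℕ
    δ z with + d ∣? z
    ... | yes _ = 1
    ... | no _  = 0

    δ-yes : ∀ {z} → + d ∣ z → δ z ≡ 1
    δ-yes {z} d∣z with + d ∣? z
    ... | yes _   = refl
    ... | no ¬d∣z = ⊥-elim (¬d∣z d∣z)

    δ-no : ∀ {z} → ¬ (+ d ∣ z) → δ z ≡ 0
    δ-no {z} ¬d∣z with + d ∣? z
    ... | yes d∣z = ⊥-elim (¬d∣z d∣z)
    ... | no _    = refl

    δ-equiv : ∀ {z w} → (+ d ∣ z → + d ∣ w) → (+ d ∣ w → + d ∣ z) → δ z ≡ δ w
    δ-equiv {z} {w} f g with + d ∣? z
    ... | yes d∣z = sym (δ-yes (f d∣z))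
    ... | no ¬d∣z = sym (δ-no (λ d∣w → ¬d∣z (g d∣w)))

    δ-cong : ∀ {z w} x → z ≡ w ℤ.+ x → + d ∣ x → δ z ≡ δ w
    δ-cong {z} {w} x refl d∣x = δ-equiv
      (λ h → subst (+ d ∣_) (lemma w x) (∣m∣n⇒∣m-n h d∣x))
      (λ h → ∣m∣n⇒∣m+n h d∣x)
      where
      lemma : ∀ w x → (w ℤ.+ x) ℤ.- x ≡ w
      lemma = solve-∀

    δ-neg : ∀ z → δ (ℤ.- z) ≡ δ z
    δ-neg z = δ-equiv (λ h → subst (+ d ∣_) (ℤ.neg-involutive z) (∣m⇒∣-m h)) ∣m⇒∣-m

    count : ℤ → ℤ → ℕ
    count α β = sumℕ (λ i → δ (α ℤ.* + i ℤ.+ β)) n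

    -- The progression loses its value at i = 0 and gains the one at i = n; these agree modulo d
    -- because d divides n.
    count-suc : ∀ α β → count α (β ℤ.+ α) ≡ count α β
    count-suc α β = ℕ.+-cancelˡ-≡ (δ (α ℤ.* + 0 ℤ.+ β)) _ _ (begin
      δ (α ℤ.* + 0 ℤ.+ β) + count α (β ℤ.+ α)
        ≡⟨ cong (λ z → δ (α ℤ.* + 0 ℤ.+ β) + z) (sumℕ-cong n (λ i _ → cong δ (trans (lemma α β (+ i)) (cong (λ z → α ℤ.* z ℤ.+ β) (ℤ.+-comm (+ i) (+ 1)))))) ⟩
      δ (α ℤ.* + 0 ℤ.+ β) + sumℕ (λ i → δ (α ℤ.* + suc i ℤ.+ β)) n
        ≡⟨ sumℕ-suc (λ i → δ (α ℤ.* + i ℤ.+ β)) n ⟨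
      count α β + δ (α ℤ.* + n ℤ.+ β)
        ≡⟨ cong (λ z → count α β + z) (δ-cong (α ℤ.* + n) (lemma₂ α β (+ n)) (∣n⇒∣m*n α d∣n)) ⟩
      count α β + δ (α ℤ.* + 0 ℤ.+ β)
        ≡⟨ ℕ.+-comm (count α β) _ ⟩
      δ (α ℤ.* + 0 ℤ.+ β) + count α β ∎)
      where
      open ≡-Reasoning
      lemma : ∀ α β i → α ℤ.* i ℤ.+ (β ℤ.+ α) ≡ α ℤ.* (i ℤ.+ + 1) ℤ.+ β
      lemma = solve-∀
      lemma₂ : ∀ α β n → α ℤ.* n ℤ.+ β ≡ (α ℤ.* + 0 ℤ.+ β) ℤ.+ α ℤ.* n
      lemma₂ = solve-∀

    count-shift : ∀ α β t → count α (β ℤ.+ α ℤ.* t) ≡ count α β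
    count-shift α β (+ t) = go t
      where
      lemma : ∀ α β t → β ℤ.+ α ℤ.* (+ 1 ℤ.+ t) ≡ (β ℤ.+ α ℤ.* t) ℤ.+ α
      lemma = solve-∀
      go : ∀ t → count α (β ℤ.+ α ℤ.* + t) ≡ count α β
      go zero    = cong (count α) (trans (cong (λ z → β ℤ.+ z) (ℤ.*-zeroʳ α)) (ℤ.+-identityʳ β))
      go (suc t) = trans (cong (count α) (lemma α β (+ t))) (trans (count-suc α _) (go t))
    count-shift α β t@(-[1+ k ]) = sym (trans (cong (count α) (lemma α β t)) (count-shift α (β ℤ.+ α ℤ.* t) (+ suc k)))
      where
      lemma : ∀ α β t → β ≡ (β ℤ.+ α ℤ.* t) ℤ.+ α ℤ.* (ℤ.- t)
      lemma = solve-∀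

    multiples : ℕ
    multiples = sumℕ (λ i → δ (+ i)) n

    -- β ≡ −α s β (mod d) is a multiple of α, so α i + β is a shift of the progression α i.
    module _ (α s : ℤ) (d∣1+αs : + d ∣ + 1 ℤ.+ α ℤ.* s) where

      δ-* : ∀ z → δ (α ℤ.* z) ≡ δ z
      δ-* z = δ-equiv
        (λ h → subst (+ d ∣_) (lemma α s z) (∣m∣n⇒∣m-n (∣m⇒∣m*n z d∣1+αs) (∣n⇒∣m*n s h)))
        (∣n⇒∣m*n α)
        where
        lemma : ∀ α s z → (+ 1 ℤ.+ α ℤ.* s) ℤ.* z ℤ.- s ℤ.* (α ℤ.* z) ≡ z
        lemma = solve-∀

      count-all : ∀ β → count α β ≡ multiples
      count-all β = begin
        count α β                                 ≡⟨ count-shift α β (s ℤ.* β) ⟨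
        count α (β ℤ.+ α ℤ.* (s ℤ.* β))           ≡⟨ sumℕ-cong n (λ i _ → δ-cong ((+ 1 ℤ.+ α ℤ.* s) ℤ.* β) (lemma α s β (+ i)) (∣m⇒∣m*n β d∣1+αs)) ⟩
        sumℕ (λ i → δ (α ℤ.* + i)) n              ≡⟨ sumℕ-cong n (λ i _ → δ-* (+ i)) ⟩
        multiples                                 ∎
        where
        open ≡-Reasoning
        lemma : ∀ α s β i → α ℤ.* i ℤ.+ (β ℤ.+ α ℤ.* (s ℤ.* β)) ≡ α ℤ.* i ℤ.+ (+ 1 ℤ.+ α ℤ.* s) ℤ.* β
        lemma = solve-∀

open NaturalSums using (sumℕ)

-- Subrings and the order at φ

record IsSubring (K : CommutativeRing 0ℓ 0ℓ) (P : CommutativeRing.Carrier K → Set) : Set where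
  open CommutativeRing K
  field
    resp : ∀ {x y} → x ≈ y → P x → P y
    0∈   : P 0#
    1∈   : P 1#
    +∈   : ∀ {x y} → P x → P y → P (x + y)
    *∈   : ∀ {x y} → P x → P y → P (x * y)
    -∈   : ∀ {x} → P x → P (- x)

module Valuation (K : CommutativeRing 0ℓ 0ℓ) (Loc : CommutativeRing.Carrier K → Set) (isSubring : IsSubring K Loc)
                 (φ : CommutativeRing.Carrier K) (φ∈ : Loc φ) (unit-φ : Ranges.Unit K φ) where
  open CommutativeRing K
  open IntegerCoefficients K
  open Ranges K
  open IsSubring isSubring
  open import Algebra.Properties.Semiring.Exp semiring
  open import Relation.Binary.Reasoning.Setoid setoid

  record Order≥ (k : ℕ) (z : Carrier) : Set where
    constructor order≥
    field
      cofactor  : Carrier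
      cofactor∈ : Loc cofactor
      equal     : z ≈ φ ^ k * cofactor

  Invertible : Carrier → Set
  Invertible w = Loc w × ∃ λ v → Loc v × w * v ≈ 1#

  record Order (k : ℕ) (z : Carrier) : Set where
    constructor order
    field
      cofactor   : Carrier
      invertible : Invertible cofactor
      equal      : z ≈ φ ^ k * cofactor

  φ^∈ : ∀ k → Loc (φ ^ k)
  φ^∈ zero    = 1∈
  φ^∈ (suc k) = *∈ φ∈ (φ^∈ k)

  unit-φ^ : ∀ k → Unit (φ ^ k)
  unit-φ^ = unit-^ unit-φ

  Order≥-resp : ∀ {k x y} → x ≈ y → Order≥ k x → Order≥ k y
  Order≥-resp x≈y (order≥ w w∈ x≈) = order≥ w w∈ (trans (sym x≈y) x≈)

  Order-resp : ∀ {k x y} → x ≈ y → Order k x → Order k y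
  Order-resp x≈y (order w w∈ x≈) = order w w∈ (trans (sym x≈y) x≈)

  Order⇒≥ : ∀ {k x} → Order k x → Order≥ k x
  Order⇒≥ (order w (w∈ , _) x≈) = order≥ w w∈ x≈

  Loc⇒≥ : ∀ {x} → Loc x → Order≥ 0 x
  Loc⇒≥ x∈ = order≥ _ x∈ (sym (*-identityˡ _))

  Order≥-0 : ∀ {k} → Order≥ k 0#
  Order≥-0 = order≥ 0# 0∈ (sym (zeroʳ _))

  Order≥-+ : ∀ {k x y} → Order≥ k x → Order≥ k y → Order≥ k (x + y)
  Order≥-+ (order≥ w w∈ x≈) (order≥ v v∈ y≈) = order≥ (w + v) (+∈ w∈ v∈) (trans (+-cong x≈ y≈) (sym (distribˡ _ _ _)))

  Order≥-- : ∀ {k x} → Order≥ k x → Order≥ k (- x)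
  Order≥-- (order≥ w w∈ x≈) = order≥ (- w) (-∈ w∈) (trans (-‿cong x≈) (solve 2 (λ a b → :- (a :* b) := a :* (:- b)) refl _ _))

  Order≥-* : ∀ {k l x y} → Order≥ k x → Order≥ l y → Order≥ (k ℕ.+ l) (x * y)
  Order≥-* {k} {l} (order≥ w w∈ x≈) (order≥ v v∈ y≈) = order≥ (w * v) (*∈ w∈ v∈) (trans (*-cong x≈ y≈)
    (trans (solve 4 (λ a b c d → (a :* b) :* (c :* d) := (a :* c) :* (b :* d)) refl _ _ _ _) (*-congʳ (sym (^-homo-* φ k l)))))

  Order≥-∑ : ∀ {k} f n → (∀ i → i < n → Order≥ k (f i)) → Order≥ k (∑ f n)
  Order≥-∑ f zero    _ = Order≥-0
  Order≥-∑ f (suc n) o = Order≥-+ (Order≥-∑ f n (λ i i<n → o i (ℕ.m<n⇒m<1+n i<n))) (o n ℕ.≤-refl)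

  Order≥-weaken : ∀ {k l x} → k ≤ l → Order≥ l x → Order≥ k x
  Order≥-weaken {k} {l} k≤l (order≥ w w∈ x≈) = order≥ (φ ^ (l ℕ.∸ k) * w) (*∈ (φ^∈ (l ℕ.∸ k)) w∈)
    (trans x≈ (trans (*-congʳ (trans (^-congʳ φ (≡.sym (ℕ.m+[n∸m]≡n k≤l))) (^-homo-* φ k (l ℕ.∸ k)))) (*-assoc _ _ _)))

  Order-* : ∀ {k l x y} → Order k x → Order l y → Order (k ℕ.+ l) (x * y)
  Order-* {k} {l} (order w (w∈ , w′ , w′∈ , ww′) x≈) (order v (v∈ , v′ , v′∈ , vv′) y≈) =
    order (w * v) (*∈ w∈ v∈ , w′ * v′ , *∈ w′∈ v′∈ , proj₂ (unit-* (w′ , ww′) (v′ , vv′))) (trans (*-cong x≈ y≈)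
    (trans (solve 4 (λ a b c d → (a :* b) :* (c :* d) := (a :* c) :* (b :* d)) refl _ _ _ _) (*-congʳ (sym (^-homo-* φ k l)))))

  Order-- : ∀ {k x} → Order k x → Order k (- x)
  Order-- (order w (w∈ , w′ , w′∈ , ww′) x≈) = order (- w) (-∈ w∈ , - w′ , -∈ w′∈ , proj₂ (unit-- (w′ , ww′)))
    (trans (-‿cong x≈) (solve 2 (λ a b → :- (a :* b) := a :* (:- b)) refl _ _))

  Invertible⇒Order : ∀ {x} → Invertible x → Order 0 x
  Invertible⇒Order x∈ = order _ x∈ (sym (*-identityˡ _))

  Order-1 : Order 0 1#
  Order-1 = Invertible⇒Order (1∈ , 1# , 1∈ , *-identityˡ 1#)

  Order-∏ : ∀ {o} f n → (∀ i → i < n → Order (o i) (f i)) → Order (sumℕ o n) (∏ f n)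
  Order-∏ f zero    _ = Order-1
  Order-∏ f (suc n) o = Order-* (Order-∏ f n (λ i i<n → o i (ℕ.m<n⇒m<1+n i<n))) (o n ℕ.≤-refl)

  -- The divisor has an exact order, so its cofactor can be inverted inside `Loc`; the power of φ is
  -- cancelled in K, where φ is a unit.
  Order≥-quotient : ∀ {a b k x w z} → x * w ≈ z → Order b w → Order≥ a z → a ≡ b ℕ.+ k → Order≥ k x
  Order≥-quotient {_} {b} {k} {x} {w} {z} xw≈z (order u (u∈ , u′ , u′∈ , uu′) w≈) (order≥ v v∈ z≈) ≡.refl =
    order≥ (v * u′) (*∈ v∈ u′∈) (unit-cancel (unit-* (unit-φ^ b) (u′ , uu′)) (begin
      x * (φ ^ b * u)             ≈⟨ *-congˡ w≈ ⟨
      x * w                       ≈⟨ xw≈z ⟩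
      z                           ≈⟨ z≈ ⟩
      φ ^ (b ℕ.+ k) * v           ≈⟨ *-congʳ (^-homo-* φ b k) ⟩
      (φ ^ b * φ ^ k) * v         ≈⟨ solve 3 (λ b k v → (b :* k) :* v := k :* (v :* con (+ 1)) :* b) refl _ _ _ ⟩
      φ ^ k * (v * 1#) * φ ^ b    ≈⟨ *-congʳ (*-congˡ (*-congˡ uu′)) ⟨
      φ ^ k * (v * (u * u′)) * φ ^ b ≈⟨ solve 5 (λ k v u u′ b → k :* (v :* (u :* u′)) :* b := k :* (v :* u′) :* (b :* u)) refl _ _ _ _ _ ⟩
      φ ^ k * (v * u′) * (φ ^ b * u) ∎))

  infix 4 _≡_[_]
  _≡_[_] : Carrier → Carrier → ℕ → Set
  x ≡ y [ k ] = Order≥ k (x - y)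

  cong-refl : ∀ {k x y} → x ≈ y → x ≡ y [ k ]
  cong-refl x≈y = Order≥-resp (trans (sym (-‿inverseʳ _)) (+-congʳ (sym x≈y))) Order≥-0

  cong-sym : ∀ {k x y} → x ≡ y [ k ] → y ≡ x [ k ]
  cong-sym c = Order≥-resp (solve 2 (λ x y → :- (x :- y) := y :- x) refl _ _) (Order≥-- c)

  cong-trans : ∀ {k x y z} → x ≡ y [ k ] → y ≡ z [ k ] → x ≡ z [ k ]
  cong-trans {y = y} c d = Order≥-resp (solve 3 (λ x y z → (x :- y) :+ (y :- z) := x :- z) refl _ y _) (Order≥-+ c d)

  cong-* : ∀ {k x x′ y y′} → Loc x → Loc y′ → x ≡ x′ [ k ] → y ≡ y′ [ k ] → x * y ≡ x′ * y′ [ k ]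
  cong-* {x = x} {x′} {y} {y′} x∈ y′∈ c d = Order≥-resp (solve 4 (λ x x′ y y′ → x :* (y :- y′) :+ y′ :* (x :- x′) := x :* y :- x′ :* y′) refl x x′ y y′)
    (Order≥-+ (Order≥-* (Loc⇒≥ x∈) d) (Order≥-* (Loc⇒≥ y′∈) c))

  ∏∈ : ∀ f n → (∀ i → i < n → Loc (f i)) → Loc (∏ f n)
  ∏∈ f zero    _ = 1∈
  ∏∈ f (suc n) l = *∈ (∏∈ f n (λ i i<n → l i (ℕ.m<n⇒m<1+n i<n))) (l n ℕ.≤-refl)

  cong-∏ : ∀ {k} f g n → (∀ i → i < n → Loc (f i)) → (∀ i → i < n → Loc (g i)) → (∀ i → i < n → f i ≡ g i [ k ]) → ∏ f n ≡ ∏ g n [ k ]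
  cong-∏ f g zero    _ _ _ = cong-refl refl
  cong-∏ f g (suc n) lf lg c = cong-* (∏∈ f n (λ i i<n → lf i (ℕ.m<n⇒m<1+n i<n))) (lg n ℕ.≤-refl)
    (cong-∏ f g n (λ i i<n → lf i (ℕ.m<n⇒m<1+n i<n)) (λ i i<n → lg i (ℕ.m<n⇒m<1+n i<n)) (λ i i<n → c i (ℕ.m<n⇒m<1+n i<n))) (c n ℕ.≤-refl)

-- The congruences at a single cyclotomic factor

module CubicCongruence where
  open import Data.Integer.Divisibility.Signed using (_∣_; divides; _∣?_; ∣⇒∣ᵤ)
  open NaturalSums

  -- Apart from the invertibility of q, what is known about φ is `order-1-q^`: the factor 1 - q^i
  -- has order 1 if d divides i and order 0 otherwise. The integer s is minus an inverse of 6 modulo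
  -- d.
  module Congruence
      (K : CommutativeRing 0ℓ 0ℓ) (Loc : CommutativeRing.Carrier K → Set) (isSubring : IsSubring K Loc)
      (φ : CommutativeRing.Carrier K) (φ∈ : Loc φ) (unit-φ : Ranges.Unit K φ)
      (q : CommutativeRing.Carrier K) (unit-q : Ranges.Unit K q)
      (unit-1-q^ : ∀ i → Ranges.Unit K (CommutativeRing._-_ K (CommutativeRing.1# K)
         (Algebra.Properties.Semiring.Exp._^_ (CommutativeRing.semiring K) q (suc i))))
      (h d : ℕ) (d∣n : + d ∣ + suc (2 ℕ.* h)) (s : ℤ) (d∣1+6s : + d ∣ + 1 ℤ.+ + 6 ℤ.* s)
      (invertible-q : Valuation.Invertible K Loc isSubring φ φ∈ unit-φ q)
      (order-1-q^ : ∀ i → Valuation.Order K Loc isSubring φ φ∈ unit-φ (Counting.δ d (suc (2 ℕ.* h)) d∣n (+ suc i))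
         (CommutativeRing._-_ K (CommutativeRing.1# K) (Algebra.Properties.Semiring.Exp._^_ (CommutativeRing.semiring K) q (suc i))))
      where
    open CommutativeRing K
    open IntegerCoefficients K
    open Ranges K
    open CubicSum K q
    open Evaluation unit-q unit-1-q^
    open Lagrange K
    open InterpolatedSum K q unit-q unit-1-q^
    open IsSubring isSubring
    open Valuation K Loc isSubring φ φ∈ unit-φ
    open import Algebra.Properties.Semiring.Exp semiring
    open import Relation.Binary.Reasoning.Setoid setoid

    r n : ℕ
    r = 2 ℕ.* h
    n = suc r

    open Counting d n d∣n

    exponent : ℕ → ℕ
    exponent i = suc (2 ℕ.* i)

    δ-0 : δ (+ 0) ≡ 1
    δ-0 = δ-yes (divides (+ 0) ≡.refl)

    Order-q^ : ∀ i → Order 0 (q ^ i)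
    Order-q^ zero    = Order-1
    Order-q^ (suc i) = Order-* (Invertible⇒Order invertible-q) (Order-q^ i)

    q∈ : Loc q
    q∈ = proj₁ invertible-q

    q^∈ : ∀ i → Loc (q ^ i)
    q^∈ zero    = 1∈
    q^∈ (suc i) = *∈ q∈ (q^∈ i)

    Order-q^-q^ : ∀ i j → i ≢ j → Order (δ (+ i ℤ.- + j)) (q ^ i - q ^ j)
    Order-q^-q^ zero    zero    i≢j = ⊥-elim (i≢j ≡.refl)
    Order-q^-q^ zero    (suc j) _   = ≡.subst (λ k → Order k (1# - q ^ suc j)) (≡.sym (δ-neg (+ suc j))) (order-1-q^ j)
    Order-q^-q^ (suc i) zero    _   = Order-resp (solve 1 (λ x → :- (con (+ 1) :- x) := x :- con (+ 1)) refl _)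
      (Order-- (≡.subst (λ k → Order k (1# - q ^ suc i)) (≡.cong δ (≡.sym (ℤ.+-identityʳ (+ suc i)))) (order-1-q^ i)))
    Order-q^-q^ (suc i) (suc j) i≢j = ≡.subst (λ k → Order k _) (≡.cong δ (lemma (+ i) (+ j)))
      (Order-resp (solve 3 (λ q x y → q :* (x :- y) := q :* x :- q :* y) refl q (q ^ i) (q ^ j))
        (Order-* (Invertible⇒Order invertible-q) (Order-q^-q^ i j (λ i≡j → i≢j (≡.cong suc i≡j)))))
      where
      lemma : ∀ i j → i ℤ.- j ≡ (+ 1 ℤ.+ i) ℤ.- (+ 1 ℤ.+ j)
      lemma = solve-∀

    Order-bracket : ∀ {i j} → i ≢ j → Order (δ (+ i ℤ.- + j) ℕ.+ δ (+ i ℤ.+ + j)) (bracket (q ^ i) (q ^ j))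
    Order-bracket {i} {j} i≢j = Order-*
      (Order-resp (solve 2 (λ x y → :- (x :- y) := y :- x) refl _ _) (Order-- (Order-q^-q^ i j i≢j)))
      (Order-resp (+-congˡ (-‿cong (trans (^-homo-* q i j) (*-comm _ _)))) (order-1-q^+ i j i≢j))
      where
      order-1-q^+ : ∀ i j → i ≢ j → Order (δ (+ i ℤ.+ + j)) (1# - q ^ (i ℕ.+ j))
      order-1-q^+ zero    zero    i≢j = ⊥-elim (i≢j ≡.refl)
      order-1-q^+ zero    (suc j) _   = order-1-q^ j
      order-1-q^+ (suc i) j       _   = order-1-q^ (i ℕ.+ j)

    poles-pow : ∀ k → poles k ≈ q ^ (6 ℕ.* suc k)
    poles-pow k = begin
      q ^ 6 * (q ^ k) ^ 6 ≈⟨ solve 2 (λ q t → q :^ 6 :* t :^ 6 := (q :* t) :^ 6) refl q (q ^ k) ⟩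
      (q ^ suc k) ^ 6     ≈⟨ ^-assocʳ q (suc k) 6 ⟩
      q ^ (suc k ℕ.* 6)   ≡⟨ ≡.cong (q ^_) (ℕ.*-comm (suc k) 6) ⟩
      q ^ (6 ℕ.* suc k)   ∎

    private
      at : ℕ → ℕ → ℕ
      at m k = δ (+ k ℤ.- + m) ℕ.+ δ (+ k ℤ.+ + m)

      -- As 6 is invertible modulo d, each of the progressions 6k - m and 6k + m meets the multiples
      -- of d as often as k itself does.
      count₆ : ∀ m → sumℕ (λ k → at m (6 ℕ.* k)) n ≡ multiples ℕ.+ multiples
      count₆ m = ≡.trans (sumℕ-+ _ _ n) (≡.cong₂ ℕ._+_
        (≡.trans (sumℕ-cong n (λ k _ → ≡.cong (λ z → δ (z ℤ.- + m)) (ℤ.pos-* 6 k))) (count-all (+ 6) s d∣1+6s (ℤ.- + m)))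
        (≡.trans (sumℕ-cong n (λ k _ → ≡.cong (λ z → δ (z ℤ.+ + m)) (ℤ.pos-* 6 k))) (count-all (+ 6) s d∣1+6s (+ m))))

      -- Thus h is minus an inverse of 2 modulo d.
      d∣1+2h : + d ∣ + 1 ℤ.+ + 2 ℤ.* + h
      d∣1+2h = ≡.subst (+ d ∣_) (≡.cong (λ z → + 1 ℤ.+ z) (ℤ.pos-* 2 h)) d∣n

      count₂ : ∀ m → sumℕ (λ j → δ (+ m ℤ.- + exponent j) ℕ.+ δ (+ m ℤ.+ + exponent j)) n ≡ multiples ℕ.+ multiples
      count₂ m = ≡.trans (sumℕ-+ _ _ n) (≡.cong₂ ℕ._+_
        (≡.trans (sumℕ-cong n (λ j _ → ≡.trans (≡.sym (δ-neg _)) (≡.cong δ (≡.trans (≡.cong (λ z → ℤ.- (+ m ℤ.- (+ 1 ℤ.+ z))) (ℤ.pos-* 2 j)) (lemma₁ (+ m) (+ j))))))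
          (count-all (+ 2) (+ h) d∣1+2h (+ 1 ℤ.- + m)))
        (≡.trans (sumℕ-cong n (λ j _ → ≡.cong δ (≡.trans (≡.cong (λ z → + m ℤ.+ (+ 1 ℤ.+ z)) (ℤ.pos-* 2 j)) (lemma₂ (+ m) (+ j)))))
          (count-all (+ 2) (+ h) d∣1+2h (+ 1 ℤ.+ + m))))
        where
        lemma₁ : ∀ m j → ℤ.- (m ℤ.- (+ 1 ℤ.+ + 2 ℤ.* j)) ≡ + 2 ℤ.* j ℤ.+ (+ 1 ℤ.- m)
        lemma₁ = solve-∀
        lemma₂ : ∀ m j → m ℤ.+ (+ 1 ℤ.+ + 2 ℤ.* j) ≡ + 2 ℤ.* j ℤ.+ (+ 1 ℤ.+ m)
        lemma₂ = solve-∀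

    orderC : ℕ → ℕ
    orderC m = sumℕ (λ k → at m (6 ℕ.* suc k)) r

    Order-C : ∀ m → (∀ k → 6 ℕ.* suc k ≢ m) → Order (orderC m) (form poles r (q ^ m))
    Order-C m ≢m = Order-∏ _ r (λ k _ → Order-resp (bracket-cong (sym (poles-pow k)) refl) (Order-bracket (≢m k)))

    -- C(m) omits k = 0, whose exponents -m and m make up the two extra terms.
    orderC-eq : ∀ m → (δ (+ m) ℕ.+ δ (+ m)) ℕ.+ orderC m ≡ multiples ℕ.+ multiples
    orderC-eq m = ≡.trans (≡.cong (λ z → (z ℕ.+ δ (+ m)) ℕ.+ orderC m) (≡.sym (≡.trans (≡.cong δ (ℤ.+-identityˡ (ℤ.- + m))) (δ-neg (+ m)))))
      (≡.trans (≡.sym (sumℕ-suc (λ k → at m (6 ℕ.* k)) r)) (count₆ m))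

    -- The numerator of the Lagrange basis form of node i at p; for p = `node i` it is the
    -- denominator.
    others : Carrier → ℕ → Carrier
    others p i = ∏ (replace i 1# (λ j → bracket p (node j))) n

    orderOthers : ℕ → ℕ → ℕ
    orderOthers m i = sumℕ (skip i (λ j → δ (+ m ℤ.- + exponent j) ℕ.+ δ (+ m ℤ.+ + exponent j))) n

    Order-others : ∀ m i → (∀ j → i ≢ j → m ≢ exponent j) → Order (orderOthers m i) (others (q ^ m) i)
    Order-others m i m≢ = Order-∏ _ n pointwise
      where
      pointwise : ∀ j → j < n → Order (skip i (λ j → δ (+ m ℤ.- + exponent j) ℕ.+ δ (+ m ℤ.+ + exponent j)) j)
                                      (replace i 1# (λ j → bracket (q ^ m) (node j)) j)
      pointwise j _ with i ℕ.≟ j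
      ... | yes _  = Order-1
      ... | no i≢j = Order-bracket (m≢ j i≢j)

    orderOthers-eq : ∀ m i → i < n → (δ (+ m ℤ.- + exponent i) ℕ.+ δ (+ m ℤ.+ + exponent i)) ℕ.+ orderOthers m i ≡ multiples ℕ.+ multiples
    orderOthers-eq m i i<n = ≡.trans (≡.sym (sumℕ-skip n _ i<n)) (count₂ m)

    ratio-others : ∀ p i → ∏ (ratio p i) n * others (node i) i ≈ others p i
    ratio-others p i = trans (sym (∏-* _ _ n)) (∏-cong n pointwise)
      where
      pointwise : ∀ j → j < n → ratio p i j * replace i 1# (λ j → bracket (node i) (node j)) j ≈ replace i 1# (λ j → bracket p (node j)) j
      pointwise j _ with i ℕ.≟ j
      ... | yes _  = *-identityˡ 1#
      ... | no i≢j = begin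
        (bracket p (node j) * b⁻¹ i j) * bracket (node i) (node j)
          ≈⟨ solve 3 (λ a b c → (a :* b) :* c := a :* (c :* b)) refl _ _ _ ⟩
        bracket p (node j) * (bracket (node i) (node j) * b⁻¹ i j)
          ≈⟨ *-congˡ (b⁻¹-inverse i≢j) ⟩
        bracket p (node j) * 1#
          ≈⟨ *-identityʳ _ ⟩
        bracket p (node j) ∎

    unit-C₁ : Unit (form poles r 1#)
    unit-C₁ = unit-∏ _ r (λ k _ → unit-resp (bracket-cong (sym (poles-pow k)) refl)
      (unit-* (unit-1-q^ (k ℕ.+ 5 ℕ.* suc k)) (unit-resp (+-congˡ (-‿cong (sym (*-identityˡ (q ^ (6 ℕ.* suc k)))))) (unit-1-q^ (k ℕ.+ 5 ℕ.* suc k)))))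

    -- The summand of node i in the interpolation at m = 0, that is at the point 1, after division
    -- by C(0).
    contribution : ℕ → Carrier
    contribution i = (form poles r (node i) * nodeValue i * ∏ (ratio 1# i) n) * proj₁ unit-C₁

    contribution-eq : ∀ i → contribution i * (form poles r 1# * others (node i) i) ≈ nodeValue i * (form poles r (node i) * others 1# i)
    contribution-eq i = begin
      ((c * v * l) * w) * (c₁ * o)   ≈⟨ solve 6 (λ c v l w c₁ o → ((c :* v :* l) :* w) :* (c₁ :* o) := (c :* v) :* (l :* o) :* (c₁ :* w)) refl c v l w c₁ o ⟩
      (c * v) * (l * o) * (c₁ * w)   ≈⟨ *-cong (*-congˡ (ratio-others 1# i)) (proj₂ unit-C₁) ⟩
      (c * v) * others 1# i * 1#     ≈⟨ solve 3 (λ c v o → (c :* v) :* o :* con (+ 1) := v :* (c :* o)) refl c v _ ⟩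
      v * (c * others 1# i)          ∎
      where
      c = form poles r (node i)
      v = nodeValue i
      l = ∏ (ratio 1# i) n
      w = proj₁ unit-C₁
      c₁ = form poles r 1#
      o = others (node i) i

    contribution-cleared : ∀ i → form poles r 1# * contribution i ≈ form poles r (node i) * nodeValue i * ∏ (ratio 1# i) n
    contribution-cleared i = begin
      c₁ * (t * w)  ≈⟨ solve 3 (λ c w t → c :* (t :* w) := t :* (c :* w)) refl c₁ w t ⟩
      t * (c₁ * w)  ≈⟨ *-congˡ (proj₂ unit-C₁) ⟩
      t * 1#        ≈⟨ *-identityʳ t ⟩
      t             ∎
      where
      c₁ = form poles r 1#
      w = proj₁ unit-C₁
      t = form poles r (node i) * nodeValue i * ∏ (ratio 1# i) n

    cubicSum-contributions : ∀ {f} → Summand 1# f → cubicSum f n ≈ ∑ contribution n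
    cubicSum-contributions {f} hf = unit-cancel unit-C₁ (begin
      cubicSum f n * form poles r 1#              ≈⟨ *-comm _ _ ⟩
      form poles r 1# * cubicSum f n              ≈⟨ interpolatedSum hf r ⟩
      ∑ (λ i → form poles r (node i) * nodeValue i * ∏ (ratio 1# i) n) n
        ≈⟨ ∑-cong n (λ i _ → contribution-cleared i) ⟨
      ∑ (λ i → form poles r 1# * contribution i) n ≈⟨ *-distribˡ-∑ (form poles r 1#) contribution n ⟨
      form poles r 1# * ∑ contribution n          ≈⟨ *-comm _ _ ⟩
      ∑ contribution n * form poles r 1#          ∎)

    χ∈ : ∀ i → Loc ⟦ χ i ⟧ℤ
    χ∈ 0 = 1∈
    χ∈ 1 = 0∈
    χ∈ 2 = -∈ 1∈
    χ∈ (suc (suc (suc i))) = χ∈ i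

    -- The inverse stored in `unit-q^` is only known in K; uniqueness of inverses identifies it with
    -- a power of the local inverse of q.
    q⁻¹∈ : ∀ i → Loc (proj₁ (unit-q^ i))
    q⁻¹∈ i = resp (unit-cancel (unit-q^ i) (trans (*-comm _ _) (trans (proj₂ (inv i)) (trans (sym (proj₂ (unit-q^ i))) (*-comm _ _))))) (proj₁ (inv i))
      where
      v = proj₁ (proj₂ invertible-q)
      inv : ∀ i → Loc (v ^ i) × q ^ i * v ^ i ≈ 1#
      inv zero    = 1∈ , *-identityˡ 1#
      inv (suc i) = *∈ (proj₁ (proj₂ (proj₂ invertible-q))) (proj₁ (inv i)) ,
        proj₂ (unit-* (v , proj₂ (proj₂ (proj₂ invertible-q))) (v ^ i , proj₂ (inv i)))

    Order≥-nodeValue : ∀ i → Order≥ (δ (+ exponent i)) (nodeValue i)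
    Order≥-nodeValue i = ≡.subst (λ k → Order≥ k (nodeValue i)) (ℕ.+-identityʳ _)
      (Order≥-* (Order≥-* (Loc⇒≥ (χ∈ i)) (Order⇒≥ (order-1-q^ (2 ℕ.* i)))) (Loc⇒≥ (q⁻¹∈ i)))

    private
      2∣6* : ∀ k → 6 ℕ.* k ≡ 2 ℕ.* (3 ℕ.* k)
      2∣6* k = ℕ.*-assoc 2 3 k

    -- No bracket is zero: the exponents of the poles are even, those of the nodes odd, and the
    -- point 1 has exponent 0.
    Order-numerator : ∀ i → Order (orderC (exponent i) ℕ.+ orderOthers 0 i) (form poles r (node i) * others 1# i)
    Order-numerator i = Order-* (Order-C (exponent i) (λ k eq → ℕ.even≢odd (3 ℕ.* suc k) i (≡.trans (≡.sym (2∣6* (suc k))) eq)))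
      (Order-others 0 i (λ j _ ()))

    Order-denominator : ∀ i → Order (orderC 0 ℕ.+ orderOthers (exponent i) i) (form poles r 1# * others (node i) i)
    Order-denominator i = Order-* (Order-C 0 (λ k ()))
      (Order-others (exponent i) i (λ j i≢j eq → i≢j (ℕ.*-cancelˡ-≡ i j 2 (ℕ.suc-injective eq))))

    -- order of numerator − order of denominator = 3 − 3 δ
    module _ (i : ℕ) (i<n : i < n) where
      private
        D = δ (+ exponent i)
        E = multiples ℕ.+ multiples
        c  = orderC (exponent i)
        c₀ = orderC 0
        p  = orderOthers 0 i
        x  = orderOthers (exponent i) i

      orderC₀-eq : 2 ℕ.+ c₀ ≡ E
      orderC₀-eq = ≡.trans (≡.cong (λ z → (z ℕ.+ z) ℕ.+ c₀) (≡.sym δ-0)) (orderC-eq 0)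

      orderP-eq : (D ℕ.+ D) ℕ.+ p ≡ E
      orderP-eq = ≡.trans (≡.cong (λ z → (z ℕ.+ D) ℕ.+ p) (≡.sym (≡.trans (≡.cong δ (ℤ.+-identityˡ (ℤ.- + exponent i))) (δ-neg (+ exponent i))))) (orderOthers-eq 0 i i<n)

      -- The omitted bracket of the node with itself has the exponents 0 and 2m, and 2 is invertible
      -- modulo d.
      orderX-eq : (1 ℕ.+ D) ℕ.+ x ≡ E
      orderX-eq = ≡.trans (≡.cong₂ (λ z w → (z ℕ.+ w) ℕ.+ x)
          (≡.sym (≡.trans (≡.cong δ (ℤ.+-inverseʳ (+ exponent i))) δ-0))
          (≡.sym (≡.trans (≡.cong δ (lemma (+ exponent i))) (δ-* (+ 2) (+ h) d∣1+2h (+ exponent i)))))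
        (orderOthers-eq (exponent i) i i<n)
        where
        lemma : ∀ z → z ℤ.+ z ≡ + 2 ℤ.* z
        lemma = solve-∀

      -- For d ∤ m the two numerator products reach the full count `E`. In the denominator C(0)
      -- misses 2, from the exponents ±0 of k = 0, and the Lagrange product misses 1, from the
      -- exponent 0 of the omitted bracket, whose other exponent 2m is not a multiple of d.
      orders : D ≡ 0 → c ℕ.+ p ≡ c₀ ℕ.+ x ℕ.+ 3
      orders D≡0 = ≡.trans (≡.cong₂ ℕ._+_ (≡.trans c≡ (≡.sym orderC₀-eq)) (≡.trans p≡ (≡.sym x≡)))
        (lemma c₀ x)
        where
        c≡ : c ≡ E
        c≡ = ≡.trans (≡.cong (λ z → (z ℕ.+ z) ℕ.+ c) (≡.sym D≡0)) (orderC-eq (exponent i))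
        p≡ : p ≡ E
        p≡ = ≡.trans (≡.cong (λ z → (z ℕ.+ z) ℕ.+ p) (≡.sym D≡0)) orderP-eq
        x≡ : 1 ℕ.+ x ≡ E
        x≡ = ≡.trans (≡.cong (λ z → (1 ℕ.+ z) ℕ.+ x) (≡.sym D≡0)) orderX-eq
        lemma : ∀ a b → (2 ℕ.+ a) ℕ.+ (1 ℕ.+ b) ≡ a ℕ.+ b ℕ.+ 3
        lemma = solveℕ-∀

      module _ (D≡1 : D ≡ 1) where
        -- When d divides m, the exponents m and 0 are the same modulo d; every one of the products
        -- then misses 2, and the orders cancel.
        c≡c₀ : c ≡ c₀
        c≡c₀ = ℕ.+-cancelˡ-≡ 2 _ _ (≡.trans (≡.trans (≡.cong (λ z → (z ℕ.+ z) ℕ.+ c) (≡.sym D≡1)) (orderC-eq (exponent i))) (≡.sym orderC₀-eq))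
        p≡c₀ : p ≡ c₀
        p≡c₀ = ℕ.+-cancelˡ-≡ 2 _ _ (≡.trans (≡.trans (≡.cong (λ z → (z ℕ.+ z) ℕ.+ p) (≡.sym D≡1)) orderP-eq) (≡.sym orderC₀-eq))
        x≡c₀ : x ≡ c₀
        x≡c₀ = ℕ.+-cancelˡ-≡ 2 _ _ (≡.trans (≡.trans (≡.cong (λ z → (1 ℕ.+ z) ℕ.+ x) (≡.sym D≡1)) orderX-eq) (≡.sym orderC₀-eq))

      contribution-order₃ : D ≡ 0 → Order≥ 3 (contribution i)
      contribution-order₃ D≡0 = Order≥-quotient (contribution-eq i) (Order-denominator i)
        (Order≥-* (Order≥-nodeValue i) (Order⇒≥ (Order-numerator i))) (≡.trans (≡.cong (ℕ._+ (c ℕ.+ p)) D≡0) (orders D≡0))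

      contribution-order₁ : D ≡ 1 → Order≥ 1 (contribution i)
      contribution-order₁ D≡1 = Order≥-quotient (contribution-eq i) (Order-denominator i)
        (Order≥-* (Order≥-nodeValue i) (Order⇒≥ (Order-numerator i)))
        (≡.trans (≡.cong₂ ℕ._+_ D≡1 (≡.cong₂ ℕ._+_ (c≡c₀ D≡1) (≡.trans (p≡c₀ D≡1) (≡.sym (x≡c₀ D≡1))))) (ℕ.+-comm 1 _))

    δ-cases : ∀ z → δ z ≡ 0 ⊎ δ z ≡ 1
    δ-cases z with + d ∣? z
    ... | yes _ = inj₂ ≡.refl
    ... | no _  = inj₁ ≡.refl

    -- The two sides have order at least 1 separately: each contribution does, and `nodeValue h`
    -- contains 1 - qⁿ with d ∣ n.
    congruence₁ : ∀ {f} → Summand 1# f → cubicSum f n ≡ nodeValue h [ 1 ]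
    congruence₁ hf = Order≥-+ (Order≥-resp (sym (cubicSum-contributions hf)) (Order≥-∑ contribution n each))
      (Order≥-- (≡.subst (λ k → Order≥ k (nodeValue h)) (δ-yes d∣n) (Order≥-nodeValue h)))
      where
      each : ∀ i → i < n → Order≥ 1 (contribution i)
      each i i<n = [ (λ D≡0 → Order≥-weaken (s≤s z≤n) (contribution-order₃ i i<n D≡0)) , contribution-order₁ i i<n ]′ (δ-cases (+ exponent i))

    -- For d = n, the node qⁿ is the only one within order 1 of the evaluation point 1, and it agrees with it up to order 2.
    module _ (d≡n : d ≡ n) where
      private
        Q = node h

      D≡1 : δ (+ exponent h) ≡ 1
      D≡1 = δ-yes d∣n

      h<n : h < n
      h<n = s≤s (ℕ.m≤m+n h (h ℕ.+ 0))

      -- The exponents are positive and below 2n, so n itself, reached at i = h, is the only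
      -- multiple of n among them.
      D≡0 : ∀ i → i < n → h ≢ i → δ (+ exponent i) ≡ 0
      D≡0 i i<n h≢i = δ-no (λ d∣m → go (≡.subst (λ k → k ℕ.∣ exponent i) d≡n (∣⇒∣ᵤ d∣m)))
        where
        go : ¬ (n ℕ.∣ exponent i)
        go (ℕ.divides 0 ())
        go (ℕ.divides 1 eq) = h≢i (ℕ.*-cancelˡ-≡ h i 2 (ℕ.suc-injective (≡.sym (≡.trans eq (ℕ.*-identityˡ n)))))
        go (ℕ.divides (suc (suc k)) eq) = ℕ.<⇒≱ bound (ℕ.≤-trans (ℕ.m≤m+n (n ℕ.+ n) (k ℕ.* n)) (ℕ.≤-reflexive (≡.trans (ℕ.+-assoc n n (k ℕ.* n)) (≡.sym eq))))
          where
          bound : exponent i < n ℕ.+ n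
          bound = ℕ.≤-trans (ℕ.≤-reflexive (lemma i)) (ℕ.+-mono-≤ i<n i<n)
            where
            lemma : ∀ i → suc (suc (2 ℕ.* i)) ≡ suc i ℕ.+ suc i
            lemma = solveℕ-∀

      multiples≡1 : multiples ≡ 1
      multiples≡1 = ≡.trans (sumℕ-suc (λ i → δ (+ i)) r) (≡.cong₂ ℕ._+_ δ-0 (zeros-sum r ℕ.≤-refl))
        where
        zeros-sum : ∀ m → m ≤ r → sumℕ (λ i → δ (+ suc i)) m ≡ 0
        zeros-sum zero    _   = ≡.refl
        zeros-sum (suc m) m<r = ≡.cong₂ ℕ._+_ (zeros-sum m (ℕ.<⇒≤ m<r))
          (δ-no (λ d∣ → ℕ.<⇒≱ (s≤s m<r) (ℕ.∣⇒≤ (≡.subst (λ k → k ℕ.∣ suc m) d≡n (∣⇒∣ᵤ d∣)))))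

      orderC₀≡0 : orderC 0 ≡ 0
      orderC₀≡0 = ℕ.+-cancelˡ-≡ 2 _ _ (≡.trans (orderC₀-eq h h<n) (≡.cong (λ z → z ℕ.+ z) multiples≡1))

      Order-denominator₀ : Order 0 (form poles r 1# * others Q h)
      Order-denominator₀ = ≡.subst (λ k → Order k (form poles r 1# * others Q h))
        (≡.cong₂ ℕ._+_ orderC₀≡0 (≡.trans (x≡c₀ h h<n D≡1) orderC₀≡0)) (Order-denominator h)

      Order≥-[1-Q]² : ∀ {x} → Loc x → Order≥ 2 (x * ((1# - Q) * (1# - Q)))
      Order≥-[1-Q]² x∈ = Order≥-* (Loc⇒≥ x∈) (Order≥-* o o)
        where
        o : Order≥ 1 (1# - Q)
        o = ≡.subst (λ k → Order≥ k (1# - Q)) D≡1 (Order⇒≥ (order-1-q^ (2 ℕ.* h)))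

      bracket-near : ∀ {x} → Loc x → bracket x Q ≡ Q * bracket x 1# [ 2 ]
      bracket-near {x} x∈ = Order≥-resp (solve 2 (λ x y → let i = con (+ 1) in
          (:- x) :* ((i :- y) :* (i :- y)) := (y :- x) :* (i :- y :* x) :- y :* ((i :- x) :* (i :- i :* x))) refl x Q)
        (Order≥-[1-Q]² (-∈ x∈))

      bracket-near′ : ∀ {x} → Loc x → bracket Q x ≡ Q * bracket 1# x [ 2 ]
      bracket-near′ {x} x∈ = Order≥-resp (solve 2 (λ x y → let i = con (+ 1) in
          x :* ((i :- y) :* (i :- y)) := (x :- y) :* (i :- x :* y) :- y :* ((x :- i) :* (i :- x :* i))) refl x Q)
        (Order≥-[1-Q]² x∈)

      bracket∈ : ∀ {x y} → Loc x → Loc y → Loc (bracket x y)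
      bracket∈ x∈ y∈ = *∈ (+∈ y∈ (-∈ x∈)) (+∈ 1∈ (-∈ (*∈ y∈ x∈)))

      Q∈ : Loc Q
      Q∈ = q^∈ n

      poles∈ : ∀ k → Loc (poles k)
      poles∈ k = resp (sym (poles-pow k)) (q^∈ (6 ℕ.* suc k))

      node∈ : ∀ j → Loc (node j)
      node∈ j = q^∈ (exponent j)

      replace∈ : ∀ {a} f → Loc a → (∀ j → Loc (f j)) → ∀ j → Loc (replace h a f j)
      replace∈ f a∈ f∈ j with h ℕ.≟ j
      ... | yes _ = a∈
      ... | no _  = f∈ j

      Qʳ : Carrier
      Qʳ = ∏ (λ _ → Q) r

      C-near : form poles r Q ≡ Qʳ * form poles r 1# [ 2 ]
      C-near = cong-trans (cong-∏ _ (λ k → Q * bracket (poles k) 1#) r (λ k _ → bracket∈ (poles∈ k) Q∈)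
          (λ k _ → *∈ Q∈ (bracket∈ (poles∈ k) 1∈)) (λ k _ → bracket-near (poles∈ k)))
        (cong-refl (∏-* _ _ r))

      -- The factor at j = h is missing. With `Q` put there on the left and `Q` times 1 on the
      -- right, both sides are products of n factors that are congruent one by one.
      others-near : Q * others Q h ≡ (Qʳ * Q) * others 1# h [ 2 ]
      others-near = cong-trans (cong-refl (sym (∏-replace n Q _ h<n)))
        (cong-trans (cong-∏ _ (λ j → Q * replace h 1# (λ j → bracket 1# (node j)) j) n
            (λ j _ → replace∈ _ Q∈ (λ j → bracket∈ Q∈ (node∈ j)) j)
            (λ j _ → *∈ Q∈ (replace∈ _ 1∈ (λ j → bracket∈ 1∈ (node∈ j)) j)) pointwise)
          (cong-refl (∏-* _ _ n)))
        where
        pointwise : ∀ j → j < n → replace h Q (λ j → bracket Q (node j)) j ≡ Q * replace h 1# (λ j → bracket 1# (node j)) j [ 2 ]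
        pointwise j _ with h ℕ.≟ j
        ... | yes _ = cong-refl (sym (*-identityʳ Q))
        ... | no _  = bracket-near′ (node∈ j)

      others∈ : ∀ {p} → Loc p → Loc (others p h)
      others∈ p∈ = ∏∈ _ n (λ j _ → replace∈ _ 1∈ (λ j → bracket∈ p∈ (node∈ j)) j)

      C∈ : ∀ {p} → Loc p → Loc (form poles r p)
      C∈ p∈ = ∏∈ _ r (λ k _ → bracket∈ (poles∈ k) p∈)

      -- Both kinds of products consist of r brackets, so moving from `Q` to 1 produces the same
      -- power of `Q` on the two sides. The spare factor `Q` from `others-near` has order 0 and is
      -- divided out.
      fraction-near : form poles r Q * others 1# h ≡ form poles r 1# * others Q h [ 2 ]
      fraction-near = Order≥-quotient
        (solve 5 (λ q a b c d → (a :* b :- c :* d) :* q := (a :* (q :* b)) :- (c :* (q :* d))) refl Q (form poles r Q) (others 1# h) (form poles r 1#) (others Q h))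
        (Order-q^ n)
        (cong-trans (cong-* (C∈ Q∈) (*∈ Q∈ (others∈ 1∈)) C-near (cong-refl refl))
          (cong-trans (cong-refl (solve 4 (λ r q c o → (r :* c) :* (q :* o) := c :* ((r :* q) :* o)) refl Qʳ Q (form poles r 1#) (others 1# h)))
            (cong-* (C∈ 1∈) (*∈ Q∈ (others∈ Q∈)) (cong-refl refl) (cong-sym others-near))))
        ≡.refl

      -- `fraction-near` gives 2, and the factor 1 - qⁿ of the node value gives 1. The denominator
      -- has order 0 because 0 is the only multiple of n among 0, ..., n - 1.
      contribution-near : contribution h ≡ nodeValue h [ 3 ]
      contribution-near = Order≥-quotient
        (begin
          (contribution h - nodeValue h) * (form poles r 1# * others Q h)
            ≈⟨ solve 3 (λ x v w → (x :- v) :* w := x :* w :- v :* w) refl (contribution h) (nodeValue h) _ ⟩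
          contribution h * (form poles r 1# * others Q h) - nodeValue h * (form poles r 1# * others Q h)
            ≈⟨ +-congʳ (contribution-eq h) ⟩
          nodeValue h * (form poles r Q * others 1# h) - nodeValue h * (form poles r 1# * others Q h)
            ≈⟨ solve 3 (λ v x w → v :* x :- v :* w := v :* (x :- w)) refl (nodeValue h) _ _ ⟩
          nodeValue h * (form poles r Q * others 1# h - form poles r 1# * others Q h) ∎)
        Order-denominator₀
        (Order≥-* (≡.subst (λ k → Order≥ k (nodeValue h)) D≡1 (Order≥-nodeValue h)) fraction-near)
        ≡.refl

      congruence₃ : ∀ {f} → Summand 1# f → cubicSum f n ≡ nodeValue h [ 3 ]
      congruence₃ {f} hf = Order≥-resp
        (trans (solve 3 (λ x v s → (x :- v) :+ s := (x :+ s) :- v) refl (contribution h) (nodeValue h) _)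
          (+-congʳ (trans (sym (∑-replace n contribution h<n)) (sym (cubicSum-contributions hf)))))
        (Order≥-+ contribution-near (Order≥-∑ (replace h 0# contribution) n (λ i i<n →
          Order≥-replace contribution (λ h≢i → contribution-order₃ i i<n (D≡0 i i<n h≢i)))))
        where
        Order≥-replace : ∀ {j k} f → (h ≢ j → Order≥ k (f j)) → Order≥ k (replace h 0# f j)
        Order≥-replace {j} f o with h ℕ.≟ j
        ... | yes _  = Order≥-0
        ... | no h≢j = o h≢j

-- Total ring of fractions and localisation at φ

module Localisation (R : CommutativeRing 0ℓ 0ℓ) where
  open CommutativeRing R
  open IntegerCoefficients R
  open Relation.Binary.Reasoning.Setoid setoid
  private module E = Algebra.Properties.Semiring.Exp semiring
  open E using (_^_)

  Regular : Carrier → Set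
  Regular x = ∀ y → y * x ≈ 0# → y ≈ 0#

  regular-1 : Regular 1#
  regular-1 y y1≈0 = trans (sym (*-identityʳ y)) y1≈0

  regular-* : ∀ {x y} → Regular x → Regular y → Regular (x * y)
  regular-* {x} {y} rx ry z zxy≈0 = rx z (ry (z * x) (trans (*-assoc z x y) zxy≈0))

  regular-resp : ∀ {x y} → x ≈ y → Regular x → Regular y
  regular-resp x≈y rx z zy≈0 = rx z (trans (*-congˡ x≈y) zy≈0)

  regular-cancel : ∀ {x y z} → Regular x → y * x ≈ z * x → y ≈ z
  regular-cancel {x} {y} {z} rx yx≈zx = begin
    y             ≈⟨ solve 2 (λ y z → y := (y :- z) :+ z) refl y z ⟩
    (y - z) + z   ≈⟨ +-congʳ (rx (y - z) (begin
      (y - z) * x     ≈⟨ solve 3 (λ x y z → (y :- z) :* x := y :* x :- z :* x) refl x y z ⟩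
      y * x - z * x   ≈⟨ +-congʳ yx≈zx ⟩
      z * x - z * x   ≈⟨ -‿inverseʳ _ ⟩
      0#              ∎)) ⟩
    0# + z        ≈⟨ +-identityˡ z ⟩
    z             ∎

  record Fraction : Set where
    constructor fraction
    field
      top bot : Carrier
      regular : Regular bot
  open Fraction public

  infix 4 _≃_
  record _≃_ (x y : Fraction) : Set where
    constructor cross
    field equal : top x * bot y ≈ top y * bot x
  open _≃_ public

  ι : Carrier → Fraction
  ι x = fraction x 1# regular-1

  infixl 6 _⊕_
  infixl 7 _⊗_

  abstract
    _⊕_ _⊗_ : Fraction → Fraction → Fraction
    x ⊕ y = fraction (top x * bot y + top y * bot x) (bot x * bot y) (regular-* (regular x) (regular y))
    x ⊗ y = fraction (top x * top y) (bot x * bot y) (regular-* (regular x) (regular y))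

    ⊝_ : Fraction → Fraction
    ⊝ x = fraction (- top x) (bot x) (regular x)

    ≃-sym : ∀ {x y} → x ≃ y → y ≃ x
    ≃-sym (cross p) = cross (sym p)

    ≃-trans : ∀ {x y z} → x ≃ y → y ≃ z → x ≃ z
    ≃-trans {x} {y} {z} (cross p) (cross q) = cross (regular-cancel (regular y) (begin
      top x * bot z * bot y   ≈⟨ solve 3 (λ a b c → a :* b :* c := a :* c :* b) refl _ _ _ ⟩
      top x * bot y * bot z   ≈⟨ *-congʳ p ⟩
      top y * bot x * bot z   ≈⟨ solve 3 (λ a b c → a :* b :* c := a :* c :* b) refl _ _ _ ⟩
      top y * bot z * bot x   ≈⟨ *-congʳ q ⟩
      top z * bot y * bot x   ≈⟨ solve 3 (λ a b c → a :* b :* c := a :* c :* b) refl _ _ _ ⟩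
      top z * bot x * bot y   ∎))

    ⊕-cong : ∀ {x x′ y y′} → x ≃ x′ → y ≃ y′ → x ⊕ y ≃ x′ ⊕ y′
    ⊕-cong {x} {x′} {y} {y′} (cross p) (cross q) = cross (begin
      (top x * bot y + top y * bot x) * (bot x′ * bot y′)
        ≈⟨ solve 6 (λ a b c d e f → (a :* d :+ c :* b) :* (e :* f) := (a :* e) :* (d :* f) :+ (c :* f) :* (b :* e)) refl
             (top x) (bot x) (top y) (bot y) (bot x′) (bot y′) ⟩
      (top x * bot x′) * (bot y * bot y′) + (top y * bot y′) * (bot x * bot x′)
        ≈⟨ +-cong (*-congʳ p) (*-congʳ q) ⟩
      (top x′ * bot x) * (bot y * bot y′) + (top y′ * bot y) * (bot x * bot x′)
        ≈⟨ solve 6 (λ a b c d e f → (a :* e) :* (f :* d) :+ (c :* f) :* (e :* b) := (a :* d :+ c :* b) :* (e :* f)) refl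
             (top x′) (bot x′) (top y′) (bot y′) (bot x) (bot y) ⟩
      (top x′ * bot y′ + top y′ * bot x′) * (bot x * bot y) ∎)

    ⊗-cong : ∀ {x x′ y y′} → x ≃ x′ → y ≃ y′ → x ⊗ y ≃ x′ ⊗ y′
    ⊗-cong {x} {x′} {y} {y′} (cross p) (cross q) = cross (begin
      (top x * top y) * (bot x′ * bot y′) ≈⟨ interchange _ _ _ _ ⟩
      (top x * bot x′) * (top y * bot y′) ≈⟨ *-cong p q ⟩
      (top x′ * bot x) * (top y′ * bot y) ≈⟨ interchange _ _ _ _ ⟩
      (top x′ * top y′) * (bot x * bot y) ∎)
      where
      interchange : ∀ a b c d → (a * b) * (c * d) ≈ (a * c) * (b * d)
      interchange = solve 4 (λ a b c d → (a :* b) :* (c :* d) := (a :* c) :* (b :* d)) refl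

    ⊝-cong : ∀ {x y} → x ≃ y → ⊝ x ≃ ⊝ y
    ⊝-cong (cross p) = cross (trans (solve 2 (λ a b → (:- a) :* b := :- (a :* b)) refl _ _)
      (trans (-‿cong p) (solve 2 (λ a b → :- (a :* b) := (:- a) :* b) refl _ _)))

    ⊕-comm : ∀ x y → x ⊕ y ≃ y ⊕ x
    ⊕-comm x y = cross (solve 4 (λ a b c d → (a :* d :+ c :* b) :* (d :* b) := (c :* b :+ a :* d) :* (b :* d)) refl (top x) (bot x) (top y) (bot y))

    ⊗-comm : ∀ x y → x ⊗ y ≃ y ⊗ x
    ⊗-comm x y = cross (solve 4 (λ a b c d → (a :* c) :* (d :* b) := (c :* a) :* (b :* d)) refl (top x) (bot x) (top y) (bot y))

    ⊕-identityˡ : ∀ x → ι 0# ⊕ x ≃ x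
    ⊕-identityˡ x = cross (solve 2 (λ a b → (con (+ 0) :* b :+ a :* con (+ 1)) :* b := a :* (con (+ 1) :* b)) refl (top x) (bot x))

    ⊗-identityˡ : ∀ x → ι 1# ⊗ x ≃ x
    ⊗-identityˡ x = cross (solve 2 (λ a b → (con (+ 1) :* a) :* b := a :* (con (+ 1) :* b)) refl (top x) (bot x))

    ⊝-inverseˡ : ∀ x → ⊝ x ⊕ x ≃ ι 0#
    ⊝-inverseˡ x = cross (solve 2 (λ a b → ((:- a) :* b :+ a :* b) :* con (+ 1) := con (+ 0) :* (b :* b)) refl (top x) (bot x))

    ⊗-distribˡ : ∀ x y z → x ⊗ (y ⊕ z) ≃ x ⊗ y ⊕ x ⊗ z
    ⊗-distribˡ x y z = cross (solve 6 (λ a b c d e f → (a :* (c :* f :+ e :* d)) :* ((b :* d) :* (b :* f))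
      := ((a :* c) :* (b :* f) :+ (a :* e) :* (b :* d)) :* (b :* (d :* f))) refl (top x) (bot x) (top y) (bot y) (top z) (bot z))

    ⊕-assoc : ∀ x y z → (x ⊕ y) ⊕ z ≃ x ⊕ (y ⊕ z)
    ⊕-assoc x y z = cross (solve 6 (λ a b c d e f → ((a :* d :+ c :* b) :* f :+ e :* (b :* d)) :* (b :* (d :* f))
      := (a :* (d :* f) :+ (c :* f :+ e :* d) :* b) :* ((b :* d) :* f)) refl (top x) (bot x) (top y) (bot y) (top z) (bot z))

    ⊗-assoc : ∀ x y z → (x ⊗ y) ⊗ z ≃ x ⊗ (y ⊗ z)
    ⊗-assoc x y z = cross (solve 6 (λ a b c d e f → ((a :* c) :* e) :* (b :* (d :* f)) := (a :* (c :* e)) :* ((b :* d) :* f)) refl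
      (top x) (bot x) (top y) (bot y) (top z) (bot z))

    ι-+ : ∀ x y → ι (x + y) ≃ ι x ⊕ ι y
    ι-+ x y = cross (solve 2 (λ x y → (x :+ y) :* (con (+ 1) :* con (+ 1)) := (x :* con (+ 1) :+ y :* con (+ 1)) :* con (+ 1)) refl x y)

    ι-* : ∀ x y → ι (x * y) ≃ ι x ⊗ ι y
    ι-* x y = cross (solve 2 (λ x y → (x :* y) :* (con (+ 1) :* con (+ 1)) := (x :* y) :* con (+ 1)) refl x y)

    ι-- : ∀ x → ι (- x) ≃ ⊝ ι x
    ι-- x = cross refl

    bot*fraction : ∀ z → z ⊗ ι (bot z) ≃ ι (top z)
    bot*fraction z = cross (solve 2 (λ a b → (a :* b) :* con (+ 1) := a :* (b :* con (+ 1))) refl (top z) (bot z))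

    ⊗-inverse : ∀ {x} (rx : Regular x) → ι x ⊗ fraction 1# x rx ≃ ι 1#
    ⊗-inverse {x} rx = cross (solve 1 (λ x → (x :* con (+ 1)) :* con (+ 1) := con (+ 1) :* (con (+ 1) :* x)) refl x)

  fractions : CommutativeRing 0ℓ 0ℓ
  fractions = record
    { Carrier = Fraction ; _≈_ = _≃_ ; _+_ = _⊕_ ; _*_ = _⊗_ ; -_ = ⊝_ ; 0# = ι 0# ; 1# = ι 1#
    ; isCommutativeRing = record
      { isRing = record
        { +-isAbelianGroup = record
          { isGroup = record
            { isMonoid = record
              { isSemigroup = record
                { isMagma = record
                  { isEquivalence = record { refl = cross refl ; sym = ≃-sym ; trans = ≃-trans }
                  ; ∙-cong = ⊕-cong }
                ; assoc = ⊕-assoc }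
              ; identity = ⊕-identityˡ , λ x → ≃-trans (⊕-comm x (ι 0#)) (⊕-identityˡ x) }
            ; inverse = ⊝-inverseˡ , λ x → ≃-trans (⊕-comm x (⊝ x)) (⊝-inverseˡ x)
            ; ⁻¹-cong = ⊝-cong }
          ; comm = ⊕-comm }
        ; *-cong = ⊗-cong
        ; *-assoc = ⊗-assoc
        ; *-identity = ⊗-identityˡ , λ x → ≃-trans (⊗-comm x (ι 1#)) (⊗-identityˡ x)
        ; distrib = ⊗-distribˡ , λ x y z → ≃-trans (⊗-comm (y ⊕ z) x) (≃-trans (⊗-distribˡ x y z) (⊕-cong (⊗-comm x y) (⊗-comm x z))) }
      ; *-comm = ⊗-comm } }

  private
    module K = CommutativeRing fractions
    module EK = Algebra.Properties.Semiring.Exp K.semiring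

  ι-cong : ∀ {x y} → x ≈ y → ι x ≃ ι y
  ι-cong x≈y = cross (*-congʳ x≈y)

  ι-injective : ∀ {x y} → ι x ≃ ι y → x ≈ y
  ι-injective (cross p) = trans (sym (*-identityʳ _)) (trans p (*-identityʳ _))

  ι-^ : ∀ x k → ι (x ^ k) ≃ ι x EK.^ k
  ι-^ x zero    = K.refl
  ι-^ x (suc k) = K.trans (ι-* x (x ^ k)) (K.*-congˡ (ι-^ x k))

  ι-1-^ : ∀ x k → ι (1# - x ^ k) ≃ K.1# K.- ι x EK.^ k
  ι-1-^ x k = K.trans (ι-+ 1# (- (x ^ k))) (K.+-congˡ (K.trans (ι-- (x ^ k)) (K.-‿cong (ι-^ x k))))

  unit-ι : ∀ {x} → Regular x → Ranges.Unit fractions (ι x)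
  unit-ι rx = _ , ⊗-inverse rx

  infix 4 _∣_
  _∣_ : Carrier → Carrier → Set
  x ∣ y = ∃ λ z → y ≈ z * x

  -- s is not a zero divisor modulo φ; for prime φ: φ does not divide s.
  Coprime : Carrier → Carrier → Set
  Coprime φ s = ∀ f → φ ∣ f * s → φ ∣ f

  coprime-* : ∀ {φ s t} → Coprime φ s → Coprime φ t → Coprime φ (s * t)
  coprime-* {s = s} {t} cs ct f (c , eq) = cs f (ct (f * s) (c , trans (*-assoc f s t) eq))

  coprime-1 : ∀ {φ} → Coprime φ 1#
  coprime-1 f (c , eq) = c , trans (sym (*-identityʳ f)) eq

  coprime-divisor : ∀ {φ s t} → s ∣ t → Coprime φ t → Coprime φ s
  coprime-divisor {φ} {s} {t} (u , t≈us) ct f (c , fs≈cφ) = ct f (u * c , (begin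
    f * t         ≈⟨ *-congˡ t≈us ⟩
    f * (u * s)   ≈⟨ solve 3 (λ f u s → f :* (u :* s) := u :* (f :* s)) refl f u s ⟩
    u * (f * s)   ≈⟨ *-congˡ fs≈cφ ⟩
    u * (c * φ)   ≈⟨ *-assoc u c φ ⟨
    u * c * φ     ∎))

  -- Factors φ are split off one at a time: coprimality moves one into f, and regularity of φ
  -- cancels it from the equation.
  coprime-∣^ : ∀ {φ s} → Regular φ → Coprime φ s → ∀ k f → φ ^ k ∣ f * s → φ ^ k ∣ f
  coprime-∣^ rφ cs zero    f _         = f , sym (*-identityʳ f)
  coprime-∣^ {φ} {s} rφ cs (suc k) f (c , eq) with cs f (c * φ ^ k , trans eq (solve 3 (λ c x y → c :* (x :* y) := (c :* y) :* x) refl c φ (φ ^ k)))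
  ... | c′ , f≈ with coprime-∣^ rφ cs k c′ (c , regular-cancel rφ (begin
        c′ * s * φ          ≈⟨ solve 3 (λ c x y → c :* x :* y := (c :* y) :* x) refl c′ s φ ⟩
        c′ * φ * s          ≈⟨ *-congʳ f≈ ⟨
        f * s               ≈⟨ eq ⟩
        c * (φ * φ ^ k)     ≈⟨ solve 3 (λ c x y → c :* (x :* y) := (c :* y) :* x) refl c φ (φ ^ k) ⟩
        c * φ ^ k * φ       ∎))
  ...   | c″ , c′≈ = c″ , trans f≈ (trans (*-congʳ c′≈) (solve 3 (λ c x y → (c :* y) :* x := c :* (x :* y)) refl c″ φ (φ ^ k)))

module LocalRing (R : CommutativeRing 0ℓ 0ℓ) (φ : CommutativeRing.Carrier R) (regular-φ : Localisation.Regular R φ) where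
  open CommutativeRing R
  open Localisation R
  open Algebra.Properties.Semiring.Exp semiring using (_^_)

  module K = CommutativeRing fractions
  private
    module EK = Algebra.Properties.Semiring.Exp K.semiring
    module KS = IntegerCoefficients fractions
  open Relation.Binary.Reasoning.Setoid K.setoid

  -- The denominator s is produced afresh instead of being read off from `bot z`, so the notion does
  -- not depend on how the fraction is written.
  Local : Fraction → Set
  Local z = ∃ λ s → ∃ λ x → Coprime φ s × Regular s × z K.* ι s ≃ ι x

  local : IsSubring fractions Local
  local = record
    { resp = λ { z≈w (s , x , cs , rs , eq) → s , x , cs , rs , K.trans (K.*-congʳ (K.sym z≈w)) eq }
    ; 0∈ = ι∈ 0#
    ; 1∈ = ι∈ 1#
    ; +∈ = λ { {z} {w} (s , x , cs , rs , eq) (t , y , ct , rt , eq′) →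
        s * t , x * t + y * s , coprime-* cs ct , regular-* rs rt , (begin
          (z K.+ w) K.* ι (s * t)           ≈⟨ K.*-congˡ (ι-* s t) ⟩
          (z K.+ w) K.* (ι s K.* ι t)       ≈⟨ KS.solve 4 (λ z w s t → (z KS.:+ w) KS.:* (s KS.:* t) KS.:= (z KS.:* s) KS.:* t KS.:+ (w KS.:* t) KS.:* s) K.refl z w (ι s) (ι t) ⟩
          (z K.* ι s) K.* ι t K.+ (w K.* ι t) K.* ι s ≈⟨ K.+-cong (K.*-congʳ eq) (K.*-congʳ eq′) ⟩
          ι x K.* ι t K.+ ι y K.* ι s       ≈⟨ K.+-cong (ι-* x t) (ι-* y s) ⟨
          ι (x * t) K.+ ι (y * s)           ≈⟨ ι-+ _ _ ⟨
          ι (x * t + y * s)                 ∎) }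
    ; *∈ = λ { {z} {w} (s , x , cs , rs , eq) (t , y , ct , rt , eq′) →
        s * t , x * y , coprime-* cs ct , regular-* rs rt , (begin
          (z K.* w) K.* ι (s * t)           ≈⟨ K.*-congˡ (ι-* s t) ⟩
          (z K.* w) K.* (ι s K.* ι t)       ≈⟨ KS.solve 4 (λ z w s t → (z KS.:* w) KS.:* (s KS.:* t) KS.:= (z KS.:* s) KS.:* (w KS.:* t)) K.refl z w (ι s) (ι t) ⟩
          (z K.* ι s) K.* (w K.* ι t)       ≈⟨ K.*-cong eq eq′ ⟩
          ι x K.* ι y                       ≈⟨ ι-* x y ⟨
          ι (x * y)                         ∎) }
    ; -∈ = λ { {z} (s , x , cs , rs , eq) → s , - x , cs , rs ,
        K.trans (KS.solve 2 (λ z s → (KS.:- z) KS.:* s KS.:= KS.:- (z KS.:* s)) K.refl z (ι s)) (K.trans (K.-‿cong eq) (K.sym (ι-- x))) }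
    }
    where
    ι∈ : ∀ x → Local (ι x)
    ι∈ x = 1# , x , coprime-1 , regular-1 , K.*-identityʳ (ι x)

  ι∈ : ∀ x → Local (ι x)
  ι∈ x = 1# , x , coprime-1 , regular-1 , K.*-identityʳ (ι x)

  open Valuation fractions Local local (ι φ) (ι∈ φ) (unit-ι regular-φ) using (Order≥; order≥; Invertible)

  invertible-ι : ∀ {s} → Regular s → Coprime φ s → Invertible (ι s)
  invertible-ι {s} rs cs = ι∈ s , proj₁ (unit-ι rs) , (s , 1# , cs , rs , K.trans (K.*-comm _ _) (proj₂ (unit-ι rs))) , proj₂ (unit-ι rs)

  Order≥⇒∣ : ∀ k z → Order≥ k z → φ ^ k ∣ top z
  Order≥⇒∣ k z (order≥ w (s , x , cs , rs , ws≈x) z≈) = coprime-∣^ regular-φ cs k (top z) (x * bot z , ι-injective (begin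
    ι (top z * s)                                 ≈⟨ ι-* _ _ ⟩
    ι (top z) K.* ι s                             ≈⟨ K.*-congʳ (bot*fraction z) ⟨
    (z K.* ι (bot z)) K.* ι s                     ≈⟨ K.*-congʳ (K.*-congʳ z≈) ⟩
    ((ι φ EK.^ k K.* w) K.* ι (bot z)) K.* ι s    ≈⟨ KS.solve 4 (λ p w b s → ((p KS.:* w) KS.:* b) KS.:* s KS.:= ((w KS.:* s) KS.:* b) KS.:* p) K.refl _ w _ (ι s) ⟩
    ((w K.* ι s) K.* ι (bot z)) K.* ι φ EK.^ k    ≈⟨ K.*-cong (K.*-congʳ ws≈x) (K.sym (ι-^ φ k)) ⟩
    (ι x K.* ι (bot z)) K.* ι (φ ^ k)             ≈⟨ K.*-congʳ (ι-* _ _) ⟨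
    ι (x * bot z) K.* ι (φ ^ k)                   ≈⟨ ι-* _ _ ⟨
    ι ((x * bot z) * φ ^ k)                       ∎))

-- The ring ℤ[q] of coefficient lists

module PolynomialRing where
  open import Defs
  open import Data.List using ([]; _∷_; map)
  open ≡ hiding ([_])

  infix 4 _≋_
  -- A record around `_≈ₚ_`, so that p and r can be inferred from the type of a proof; the bare
  -- function type mentions only their coefficients.
  record _≋_ (p r : Poly) : Set where
    constructor pointwise
    field at : p ≈ₚ r
  open _≋_ public

  ≋-refl : ∀ {p} → p ≋ p
  ≋-refl = pointwise λ _ → refl

  ≋-sym : ∀ {p r} → p ≋ r → r ≋ p
  ≋-sym (pointwise e) = pointwise λ i → sym (e i)

  ≋-trans : ∀ {p r s} → p ≋ r → r ≋ s → p ≋ s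
  ≋-trans (pointwise e) (pointwise f) = pointwise λ i → trans (e i) (f i)

  scale : ℤ → Poly → Poly
  scale a = map (a ℤ.*_)

  shift : Poly → Poly
  shift p = 0ℤ ∷ p

  coeff-+ : ∀ p r i → coeff (p +ₚ r) i ≡ coeff p i ℤ.+ coeff r i
  coeff-+ []      r       i       = sym (ℤ.+-identityˡ _)
  coeff-+ (a ∷ p) []      i       = sym (ℤ.+-identityʳ _)
  coeff-+ (a ∷ p) (b ∷ r) zero    = refl
  coeff-+ (a ∷ p) (b ∷ r) (suc i) = coeff-+ p r i

  coeff-scale : ∀ a p i → coeff (scale a p) i ≡ a ℤ.* coeff p i
  coeff-scale a []      i       = sym (ℤ.*-zeroʳ a)
  coeff-scale a (b ∷ p) zero    = refl
  coeff-scale a (b ∷ p) (suc i) = coeff-scale a p i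

  coeff-neg : ∀ p i → coeff (-ₚ p) i ≡ ℤ.- coeff p i
  coeff-neg []      i       = refl
  coeff-neg (a ∷ p) zero    = refl
  coeff-neg (a ∷ p) (suc i) = coeff-neg p i

  coeff-*-zero : ∀ p r → coeff (p *ₚ r) 0 ≡ coeff p 0 ℤ.* coeff r 0
  coeff-*-zero []      r = refl
  coeff-*-zero (a ∷ p) r = trans (coeff-+ (scale a r) _ 0) (trans (ℤ.+-identityʳ _) (coeff-scale a r 0))

  coeff-*-suc : ∀ a p r i → coeff ((a ∷ p) *ₚ r) (suc i) ≡ a ℤ.* coeff r (suc i) ℤ.+ coeff (p *ₚ r) i
  coeff-*-suc a p r i = trans (coeff-+ (scale a r) _ (suc i)) (cong (λ z → z ℤ.+ coeff (p *ₚ r) i) (coeff-scale a r (suc i)))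

  +-cong : ∀ {p p′ r r′} → p ≋ p′ → r ≋ r′ → p +ₚ r ≋ p′ +ₚ r′
  +-cong {p} {p′} {r} {r′} (pointwise e) (pointwise f) = pointwise λ i → trans (coeff-+ p r i) (trans (cong₂ ℤ._+_ (e i) (f i)) (sym (coeff-+ p′ r′ i)))

  neg-cong : ∀ {p r} → p ≋ r → -ₚ p ≋ -ₚ r
  neg-cong {p} {r} (pointwise e) = pointwise λ i → trans (coeff-neg p i) (trans (cong ℤ.-_ (e i)) (sym (coeff-neg r i)))

  scale-cong : ∀ a {p r} → p ≋ r → scale a p ≋ scale a r
  scale-cong a {p} {r} (pointwise e) = pointwise λ i → trans (coeff-scale a p i) (trans (cong (a ℤ.*_) (e i)) (sym (coeff-scale a r i)))

  shift-cong : ∀ {p r} → p ≋ r → shift p ≋ shift r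
  shift-cong (pointwise e) = pointwise λ { zero → refl ; (suc i) → e i }

  +-comm : ∀ p r → p +ₚ r ≋ r +ₚ p
  +-comm p r = pointwise λ i → trans (coeff-+ p r i) (trans (ℤ.+-comm (coeff p i) (coeff r i)) (sym (coeff-+ r p i)))

  +-assoc : ∀ p r s → (p +ₚ r) +ₚ s ≋ p +ₚ (r +ₚ s)
  +-assoc p r s = pointwise λ i → begin
    coeff ((p +ₚ r) +ₚ s) i                       ≡⟨ trans (coeff-+ (p +ₚ r) s i) (cong (λ z → z ℤ.+ coeff s i) (coeff-+ p r i)) ⟩
    coeff p i ℤ.+ coeff r i ℤ.+ coeff s i         ≡⟨ ℤ.+-assoc (coeff p i) _ _ ⟩
    coeff p i ℤ.+ (coeff r i ℤ.+ coeff s i)       ≡⟨ trans (coeff-+ p (r +ₚ s) i) (cong (λ z → coeff p i ℤ.+ z) (coeff-+ r s i)) ⟨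
    coeff (p +ₚ (r +ₚ s)) i                       ∎
    where open ≡-Reasoning

  +-identityʳ : ∀ p → p +ₚ [] ≋ p
  +-identityʳ p = pointwise λ i → trans (coeff-+ p [] i) (ℤ.+-identityʳ _)

  neg-inverseʳ : ∀ p → p +ₚ (-ₚ p) ≋ []
  neg-inverseʳ p = pointwise λ i → trans (coeff-+ p (-ₚ p) i) (trans (cong (λ z → coeff p i ℤ.+ z) (coeff-neg p i)) (ℤ.+-inverseʳ (coeff p i)))

  *-congˡ : ∀ p {r s} → r ≋ s → p *ₚ r ≋ p *ₚ s
  *-congˡ []      e = ≋-refl
  *-congˡ (a ∷ p) e = +-cong (scale-cong a e) (shift-cong (*-congˡ p e))

  *-[] : ∀ p → p *ₚ [] ≋ []
  *-[] []      = ≋-refl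
  *-[] (a ∷ p) = pointwise λ { zero → refl ; (suc i) → at (*-[] p) i }

  *-cons : ∀ p b r → p *ₚ (b ∷ r) ≋ scale b p +ₚ shift (p *ₚ r)
  *-cons []      b r = pointwise λ { zero → refl ; (suc i) → refl }
  *-cons (a ∷ p) b r = pointwise λ
    { zero    → cong (λ z → z ℤ.+ 0ℤ) (ℤ.*-comm a b)
    ; (suc i) → begin
        coeff (scale a r +ₚ p *ₚ (b ∷ r)) i
          ≡⟨ coeff-+ (scale a r) _ i ⟩
        coeff (scale a r) i ℤ.+ coeff (p *ₚ (b ∷ r)) i
          ≡⟨ cong (λ z → coeff (scale a r) i ℤ.+ z) (trans (at (*-cons p b r) i) (coeff-+ (scale b p) _ i)) ⟩
        coeff (scale a r) i ℤ.+ (coeff (scale b p) i ℤ.+ coeff (shift (p *ₚ r)) i)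
          ≡⟨ lemma (coeff (scale a r) i) (coeff (scale b p) i) _ ⟩
        coeff (scale b p) i ℤ.+ (coeff (scale a r) i ℤ.+ coeff (shift (p *ₚ r)) i)
          ≡⟨ trans (coeff-+ (scale b p) _ i) (cong (λ z → coeff (scale b p) i ℤ.+ z) (coeff-+ (scale a r) _ i)) ⟨
        coeff (scale b p +ₚ (scale a r +ₚ shift (p *ₚ r))) i ∎ }
    where
    open ≡-Reasoning
    lemma : ∀ x y z → x ℤ.+ (y ℤ.+ z) ≡ y ℤ.+ (x ℤ.+ z)
    lemma = solve-∀

  *-comm : ∀ p r → p *ₚ r ≋ r *ₚ p
  *-comm []      r = ≋-sym (*-[] r)
  *-comm (a ∷ p) r = ≋-trans (+-cong ≋-refl (shift-cong (*-comm p r))) (≋-sym (*-cons r a p))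

  *-congʳ : ∀ {p r} s → p ≋ r → p *ₚ s ≋ r *ₚ s
  *-congʳ {p} {r} s e = ≋-trans (*-comm p s) (≋-trans (*-congˡ s e) (*-comm s r))

  *-distribˡ : ∀ p r s → p *ₚ (r +ₚ s) ≋ p *ₚ r +ₚ p *ₚ s
  *-distribˡ []      r s = ≋-refl
  *-distribˡ (a ∷ p) r s = pointwise λ i → begin
    coeff (scale a (r +ₚ s) +ₚ shift (p *ₚ (r +ₚ s))) i
      ≡⟨ coeff-+ (scale a (r +ₚ s)) _ i ⟩
    coeff (scale a (r +ₚ s)) i ℤ.+ coeff (shift (p *ₚ (r +ₚ s))) i
      ≡⟨ cong₂ ℤ._+_ (trans (coeff-scale a (r +ₚ s) i) (trans (cong (a ℤ.*_) (coeff-+ r s i)) (ℤ.*-distribˡ-+ a _ _))) (tail i) ⟩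
    (a ℤ.* coeff r i ℤ.+ a ℤ.* coeff s i) ℤ.+ (coeff (shift (p *ₚ r)) i ℤ.+ coeff (shift (p *ₚ s)) i)
      ≡⟨ lemma (a ℤ.* coeff r i) _ _ _ ⟩
    (a ℤ.* coeff r i ℤ.+ coeff (shift (p *ₚ r)) i) ℤ.+ (a ℤ.* coeff s i ℤ.+ coeff (shift (p *ₚ s)) i)
      ≡⟨ cong₂ ℤ._+_ (part r i) (part s i) ⟨
    coeff ((a ∷ p) *ₚ r) i ℤ.+ coeff ((a ∷ p) *ₚ s) i
      ≡⟨ coeff-+ ((a ∷ p) *ₚ r) _ i ⟨
    coeff ((a ∷ p) *ₚ r +ₚ (a ∷ p) *ₚ s) i ∎
    where
    open ≡-Reasoning
    lemma : ∀ x y z w → (x ℤ.+ y) ℤ.+ (z ℤ.+ w) ≡ (x ℤ.+ z) ℤ.+ (y ℤ.+ w)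
    lemma = solve-∀
    tail : ∀ i → coeff (shift (p *ₚ (r +ₚ s))) i ≡ coeff (shift (p *ₚ r)) i ℤ.+ coeff (shift (p *ₚ s)) i
    tail zero    = refl
    tail (suc i) = trans (at (*-distribˡ p r s) i) (coeff-+ (p *ₚ r) _ i)
    part : ∀ r i → coeff ((a ∷ p) *ₚ r) i ≡ a ℤ.* coeff r i ℤ.+ coeff (shift (p *ₚ r)) i
    part r i = trans (coeff-+ (scale a r) _ i) (cong (λ z → z ℤ.+ coeff (shift (p *ₚ r)) i) (coeff-scale a r i))

  *-distribʳ : ∀ p r s → (r +ₚ s) *ₚ p ≋ r *ₚ p +ₚ s *ₚ p
  *-distribʳ p r s = ≋-trans (*-comm (r +ₚ s) p) (≋-trans (*-distribˡ p r s) (+-cong (*-comm p r) (*-comm p s)))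

  scale-* : ∀ a r s → scale a r *ₚ s ≋ scale a (r *ₚ s)
  scale-* a []      s = ≋-refl
  scale-* a (b ∷ r) s = pointwise λ
    { zero    → trans (coeff-*-zero (scale a (b ∷ r)) s) (trans (ℤ.*-assoc a b _) (trans (cong (a ℤ.*_) (sym (coeff-*-zero (b ∷ r) s))) (sym (coeff-scale a ((b ∷ r) *ₚ s) 0))))
    ; (suc i) → begin
        coeff (scale a (b ∷ r) *ₚ s) (suc i)
          ≡⟨ coeff-*-suc (a ℤ.* b) (scale a r) s i ⟩
        a ℤ.* b ℤ.* coeff s (suc i) ℤ.+ coeff (scale a r *ₚ s) i
          ≡⟨ cong (λ z → a ℤ.* b ℤ.* coeff s (suc i) ℤ.+ z) (trans (at (scale-* a r s) i) (coeff-scale a (r *ₚ s) i)) ⟩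
        a ℤ.* b ℤ.* coeff s (suc i) ℤ.+ a ℤ.* coeff (r *ₚ s) i
          ≡⟨ lemma a b _ _ ⟩
        a ℤ.* (b ℤ.* coeff s (suc i) ℤ.+ coeff (r *ₚ s) i)
          ≡⟨ trans (coeff-scale a ((b ∷ r) *ₚ s) (suc i)) (cong (a ℤ.*_) (coeff-*-suc b r s i)) ⟨
        coeff (scale a ((b ∷ r) *ₚ s)) (suc i) ∎ }
    where
    open ≡-Reasoning
    lemma : ∀ a b x y → a ℤ.* b ℤ.* x ℤ.+ a ℤ.* y ≡ a ℤ.* (b ℤ.* x ℤ.+ y)
    lemma = solve-∀

  shift-* : ∀ r s → shift r *ₚ s ≋ shift (r *ₚ s)
  shift-* r s = pointwise λ
    { zero    → coeff-*-zero (shift r) s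
    ; (suc i) → trans (coeff-*-suc 0ℤ r s i) (ℤ.+-identityˡ _) }

  *-assoc : ∀ p r s → (p *ₚ r) *ₚ s ≋ p *ₚ (r *ₚ s)
  *-assoc []      r s = ≋-refl
  *-assoc (a ∷ p) r s = ≋-trans (*-distribʳ s (scale a r) (shift (p *ₚ r)))
    (+-cong (scale-* a r s) (≋-trans (shift-* (p *ₚ r) s) (shift-cong (*-assoc p r s))))

  const-* : ∀ a r → const a *ₚ r ≋ scale a r
  const-* a r = pointwise λ i → trans (coeff-+ (scale a r) _ i) (trans (cong (λ z → coeff (scale a r) i ℤ.+ z) (zeros i)) (ℤ.+-identityʳ _))
    where
    zeros : ∀ i → coeff (0ℤ ∷ []) i ≡ 0ℤ
    zeros zero    = refl
    zeros (suc i) = refl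

  *-identityˡ : ∀ r → 1ₚ *ₚ r ≋ r
  *-identityˡ r = ≋-trans (const-* 1ℤ r) (pointwise λ i → trans (coeff-scale 1ℤ r i) (ℤ.*-identityˡ _))

  polyRing : CommutativeRing 0ℓ 0ℓ
  polyRing = record
    { Carrier = Poly ; _≈_ = _≋_ ; _+_ = _+ₚ_ ; _*_ = _*ₚ_ ; -_ = -ₚ_ ; 0# = 0ₚ ; 1# = 1ₚ
    ; isCommutativeRing = record
      { isRing = record
        { +-isAbelianGroup = record
          { isGroup = record
            { isMonoid = record
              { isSemigroup = record
                { isMagma = record
                  { isEquivalence = record { refl = ≋-refl ; sym = ≋-sym ; trans = ≋-trans }
                  ; ∙-cong = +-cong }
                ; assoc = +-assoc }
              ; identity = (λ _ → ≋-refl) , +-identityʳ }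
            ; inverse = (λ p → ≋-trans (+-comm (-ₚ p) p) (neg-inverseʳ p)) , neg-inverseʳ
            ; ⁻¹-cong = neg-cong }
          ; comm = +-comm }
        ; *-cong = λ {p} {p′} {r} {r′} e f → ≋-trans (*-congʳ r e) (*-congˡ p′ f)
        ; *-assoc = *-assoc
        ; *-identity = *-identityˡ , (λ r → ≋-trans (*-comm r 1ₚ) (*-identityˡ r))
        ; distrib = *-distribˡ , *-distribʳ }
      ; *-comm = *-comm } }

-- Formal derivative and squarefreeness of q^i - 1

module Squarefreeness where
  open import Defs
  open import Data.List using ([]; _∷_)
  open ≡ hiding ([_])
  open PolynomialRing

  open Localisation polyRing using (Regular; Coprime; _∣_)
  module P = CommutativeRing polyRing
  module PS = IntegerCoefficients polyRing
  open Algebra.Properties.Semiring.Exp P.semiring using (_^_)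

  tail : Poly → Poly
  tail []      = []
  tail (a ∷ p) = p

  coeff-tail : ∀ p i → coeff (tail p) i ≡ coeff p (suc i)
  coeff-tail []      i = refl
  coeff-tail (a ∷ p) i = refl

  q : Poly
  q = qpow 1

  q*-shift : ∀ p → q *ₚ p ≋ shift p
  q*-shift p = pointwise λ
    { zero → trans (coeff-*-zero q p) (ℤ.*-zeroˡ (coeff p 0))
    ; (suc i) → trans (coeff-*-suc 0ℤ (1ℤ ∷ []) p i) (trans (ℤ.+-identityˡ _) (at (*-identityˡ p) i)) }

  -- ℤ is a domain: the constant term of the other factor must be zero, and after removing it the
  -- argument repeats.
  regular-constant : ∀ {A} → coeff A 0 ≢ 0ℤ → Regular A
  regular-constant {A} A₀≢0 []      _  = ≋-refl
  regular-constant {A} A₀≢0 (a ∷ f) fA≋0 = pointwise λ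
    { zero → a≡0 ; (suc i) → at (regular-constant {A} A₀≢0 f (pointwise fA)) i }
    where
    a≡0 : a ≡ 0ℤ
    a≡0 with ℤ.i*j≡0⇒i≡0∨j≡0 a (trans (sym (coeff-*-zero (a ∷ f) A)) (at fA≋0 0))
    ... | inj₁ a≡0  = a≡0
    ... | inj₂ A₀≡0 = ⊥-elim (A₀≢0 A₀≡0)
    fA : ∀ i → coeff (f *ₚ A) i ≡ 0ℤ
    fA i = trans (sym (ℤ.+-identityˡ _)) (trans (cong (λ z → z ℤ.* coeff A (suc i) ℤ.+ coeff (f *ₚ A) i) (sym a≡0))
      (trans (sym (coeff-*-suc a f A i)) (at fA≋0 (suc i))))

  regular-q : Regular q
  regular-q p pq≋0 = pointwise λ i → at (≋-trans (≋-sym (≋-trans (*-comm p q) (q*-shift p))) pq≋0) (suc i)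

  -- The formal derivative, in Horner form.
  D : Poly → Poly
  D []      = []
  D (a ∷ p) = p +ₚ shift (D p)

  coeff-D : ∀ p i → coeff (D p) i ≡ + suc i ℤ.* coeff p (suc i)
  coeff-D []      i       = sym (ℤ.*-zeroʳ (+ suc i))
  coeff-D (a ∷ p) zero    = trans (coeff-+ p _ 0) (trans (ℤ.+-identityʳ _) (sym (ℤ.*-identityˡ _)))
  coeff-D (a ∷ p) (suc i) = trans (coeff-+ p _ (suc i)) (trans (cong (λ z → coeff p (suc i) ℤ.+ z) (coeff-D p i)) (lemma (+ i) (coeff p (suc i))))
    where
    lemma : ∀ i x → x ℤ.+ (1ℤ ℤ.+ i) ℤ.* x ≡ (1ℤ ℤ.+ (1ℤ ℤ.+ i)) ℤ.* x
    lemma = solve-∀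

  D-cong : ∀ {p r} → p ≋ r → D p ≋ D r
  D-cong {p} {r} (pointwise e) = pointwise λ i → trans (coeff-D p i) (trans (cong (+ suc i ℤ.*_) (e (suc i))) (sym (coeff-D r i)))

  D-+ : ∀ p r → D (p +ₚ r) ≋ D p +ₚ D r
  D-+ p r = pointwise λ i → trans (coeff-D (p +ₚ r) i) (trans (cong (+ suc i ℤ.*_) (coeff-+ p r (suc i)))
    (trans (ℤ.*-distribˡ-+ (+ suc i) (coeff p (suc i)) (coeff r (suc i))) (trans (sym (cong₂ ℤ._+_ (coeff-D p i) (coeff-D r i))) (sym (coeff-+ (D p) (D r) i)))))

  D-scale : ∀ a p → D (scale a p) ≋ scale a (D p)
  D-scale a p = pointwise λ i → trans (coeff-D (scale a p) i) (trans (cong (+ suc i ℤ.*_) (coeff-scale a p (suc i)))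
    (trans (lemma (+ suc i) a _) (trans (cong (a ℤ.*_) (sym (coeff-D p i))) (sym (coeff-scale a (D p) i)))))
    where
    lemma : ∀ i a x → i ℤ.* (a ℤ.* x) ≡ a ℤ.* (i ℤ.* x)
    lemma = solve-∀

  leibniz : ∀ p r → D (p *ₚ r) ≋ D p *ₚ r +ₚ p *ₚ D r
  leibniz []      r = ≋-refl
  leibniz (a ∷ p) r = begin
    D (scale a r +ₚ shift (p *ₚ r))
      ≈⟨ D-+ (scale a r) (shift (p *ₚ r)) ⟩
    D (scale a r) +ₚ (p *ₚ r +ₚ shift (D (p *ₚ r)))
      ≈⟨ +-cong (D-scale a r) (+-cong (≋-refl {p *ₚ r}) (≋-trans (shift-cong (leibniz p r)) (≋-refl {shift (D p *ₚ r) +ₚ shift (p *ₚ D r)}))) ⟩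
    scale a (D r) +ₚ (p *ₚ r +ₚ (shift (D p *ₚ r) +ₚ shift (p *ₚ D r)))
      ≈⟨ PS.solve 4 (λ x y z w → x PS.:+ (y PS.:+ (z PS.:+ w)) PS.:= (y PS.:+ z) PS.:+ (x PS.:+ w)) P.refl (scale a (D r)) (p *ₚ r) (shift (D p *ₚ r)) (shift (p *ₚ D r)) ⟩
    (p *ₚ r +ₚ shift (D p *ₚ r)) +ₚ (scale a (D r) +ₚ shift (p *ₚ D r))
      ≈⟨ +-cong (≋-sym (≋-trans (*-distribʳ r p (shift (D p))) (+-cong (≋-refl {p *ₚ r}) (shift-* (D p) r)))) ≋-refl ⟩
    (p +ₚ shift (D p)) *ₚ r +ₚ (a ∷ p) *ₚ D r ∎
    where open import Relation.Binary.Reasoning.Setoid P.setoid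

  -- With the extra q the derivative becomes the Euler operator, which preserves the exponent and
  -- avoids i - 1.
  D-q^ : ∀ i → q *ₚ D (q ^ i) ≋ const (+ i) *ₚ q ^ i
  D-q^ zero    = pointwise λ { zero → refl ; (suc zero) → refl ; (suc (suc i)) → refl }
  D-q^ (suc i) = begin
    q *ₚ D (q *ₚ q ^ i)
      ≈⟨ *-congˡ q (leibniz q (q ^ i)) ⟩
    q *ₚ (D q *ₚ q ^ i +ₚ q *ₚ D (q ^ i))
      ≈⟨ *-congˡ q (+-cong (*-congʳ (q ^ i) Dq) (D-q^ i)) ⟩
    q *ₚ (1ₚ *ₚ q ^ i +ₚ const (+ i) *ₚ q ^ i)
      ≈⟨ PS.solve 4 (λ x o c y → x PS.:* (o PS.:* y PS.:+ c PS.:* y) PS.:= (o PS.:+ c) PS.:* (x PS.:* y)) P.refl q 1ₚ (const (+ i)) (q ^ i) ⟩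
    (1ₚ +ₚ const (+ i)) *ₚ (q *ₚ q ^ i) ∎
    where
    open import Relation.Binary.Reasoning.Setoid P.setoid
    Dq : D q ≋ 1ₚ
    Dq = pointwise λ { zero → refl ; (suc zero) → refl ; (suc (suc i)) → refl }

  -- Because the constant term of A is a unit, comparing constant terms shows that the lowest
  -- coefficient of c is m times the integer u f₀. Subtracting that multiple of A from f and
  -- dropping the constant term leaves the same problem for the tail of c.
  torsion-free : ∀ {A u} → coeff A 0 ℤ.* u ≡ 1ℤ → ∀ {m} → m ≢ 0ℤ → ∀ c f → scale m f ≋ c *ₚ A → A ∣ f
  torsion-free {A} {u} A₀u {m} m≢0 [] f eq = [] , pointwise λ i → zero′ i
    where
    zero′ : ∀ i → coeff f i ≡ 0ℤ
    zero′ i with ℤ.i*j≡0⇒i≡0∨j≡0 m (trans (sym (coeff-scale m f i)) (at eq i))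
    ... | inj₁ m≡0 = ⊥-elim (m≢0 m≡0)
    ... | inj₂ f≡0 = f≡0
  torsion-free {A} {u} A₀u {m} m≢0 (c₀ ∷ c) f eq with torsion-free {A} {u} A₀u m≢0 c (tail f′) tail-eq
    where
    c₀′ = u ℤ.* coeff f 0
    f′ = f -ₚ scale c₀′ A
    coeff-f′ : ∀ i → coeff f′ i ≡ coeff f i ℤ.- c₀′ ℤ.* coeff A i
    coeff-f′ i = trans (coeff-+ f _ i) (cong (λ z → coeff f i ℤ.+ z) (trans (coeff-neg (scale c₀′ A) i) (cong ℤ.-_ (coeff-scale c₀′ A i))))
    c₀≡ : c₀ ≡ m ℤ.* c₀′
    c₀≡ = let open ≡-Reasoning in begin
      c₀                                  ≡⟨ ℤ.*-identityʳ c₀ ⟨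
      c₀ ℤ.* 1ℤ                           ≡⟨ cong (c₀ ℤ.*_) A₀u ⟨
      c₀ ℤ.* (coeff A 0 ℤ.* u)            ≡⟨ ℤ.*-assoc c₀ _ u ⟨
      c₀ ℤ.* coeff A 0 ℤ.* u              ≡⟨ cong (ℤ._* u) (trans (sym (coeff-*-zero (c₀ ∷ c) A)) (trans (sym (at eq 0)) (coeff-scale m f 0))) ⟩
      m ℤ.* coeff f 0 ℤ.* u               ≡⟨ trans (ℤ.*-assoc m _ u) (cong (m ℤ.*_) (ℤ.*-comm (coeff f 0) u)) ⟩
      m ℤ.* c₀′                           ∎
    tail-eq : scale m (tail f′) ≋ c *ₚ A
    tail-eq = pointwise λ i → let open ≡-Reasoning in begin
      coeff (scale m (tail f′)) i
        ≡⟨ trans (coeff-scale m (tail f′) i) (cong (m ℤ.*_) (trans (coeff-tail f′ i) (coeff-f′ (suc i)))) ⟩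
      m ℤ.* (coeff f (suc i) ℤ.- c₀′ ℤ.* coeff A (suc i))
        ≡⟨ lemma m (coeff f (suc i)) c₀′ (coeff A (suc i)) ⟩
      m ℤ.* coeff f (suc i) ℤ.- m ℤ.* c₀′ ℤ.* coeff A (suc i)
        ≡⟨ cong₂ (λ x y → x ℤ.- y ℤ.* coeff A (suc i)) (trans (sym (coeff-scale m f (suc i))) (trans (at eq (suc i)) (coeff-*-suc c₀ c A i))) (sym c₀≡) ⟩
      (c₀ ℤ.* coeff A (suc i) ℤ.+ coeff (c *ₚ A) i) ℤ.- c₀ ℤ.* coeff A (suc i)
        ≡⟨ lemma₂ (c₀ ℤ.* coeff A (suc i)) (coeff (c *ₚ A) i) ⟩
      coeff (c *ₚ A) i ∎
      where
      lemma : ∀ m x c a → m ℤ.* (x ℤ.- c ℤ.* a) ≡ m ℤ.* x ℤ.- m ℤ.* c ℤ.* a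
      lemma = solve-∀
      lemma₂ : ∀ x y → (x ℤ.+ y) ℤ.- x ≡ y
      lemma₂ = solve-∀
  ... | d , tail≋ = (u ℤ.* coeff f 0) ∷ d , pointwise go
    where
    open ≡-Reasoning
    c₀′ = u ℤ.* coeff f 0
    f′ = f -ₚ scale c₀′ A
    coeff-f : ∀ i → coeff f i ≡ c₀′ ℤ.* coeff A i ℤ.+ coeff f′ i
    coeff-f i = sym (trans (cong (λ z → c₀′ ℤ.* coeff A i ℤ.+ z) (trans (coeff-+ f _ i) (cong (λ z → coeff f i ℤ.+ z) (trans (coeff-neg (scale c₀′ A) i) (cong ℤ.-_ (coeff-scale c₀′ A i)))))) (lemma (c₀′ ℤ.* coeff A i) (coeff f i)))
      where
      lemma : ∀ x y → x ℤ.+ (y ℤ.- x) ≡ y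
      lemma = solve-∀
    go : ∀ i → coeff f i ≡ coeff ((c₀′ ∷ d) *ₚ A) i
    go zero    = begin
      coeff f 0                              ≡⟨ ℤ.*-identityʳ _ ⟨
      coeff f 0 ℤ.* 1ℤ                       ≡⟨ cong (coeff f 0 ℤ.*_) A₀u ⟨
      coeff f 0 ℤ.* (coeff A 0 ℤ.* u)        ≡⟨ lemma (coeff f 0) (coeff A 0) u ⟩
      c₀′ ℤ.* coeff A 0                      ≡⟨ coeff-*-zero (c₀′ ∷ d) A ⟨
      coeff ((c₀′ ∷ d) *ₚ A) 0               ∎
      where
      lemma : ∀ f a u → f ℤ.* (a ℤ.* u) ≡ u ℤ.* f ℤ.* a
      lemma = solve-∀
    go (suc i) = trans (coeff-f (suc i)) (trans (cong (λ z → c₀′ ℤ.* coeff A (suc i) ℤ.+ z) (trans (sym (coeff-tail f′ i)) (at tail≋ i))) (sym (coeff-*-suc c₀′ d A i)))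

  unit-ℤ : ∀ a b → a ℤ.* b ≡ 1ℤ ⊎ a ℤ.* b ≡ -1ℤ → a ≡ 1ℤ ⊎ a ≡ -1ℤ
  unit-ℤ a b eq with ℕ.m*n≡1⇒m≡1 ℤ.∣ a ∣ ℤ.∣ b ∣ (trans (sym (ℤ.abs-* a b)) (abs≡1 eq))
    where
    abs≡1 : a ℤ.* b ≡ 1ℤ ⊎ a ℤ.* b ≡ -1ℤ → ℤ.∣ a ℤ.* b ∣ ≡ 1
    abs≡1 (inj₁ e) = cong ℤ.∣_∣ e
    abs≡1 (inj₂ e) = cong ℤ.∣_∣ e
  unit-ℤ (+ 1)      b eq | refl = inj₁ refl
  unit-ℤ -[1+ 0 ]   b eq | refl = inj₂ refl

  unit-inverse : ∀ {a} → a ≡ 1ℤ ⊎ a ≡ -1ℤ → a ℤ.* a ≡ 1ℤ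
  unit-inverse (inj₁ refl) = refl
  unit-inverse (inj₂ refl) = refl

  X : ℕ → Poly
  X i = q ^ i -ₚ 1ₚ

  coeff-X-0 : ∀ i → coeff (X (suc i)) 0 ≡ -1ℤ
  coeff-X-0 i = trans (coeff-+ (q ^ suc i) _ 0) (cong (λ z → z ℤ.+ -1ℤ) (trans (coeff-*-zero q (q ^ i)) (ℤ.*-zeroˡ (coeff (q ^ i) 0))))

  -- q^i − 1 is squarefree: differentiate A B = q^i − 1.
  factors-coprime : ∀ i {A B} → A *ₚ B ≋ X (suc i) → Coprime A B
  factors-coprime i {A} {B} AB≋X f (c , fB≋cA) = torsion-free {A} {coeff A 0} (unit-inverse A₀) {+ suc i} (λ ()) (c *ₚ (q *ₚ D A -ₚ m *ₚ A) +ₚ f *ₚ q *ₚ D B) f (≋-trans (≋-sym (const-* (+ suc i) f)) (begin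
    -- Here m = m qⁱ⁺¹ - m (qⁱ⁺¹ - 1). The first part is q times the derivative of A B, the second
    -- is m A B; after multiplication by f all their terms contain A or f B, and f B is a multiple
    -- of A.
    m *ₚ f
      ≈⟨ PS.solve 4 (λ m f x y → m PS.:* f PS.:= f PS.:* (m PS.:* (x PS.:+ y)) PS.:- m PS.:* f PS.:* (x PS.:+ y PS.:- PS.con (+ 1))) P.refl m f (q ^ suc i) 0ₚ ⟩
    f *ₚ (m *ₚ (q ^ suc i +ₚ 0ₚ)) -ₚ m *ₚ f *ₚ (q ^ suc i +ₚ 0ₚ -ₚ 1ₚ)
      ≈⟨ P.+-cong (*-congˡ f (*-congˡ m (+-identityʳ (q ^ suc i)))) (P.-‿cong (*-congˡ (m *ₚ f) (+-cong (+-identityʳ (q ^ suc i)) (≋-refl { -ₚ 1ₚ})))) ⟩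
    f *ₚ (m *ₚ q ^ suc i) -ₚ m *ₚ f *ₚ X (suc i)
      ≈⟨ P.+-cong (*-congˡ f qDX) (P.-‿cong (*-congˡ (m *ₚ f) AB≋X)) ⟨
    f *ₚ (q *ₚ (D A *ₚ B +ₚ A *ₚ D B)) -ₚ m *ₚ f *ₚ (A *ₚ B)
      ≈⟨ PS.solve 7 (λ f q a b x y m → f PS.:* (q PS.:* (a PS.:* y PS.:+ x PS.:* b)) PS.:- m PS.:* f PS.:* (x PS.:* y)
           PS.:= (f PS.:* y) PS.:* (q PS.:* a PS.:- m PS.:* x) PS.:+ f PS.:* q PS.:* b PS.:* x) P.refl f q (D A) (D B) A B m ⟩
    (f *ₚ B) *ₚ (q *ₚ D A -ₚ m *ₚ A) +ₚ f *ₚ q *ₚ D B *ₚ A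
      ≈⟨ P.+-congʳ (*-congʳ _ fB≋cA) ⟩
    (c *ₚ A) *ₚ (q *ₚ D A -ₚ m *ₚ A) +ₚ f *ₚ q *ₚ D B *ₚ A
      ≈⟨ PS.solve 4 (λ c x y z → (c PS.:* x) PS.:* y PS.:+ z PS.:* x PS.:= (c PS.:* y PS.:+ z) PS.:* x) P.refl c A (q *ₚ D A -ₚ m *ₚ A) (f *ₚ q *ₚ D B) ⟩
    (c *ₚ (q *ₚ D A -ₚ m *ₚ A) +ₚ f *ₚ q *ₚ D B) *ₚ A ∎))
    where
    open import Relation.Binary.Reasoning.Setoid P.setoid
    m = const (+ suc i)
    A₀ : coeff A 0 ≡ 1ℤ ⊎ coeff A 0 ≡ -1ℤ
    A₀ = unit-ℤ (coeff A 0) (coeff B 0) (inj₂ (trans (sym (coeff-*-zero A B)) (trans (at AB≋X 0) (coeff-X-0 i))))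
    qDX : q *ₚ (D A *ₚ B +ₚ A *ₚ D B) ≋ m *ₚ q ^ suc i
    qDX = begin
      q *ₚ (D A *ₚ B +ₚ A *ₚ D B)              ≈⟨ *-congˡ q (leibniz A B) ⟨
      q *ₚ D (A *ₚ B)                          ≈⟨ *-congˡ q (D-cong AB≋X) ⟩
      q *ₚ D (X (suc i))                       ≈⟨ *-congˡ q (≋-trans (D-+ (q ^ suc i) (-ₚ 1ₚ)) (≋-trans (+-cong (≋-refl {D (q ^ suc i)}) D-1) (+-identityʳ _))) ⟩
      q *ₚ D (q ^ suc i)                       ≈⟨ D-q^ (suc i) ⟩
      m *ₚ q ^ suc i                           ∎
      where
      D-1 : D (-ₚ 1ₚ) ≋ []
      D-1 = pointwise λ { zero → refl ; (suc i) → refl }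

-- Exactness of the division that defines the cyclotomic polynomials

module ExactDivision where
  open import Defs
  open import Data.List using (List; []; _∷_; [_]; map; replicate; _++_; length; reverse; _∷ʳ_; upTo)
  open import Data.List.Properties using (reverse-involutive; unfold-reverse; map-cong-local)
  open import Data.List.Relation.Unary.All using (All; []; _∷_)
  import Data.List.Relation.Unary.All as All
  import Data.List.Relation.Unary.All.Properties as All
  open import Relation.Binary using (tri<; tri≈; tri>)
  open ≡ hiding ([_])
  open PolynomialRing
  open Squarefreeness
  open Localisation polyRing using (_∣_)
  open Algebra.Properties.Semiring.Exp P.semiring using (_^_)

  -- Degree and leading coefficient are given by coefficients alone, because trailing zeros make the
  -- length of a list meaningless.
  record Lead (p : Poly) (k : ℕ) (a : ℤ) : Set where
    constructor lead
    field
      leading  : coeff p k ≡ a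
      nonzero  : a ≢ 0ℤ
      vanishes : ∀ i → k < i → coeff p i ≡ 0ℤ
  open Lead

  lead-resp : ∀ {p r k a} → p ≋ r → Lead p k a → Lead r k a
  lead-resp (pointwise e) (lead l n v) = lead (trans (sym (e _)) l) n (λ i k<i → trans (sym (e i)) (v i k<i))

  lead-unique : ∀ {p k a l b} → Lead p k a → Lead p l b → k ≡ l × a ≡ b
  lead-unique {k = k} {l = l} x y with ℕ.<-cmp k l
  ... | tri< k<l _ _  = ⊥-elim (nonzero y (trans (sym (leading y)) (vanishes x _ k<l)))
  ... | tri≈ _ refl _ = refl , trans (sym (leading x)) (leading y)
  ... | tri> _ _ l<k  = ⊥-elim (nonzero x (trans (sym (leading x)) (vanishes y _ l<k)))

  lead? : ∀ p → p ≋ [] ⊎ (∃ λ k → ∃ λ a → Lead p k a)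
  lead? [] = inj₁ ≋-refl
  lead? (a ∷ p) with lead? p
  ... | inj₂ (k , b , lead l n v) = inj₂ (suc k , b , lead l n λ { (suc i) (s≤s k<i) → v i k<i })
  ... | inj₁ p≋[] with a ℤ.≟ 0ℤ
  ...   | yes a≡0 = inj₁ (pointwise λ { zero → a≡0 ; (suc i) → at p≋[] i })
  ...   | no a≢0  = inj₂ (0 , a , lead refl a≢0 λ { (suc i) _ → at p≋[] i })

  *-vanishes : ∀ p r k l → (∀ i → k < i → coeff p i ≡ 0ℤ) → (∀ i → l < i → coeff r i ≡ 0ℤ) →
    coeff (p *ₚ r) (k ℕ.+ l) ≡ coeff p k ℤ.* coeff r l × (∀ i → k ℕ.+ l < i → coeff (p *ₚ r) i ≡ 0ℤ)
  *-vanishes [] r k l _ _ = refl , λ _ _ → refl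
  *-vanishes (a ∷ p) r zero l vp vr = trans (eq l) refl , λ i l<i → trans (eq i) (trans (cong (a ℤ.*_) (vr i l<i)) (ℤ.*-zeroʳ a))
    where
    p≋[] : p ≋ []
    p≋[] = pointwise λ i → vp (suc i) (s≤s z≤n)
    eq : ∀ i → coeff ((a ∷ p) *ₚ r) i ≡ a ℤ.* coeff r i
    eq zero    = coeff-*-zero (a ∷ p) r
    eq (suc i) = trans (coeff-*-suc a p r i) (trans (cong (λ z → a ℤ.* coeff r (suc i) ℤ.+ z) (at (*-congʳ r p≋[]) i)) (ℤ.+-identityʳ _))
  *-vanishes (a ∷ p) r (suc k) l vp vr with *-vanishes p r k l (λ i k<i → vp (suc i) (s≤s k<i)) vr
  ... | top , above = trans (high (ℕ.m≤n+m (suc l) k) (ℕ.+-suc k l)) top ,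
      λ { (suc i) (s≤s k+l<i) → trans (high (ℕ.≤-trans (ℕ.m≤n+m (suc l) k) (ℕ.≤-trans (ℕ.≤-reflexive (ℕ.+-suc k l)) (ℕ.m≤n⇒m≤1+n k+l<i))) refl) (above i k+l<i) }
    where
    high : ∀ {i j} → l < i → i ≡ suc j → coeff ((a ∷ p) *ₚ r) (suc j) ≡ coeff (p *ₚ r) j
    high {j = j} l<i refl = trans (coeff-*-suc a p r j) (trans (cong (λ z → z ℤ.+ coeff (p *ₚ r) j) (trans (cong (a ℤ.*_) (vr (suc j) l<i)) (ℤ.*-zeroʳ a))) (ℤ.+-identityˡ _))

  lead-* : ∀ {p k a r l b} → Lead p k a → Lead r l b → Lead (p *ₚ r) (k ℕ.+ l) (a ℤ.* b)
  lead-* {p} {k} {a} {r} {l} {b} x y with *-vanishes p r k l (vanishes x) (vanishes y)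
  ... | top , above = lead (trans top (cong₂ ℤ._*_ (leading x) (leading y))) a*b≢0 above
    where
    a*b≢0 : a ℤ.* b ≢ 0ℤ
    a*b≢0 ab≡0 with ℤ.i*j≡0⇒i≡0∨j≡0 a ab≡0
    ... | inj₁ a≡0 = nonzero x a≡0
    ... | inj₂ b≡0 = nonzero y b≡0

  Monic : Poly → Set
  Monic p = ∃ λ k → Lead p k 1ℤ

  monic-* : ∀ {p r} → Monic p → Monic r → Monic (p *ₚ r)
  monic-* (k , x) (l , y) = k ℕ.+ l , lead-* x y

  monic-1 : Monic 1ₚ
  monic-1 = 0 , lead refl (λ ()) λ { (suc i) _ → refl }

  lead-[] : ∀ {p k a} → Lead p k a → ¬ (p ≋ [])
  lead-[] x e = nonzero x (trans (sym (leading x)) (at e _))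

  monic-quotient : ∀ {c b a} → c *ₚ b ≋ a → Monic b → Monic a → Monic c
  monic-quotient {c} {b} cb≋a (l , y) (m , z) with lead? c
  ... | inj₁ c≋[] = ⊥-elim (lead-[] z (≋-trans (≋-sym cb≋a) (*-congʳ b c≋[])))
  ... | inj₂ (k , x , lx) with lead-unique (lead-resp cb≋a (lead-* lx y)) z
  ...   | _ , x*1≡1 = k , subst (Lead c k) (trans (sym (ℤ.*-identityʳ x)) x*1≡1) lx

  qpow-≋ : ∀ m → qpow m ≋ q ^ m
  qpow-≋ zero    = ≋-refl
  qpow-≋ (suc m) = ≋-trans (shift-cong (qpow-≋ m)) (≋-sym (q*-shift (q ^ m)))

  lead-monomial : ∀ m {a} → a ≢ 0ℤ → Lead (replicate m 0ℤ ++ [ a ]) m a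
  lead-monomial zero    a≢0 = lead refl a≢0 λ { (suc i) _ → refl }
  lead-monomial (suc m) a≢0 with lead-monomial m a≢0
  ... | lead l n v = lead l n λ { (suc i) (s≤s m<i) → v i m<i }

  monic-X : ∀ i → Monic (X (suc i))
  monic-X i = suc i , lead-resp (+-cong (qpow-≋ (suc i)) ≋-refl) (lead
    (trans (coeff-+ (qpow (suc i)) (-ₚ 1ₚ) (suc i)) (trans (ℤ.+-identityʳ _) (leading (lead-monomial (suc i) {1ℤ} (λ ()))))) (λ ())
    (λ { (suc j) i<j → trans (coeff-+ (qpow (suc i)) (-ₚ 1ₚ) (suc j)) (trans (ℤ.+-identityʳ _) (vanishes (lead-monomial (suc i) {1ℤ} (λ ())) (suc j) i<j)) }))

  snoc-zero : ∀ p → p ∷ʳ 0ℤ ≋ p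
  snoc-zero []      = pointwise λ { zero → refl ; (suc i) → refl }
  snoc-zero (a ∷ p) = pointwise λ { zero → refl ; (suc i) → at (snoc-zero p) i }

  normalize-zero : ∀ ys → normalize (reverse (0ℤ ∷ ys)) ≡ normalize (reverse ys)
  normalize-zero ys rewrite reverse-involutive (0ℤ ∷ ys) | reverse-involutive ys = refl

  normalize-nonzero : ∀ x ys → x ≢ 0ℤ → normalize (reverse (x ∷ ys)) ≡ reverse (x ∷ ys)
  normalize-nonzero (+ zero)  ys x≢0 = ⊥-elim (x≢0 refl)
  normalize-nonzero (+ suc n) ys _ rewrite reverse-involutive (+ suc n ∷ ys) = refl
  normalize-nonzero -[1+ n ]  ys _ rewrite reverse-involutive (-[1+ n ] ∷ ys) = refl

  -- `normalize` works from the end of the list, so its result is described by its last entry.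
  data NormalForm (p : Poly) : Set where
    empty : normalize p ≡ [] → p ≋ [] → NormalForm p
    snoc  : ∀ zs x → x ≢ 0ℤ → normalize p ≡ zs ∷ʳ x → p ≋ zs ∷ʳ x → NormalForm p

  normalForm : ∀ p → NormalForm p
  normalForm p = subst NormalForm (reverse-involutive p) (go (reverse p))
    where
    go : ∀ ys → NormalForm (reverse ys)
    go [] = empty refl ≋-refl
    go (x ∷ ys) with x ℤ.≟ 0ℤ
    ... | no x≢0 = snoc (reverse ys) x x≢0 (trans (normalize-nonzero x ys x≢0) (unfold-reverse x ys)) (subst (λ r → reverse (x ∷ ys) ≋ r) (unfold-reverse x ys) ≋-refl)
    ... | yes refl with go ys
    ...   | empty n≡ e       = empty (trans (normalize-zero ys) n≡) (≋-trans drop e)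
      where
      drop : reverse (0ℤ ∷ ys) ≋ reverse ys
      drop = subst (λ r → r ≋ reverse ys) (sym (unfold-reverse 0ℤ ys)) (snoc-zero (reverse ys))
    ...   | snoc zs y y≢0 n≡ e = snoc zs y y≢0 (trans (normalize-zero ys) n≡) (≋-trans drop e)
      where
      drop : reverse (0ℤ ∷ ys) ≋ reverse ys
      drop = subst (λ r → r ≋ reverse ys) (sym (unfold-reverse 0ℤ ys)) (snoc-zero (reverse ys))

  normalize-≋ : ∀ p → normalize p ≋ p
  normalize-≋ p with normalForm p
  ... | empty n≡ e        = ≋-trans (subst (λ r → normalize p ≋ r) n≡ ≋-refl) (≋-sym e)
  ... | snoc zs x _ n≡ e  = ≋-trans (subst (λ r → normalize p ≋ r) n≡ ≋-refl) (≋-sym e)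

  lead-snoc : ∀ zs {x} → x ≢ 0ℤ → Lead (zs ∷ʳ x) (length zs) x
  lead-snoc []       x≢0 = lead refl x≢0 λ { (suc i) _ → refl }
  lead-snoc (z ∷ zs) x≢0 with lead-snoc zs x≢0
  ... | lead l n v = lead l n λ { (suc i) (s≤s k<i) → v i k<i }

  length-snoc : ∀ zs (x : ℤ) → length (zs ∷ʳ x) ≡ suc (length zs)
  length-snoc []       x = refl
  length-snoc (z ∷ zs) x = cong suc (length-snoc zs x)

  length-normalize : ∀ {p k a} → Lead p k a → length (normalize p) ≡ suc k
  length-normalize {p} x with normalForm p
  ... | empty _ e = ⊥-elim (lead-[] x e)
  ... | snoc zs y y≢0 n≡ e = trans (cong length n≡) (trans (length-snoc zs y) (cong suc (proj₁ (lead-unique (lead-resp (≋-sym e) (lead-snoc zs y≢0)) x))))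

  normalize-snoc : ∀ zs {x} → x ≢ 0ℤ → normalize (zs ∷ʳ x) ≡ zs ∷ʳ x
  normalize-snoc zs {x} x≢0 = subst (λ r → normalize r ≡ r) eq (normalize-nonzero x (reverse zs) x≢0)
    where
    eq : reverse (x ∷ reverse zs) ≡ zs ∷ʳ x
    eq = trans (unfold-reverse x (reverse zs)) (cong (_∷ʳ x) (reverse-involutive zs))

  coeff-last : ∀ k z → coeff ((replicate k 0ℤ ++ [ z ]) +ₚ []) k ≡ z
  coeff-last zero    z = refl
  coeff-last (suc k) z = top k
    where
    top : ∀ k → coeff (replicate k 0ℤ ++ [ z ]) k ≡ z
    top zero    = refl
    top (suc k) = top k

  -- The last entry of a normalised list, which Defs only exposes through divMonicF: dividing by [] once returns it as a coefficient.
  final : Poly → ℤ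
  final a = coeff (divMonicF 1 a []) (length (normalize a))

  final-snoc : ∀ zs {x} → x ≢ 0ℤ → final (zs ∷ʳ x) ≡ x
  final-snoc []           {x} x≢0 rewrite normalize-snoc [] x≢0 = coeff-last 1 x
  final-snoc (y ∷ [])     {x} x≢0 rewrite normalize-snoc (y ∷ []) x≢0 = coeff-last 2 x
  final-snoc (y ∷ z ∷ zs) {x} x≢0 = step (final-snoc (z ∷ zs) x≢0)
    where
    step : final (z ∷ zs ∷ʳ x) ≡ x → final (y ∷ z ∷ zs ∷ʳ x) ≡ x
    step rewrite normalize-snoc (y ∷ z ∷ zs) x≢0 | normalize-snoc (z ∷ zs) x≢0 =
      λ ih → trans (coeff-last (suc (suc (length (zs ∷ʳ x)))) _) (trans (sym (coeff-last (suc (length (zs ∷ʳ x))) _)) ih)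

  final-normalForm : ∀ a zs {x} → x ≢ 0ℤ → normalize a ≡ zs ∷ʳ x → final a ≡ x
  final-normalForm a zs {x} x≢0 n≡ = trans same (final-snoc zs x≢0)
    where
    same : final a ≡ final (zs ∷ʳ x)
    same rewrite n≡ | normalize-snoc zs x≢0 = refl

  divMonicF-small : ∀ f a b → length (normalize a) < length (normalize b) → divMonicF (suc f) a b ≡ []
  divMonicF-small f a b lt rewrite dec-true (length (normalize a) ℕ.<? length (normalize b)) lt = refl

  quotientTerm : Poly → Poly → Poly
  quotientTerm a b = replicate (length (normalize a) ℕ.∸ length (normalize b)) 0ℤ ++ [ final a ]

  divMonicF-large : ∀ f a b → ¬ (length (normalize a) < length (normalize b)) →
    divMonicF (suc f) a b ≡ quotientTerm a b +ₚ divMonicF f (normalize a -ₚ quotientTerm a b *ₚ normalize b) (normalize b)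
  divMonicF-large f a b ≮ rewrite dec-false (length (normalize a) ℕ.<? length (normalize b)) ≮ =
    cong (λ l → let t = replicate (length (normalize a) ℕ.∸ length (normalize b)) 0ℤ ++ [ l ]
                in t +ₚ divMonicF f (normalize a -ₚ t *ₚ normalize b) (normalize b))
      (sym (coeff-last (length (normalize a)) _))

  -- A division step cancels the leading term of a and replaces the quotient c by c - t, so the fuel
  -- stays a strict bound for the degree. Once the degree of a is below that of b, or a is zero,
  -- monicity of b forces c = 0.
  divMonicF-exact : ∀ f a b c {l} → Lead b l 1ℤ → (∀ i → f ≤ i → coeff a i ≡ 0ℤ) → a ≋ c *ₚ b → divMonicF f a b ≋ c
  divMonicF-exact f a b c {l} lb vanish a≋cb = go f vanish (normalForm a)
    where
    c≋[] : (∀ i → l ≤ i → coeff a i ≡ 0ℤ) → c ≋ []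
    c≋[] small with lead? c
    ... | inj₁ e = e
    ... | inj₂ (k , y , lc) = ⊥-elim (nonzero lcb (trans (sym (leading lcb)) (small _ (ℕ.m≤n+m l k))))
      where lcb = lead-resp (≋-sym a≋cb) (lead-* lc lb)

    go : ∀ f → (∀ i → f ≤ i → coeff a i ≡ 0ℤ) → NormalForm a → divMonicF f a b ≋ c
    go zero vanish _ = ≋-sym (c≋[] (λ i _ → vanish i z≤n))
    go (suc f) vanish (empty n≡ e) = subst (λ r → r ≋ c)
      (sym (divMonicF-small f a b (subst₂ _<_ (sym (cong length n≡)) (sym (length-normalize lb)) (s≤s z≤n))))
      (≋-sym (c≋[] (λ i _ → at e i)))
    go (suc f) vanish (snoc zs x x≢0 n≡ e) with length zs ℕ.<? l
    ... | yes k<l = subst (λ r → r ≋ c)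
      (sym (divMonicF-small f a b (subst₂ _<_ (sym (length-normalize la)) (sym (length-normalize lb)) (s≤s k<l))))
      (≋-sym (c≋[] (λ i l≤i → vanishes la i (ℕ.<-≤-trans k<l l≤i))))
      where
      la : Lead a (length zs) x
      la = lead-resp (≋-sym e) (lead-snoc zs x≢0)
    ... | no k≮l = subst (λ r → r ≋ c) (sym (divMonicF-large f a b (λ lt → k≮l (ℕ.≤-pred (subst₂ _<_ (length-normalize la) (length-normalize lb) lt)))))
      (≋-trans (+-cong (≋-refl {t}) (divMonicF-exact f a″ (normalize b) (c -ₚ t) (lead-resp (≋-sym (normalize-≋ b)) lb) vanish″ eq″))
        (PS.solve 2 (λ t c → t PS.:+ (c PS.:- t) PS.:= c) P.refl t c))
      where
      k = length zs
      la : Lead a k x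
      la = lead-resp (≋-sym e) (lead-snoc zs x≢0)
      t = quotientTerm a b
      lt : Lead t (k ℕ.∸ l) x
      lt = subst (λ r → Lead r (k ℕ.∸ l) x)
        (sym (cong₂ (λ d z → replicate d 0ℤ ++ [ z ]) (cong₂ ℕ._∸_ (length-normalize la) (length-normalize lb)) (final-normalForm a zs x≢0 n≡)))
        (lead-monomial (k ℕ.∸ l) x≢0)
      a″ = normalize a -ₚ t *ₚ normalize b
      a″≋ : a″ ≋ a -ₚ t *ₚ b
      a″≋ = +-cong (normalize-≋ a) (neg-cong (*-congˡ t (normalize-≋ b)))
      ltb : Lead (t *ₚ b) k x
      ltb = subst₂ (Lead (t *ₚ b)) (ℕ.m∸n+n≡m (ℕ.≮⇒≥ k≮l)) (ℤ.*-identityʳ x) (lead-* lt lb)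
      k≤f : k ≤ f
      k≤f = ℕ.≮⇒≥ (λ f<k → nonzero la (trans (sym (leading la)) (vanish k f<k)))
      coeff-a″ : ∀ i → coeff a″ i ≡ coeff a i ℤ.- coeff (t *ₚ b) i
      coeff-a″ i = trans (at a″≋ i) (trans (coeff-+ a _ i) (cong (λ z → coeff a i ℤ.+ z) (coeff-neg (t *ₚ b) i)))
      vanish″ : ∀ i → f ≤ i → coeff a″ i ≡ 0ℤ
      vanish″ i f≤i with ℕ.m≤n⇒m<n∨m≡n (ℕ.≤-trans k≤f f≤i)
      ... | inj₁ k<i  = trans (coeff-a″ i) (cong₂ ℤ._-_ (vanishes la i k<i) (vanishes ltb i k<i))
      ... | inj₂ refl = trans (coeff-a″ i) (trans (cong₂ ℤ._-_ (leading la) (leading ltb)) (ℤ.+-inverseʳ x))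
      eq″ : a″ ≋ (c -ₚ t) *ₚ normalize b
      eq″ = ≋-trans a″≋ (≋-trans (+-cong a≋cb ≋-refl)
        (≋-trans (PS.solve 3 (λ c b t → c PS.:* b PS.:- t PS.:* b PS.:= (c PS.:- t) PS.:* b) P.refl c b t) (*-congˡ (c -ₚ t) (≋-sym (normalize-≋ b)))))

  coeff-length : ∀ p i → length p ≤ i → coeff p i ≡ 0ℤ
  coeff-length []      i       _       = refl
  coeff-length (a ∷ p) (suc i) (s≤s h) = coeff-length p i h

  divMonic-exact : ∀ a b c → Monic b → a ≋ c *ₚ b → divMonic a b ≋ c
  divMonic-exact a b c (l , lb) = divMonicF-exact (suc (length a)) a b c lb (λ i h → coeff-length a i (ℕ.<⇒≤ h))

  -- This is `Φ` before the final normalisation, which leaves the coefficients unchanged.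
  φ : ℕ → Poly
  φ n = cycF n n

  ProperDivisor : ℕ → ℕ → Set
  ProperDivisor n d = 1 ≤ d × d < n × d ℕ.∣ n

  properDivisors-sound : ∀ n → All (ProperDivisor n) (properDivisors n)
  properDivisors-sound n = All.map (λ { ((1≤d , d<n) , d∣n) → 1≤d , d<n , d∣n })
    (All.zip (All.filter⁺ (λ d → d ℕ.∣? n) range , All.all-filter (λ d → d ℕ.∣? n) (map suc (upTo (n ℕ.∸ 1)))))
    where
    bound : ∀ n {i} → i < n ℕ.∸ 1 → suc i < n
    bound (suc n) i<n = s≤s i<n
    range : All (λ d → 1 ≤ d × d < n) (map suc (upTo (n ℕ.∸ 1)))
    range = All.map⁺ (All.applyUpTo⁺₁ (λ i → i) (n ℕ.∸ 1) (λ i<n → s≤s z≤n , bound n i<n))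

  -- Proper divisors decrease at least by one in each recursive call, as the fuel does.
  cycF-fuel : ∀ f g n → 1 ≤ n → n ≤ f → n ≤ g → cycF f n ≡ cycF g n
  cycF-fuel (suc f) (suc g) n _ n≤f n≤g = cong (λ ds → divMonic (qpow n -ₚ 1ₚ) (prodₚ ds))
    (map-cong-local (All.map (λ { {d} (1≤d , d<n , _) → cycF-fuel f g d 1≤d (ℕ.≤-pred (ℕ.<-≤-trans d<n n≤f)) (ℕ.≤-pred (ℕ.<-≤-trans d<n n≤g)) })
      (properDivisors-sound n)))
  cycF-fuel zero    g       n 1≤n n≤f _   = ⊥-elim (ℕ.<⇒≱ 1≤n n≤f)
  cycF-fuel (suc f) zero    n 1≤n _   n≤g = ⊥-elim (ℕ.<⇒≱ 1≤n n≤g)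

  properProduct : ℕ → Poly
  properProduct n = prodₚ (map φ (properDivisors n))

  -- The divisibility is still an assumption here; strong induction on n discharges it in `next`.
  φ-exact : ∀ n → Monic (properProduct (suc n)) → properProduct (suc n) ∣ X (suc n) → φ (suc n) *ₚ properProduct (suc n) ≋ X (suc n)
  φ-exact n monic (c , X≋cP) = ≋-trans (*-congʳ (properProduct (suc n)) φ≋c) (≋-sym X≋cP)
    where
    product-eq : prodₚ (map (cycF n) (properDivisors (suc n))) ≡ properProduct (suc n)
    product-eq = cong prodₚ (map-cong-local (All.map (λ { {d} (1≤d , d<n , _) → cycF-fuel n d d 1≤d (ℕ.≤-pred d<n) ℕ.≤-refl }) (properDivisors-sound (suc n))))
    φ≋c : φ (suc n) ≋ c
    φ≋c = subst (λ P → divMonic (qpow (suc n) -ₚ 1ₚ) P ≋ c) (sym product-eq)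
      (divMonic-exact (qpow (suc n) -ₚ 1ₚ) (properProduct (suc n)) c monic (≋-trans (+-cong (qpow-≋ (suc n)) ≋-refl) X≋cP))

  Φ-φ : ∀ n → Φ n ≋ φ n
  Φ-φ n = normalize-≋ (φ n)

-- Factorisation of qⁿ - 1 into pairwise coprime cyclotomic polynomials

module Cyclotomic where
  open import Defs
  import Data.Nat.GCD as ℕ
  open import Data.Nat.Induction using (<-rec)
  open import Data.List using (List; []; _∷_; [_]; map)
  open import Data.List.Relation.Unary.All using (All; []; _∷_)
  import Data.List.Relation.Unary.All as All
  open import Data.List.Relation.Unary.AllPairs using (AllPairs; []; _∷_)
  import Data.List.Relation.Unary.Unique.Propositional.Properties as Unique
  open import Data.List.Relation.Unary.Any using (here; there)
  open import Data.List.Membership.Propositional using (_∈_)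
  open import Data.List.Membership.Propositional.Properties using (∈-filter⁺; ∈-map⁺; ∈-upTo⁺)
  open ≡ hiding ([_])
  open PolynomialRing
  open Squarefreeness
  open ExactDivision
  open Localisation polyRing
  open Algebra.Properties.Semiring.Exp P.semiring using (_^_; ^-homo-*)
  open import Relation.Binary.Reasoning.Setoid P.setoid

  ∣-refl : ∀ {p} → p ∣ p
  ∣-refl {p} = 1ₚ , ≋-sym (*-identityˡ p)

  ≋⇒∣ : ∀ {p r} → p ≋ r → p ∣ r
  ≋⇒∣ {p} p≋r = 1ₚ , ≋-trans (≋-sym p≋r) (≋-sym (*-identityˡ p))

  ∣-trans : ∀ {p r s} → p ∣ r → r ∣ s → p ∣ s
  ∣-trans {p} {r} {s} (c , r≋cp) (d , s≋dr) = d *ₚ c , (begin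
    s               ≈⟨ s≋dr ⟩
    d *ₚ r          ≈⟨ *-congˡ d r≋cp ⟩
    d *ₚ (c *ₚ p)   ≈⟨ *-assoc d c p ⟨
    (d *ₚ c) *ₚ p   ∎)

  ∣-*ˡ : ∀ {p r} s → p ∣ r → p ∣ s *ₚ r
  ∣-*ˡ s h = ∣-trans h (s , ≋-refl)

  ∣-*ʳ : ∀ {p r} s → p ∣ r → p ∣ r *ₚ s
  ∣-*ʳ {r = r} s h = ∣-trans h (s , *-comm r s)

  ∣-+ : ∀ {p r s} → p ∣ r → p ∣ s → p ∣ r +ₚ s
  ∣-+ {p} {r} {s} (c , r≋) (d , s≋) = c +ₚ d , ≋-trans (+-cong r≋ s≋) (≋-sym (*-distribʳ p c d))

  ∣-neg : ∀ {p r} → p ∣ r → p ∣ -ₚ r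
  ∣-neg {p} {r} (c , r≋) = -ₚ c , ≋-trans (neg-cong r≋) (PS.solve 2 (λ c p → PS.:- (c PS.:* p) PS.:= (PS.:- c) PS.:* p) P.refl c p)

  ∣-resp : ∀ {p r s} → r ≋ s → p ∣ r → p ∣ s
  ∣-resp e (c , r≋) = c , ≋-trans (≋-sym e) r≋

  X-+ : ∀ i j → X (i ℕ.+ j) ≋ X i *ₚ q ^ j +ₚ X j
  X-+ i j = ≋-trans (P.+-congʳ (^-homo-* q i j))
    (PS.solve 2 (λ x y → x PS.:* y PS.:- PS.con (+ 1) PS.:= (x PS.:- PS.con (+ 1)) PS.:* y PS.:+ (y PS.:- PS.con (+ 1))) P.refl (q ^ i) (q ^ j))

  X-0 : X 0 ≋ 0ₚ
  X-0 = P.-‿inverseʳ 1ₚ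

  X-∣ : ∀ {d i} → d ℕ.∣ i → X d ∣ X i
  X-∣ {d} (ℕ.divides k refl) = go k
    where
    go : ∀ k → X d ∣ X (k ℕ.* d)
    go zero    = [] , X-0
    go (suc k) = ∣-resp (≋-sym (X-+ d (k ℕ.* d))) (∣-+ (∣-*ʳ (q ^ (k ℕ.* d)) ∣-refl) (go k))

  -- From the Bézout equation, q^(xi) - 1 = (q^g - 1) + (q^g - 1)(q^(yj) - 1) + (q^(yj) - 1). The
  -- factor f is carried along because coprimality is a statement about multiples of f.
  X-combination : ∀ {A f i j g x y} → A ∣ f *ₚ X i → A ∣ f *ₚ X j → g ℕ.+ y ℕ.* j ≡ x ℕ.* i → A ∣ f *ₚ X g
  X-combination {A} {f} {i} {j} {g} {x} {y} hi hj eq = ∣-resp (begin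
      f *ₚ X (x ℕ.* i) -ₚ f *ₚ X (y ℕ.* j) -ₚ X g *ₚ (f *ₚ X (y ℕ.* j))
        ≡⟨ cong (λ k → f *ₚ X k -ₚ f *ₚ X (y ℕ.* j) -ₚ X g *ₚ (f *ₚ X (y ℕ.* j))) (sym eq) ⟩
      f *ₚ X (g ℕ.+ y ℕ.* j) -ₚ f *ₚ X (y ℕ.* j) -ₚ X g *ₚ (f *ₚ X (y ℕ.* j))
        ≈⟨ P.+-congʳ (P.+-congʳ (*-congˡ f (X-+ g (y ℕ.* j)))) ⟩
      f *ₚ (X g *ₚ q ^ (y ℕ.* j) +ₚ X (y ℕ.* j)) -ₚ f *ₚ X (y ℕ.* j) -ₚ X g *ₚ (f *ₚ X (y ℕ.* j))
        ≈⟨ PS.solve 3 (λ f x z → let o = PS.con (+ 1) in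
             f PS.:* (x PS.:* z PS.:+ (z PS.:- o)) PS.:- f PS.:* (z PS.:- o) PS.:- x PS.:* (f PS.:* (z PS.:- o)) PS.:= f PS.:* x) P.refl f (X g) (q ^ (y ℕ.* j)) ⟩
      f *ₚ X g ∎)
    (∣-+ (∣-+ (multiple x hi) (∣-neg (multiple y hj))) (∣-neg (∣-*ˡ (X g) (multiple y hj))))
    where
    multiple : ∀ {k} z → A ∣ f *ₚ X k → A ∣ f *ₚ X (z ℕ.* k)
    multiple {k} z h with X-∣ {k} {z ℕ.* k} (ℕ.divides z refl)
    ... | c , eq = ∣-resp (≋-trans (PS.solve 3 (λ c f x → c PS.:* (f PS.:* x) PS.:= f PS.:* (c PS.:* x)) P.refl c f (X k)) (*-congˡ f (≋-sym eq))) (∣-*ˡ c h)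

  X-gcd : ∀ {A f} i j → A ∣ f *ₚ X i → A ∣ f *ₚ X j → A ∣ f *ₚ X (ℕ.gcd i j)
  X-gcd {A} {f} i j hi hj with ℕ.Bézout.identity (ℕ.gcd-GCD i j)
  ... | ℕ.Bézout.+- x y eq = X-combination {A} {f} {i} {j} {ℕ.gcd i j} {x} {y} hi hj eq
  ... | ℕ.Bézout.-+ x y eq = X-combination {A} {f} {j} {i} {ℕ.gcd i j} {y} {x} hj hi eq

  product : List ℕ → Poly
  product ds = prodₚ (map φ ds)

  coprime-product : ∀ {A} ds → All (λ d → Coprime A (φ d)) ds → Coprime A (product ds)
  coprime-product []       []       = coprime-1
  coprime-product (d ∷ ds) (c ∷ cs) = coprime-* c (coprime-product ds cs)

  product-∣ : ∀ {f} ds → AllPairs (λ a b → Coprime (φ a) (φ b)) ds → All (λ d → φ d ∣ f) ds → product ds ∣ f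
  product-∣ {f} []       _        _        = f , ≋-sym (≋-trans (*-comm f 1ₚ) (*-identityˡ f))
  product-∣ {f} (d ∷ ds) (c ∷ cs) (h ∷ hs) with product-∣ ds cs hs
  ... | g , f≋gP with coprime-product ds c g (∣-resp f≋gP h)
  ...   | k , g≋kφ = k , (begin
    f                             ≈⟨ f≋gP ⟩
    g *ₚ product ds               ≈⟨ *-congʳ (product ds) g≋kφ ⟩
    k *ₚ φ d *ₚ product ds        ≈⟨ *-assoc k (φ d) (product ds) ⟩
    k *ₚ (φ d *ₚ product ds)      ∎)

  member-∣ : ∀ {d ds} → d ∈ ds → φ d ∣ product ds
  member-∣ {d} {d ∷ ds} (here refl) = ∣-*ʳ (product ds) ∣-refl
  member-∣ {d} {e ∷ ds} (there h)   = ∣-*ˡ (φ e) (member-∣ h)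

  properDivisors-complete : ∀ {n d} → ProperDivisor n d → d ∈ properDivisors n
  properDivisors-complete {suc n} {suc d} (_ , s≤s d<n , d∣n) = ∈-filter⁺ (λ d → d ℕ.∣? suc n) (∈-map⁺ suc (∈-upTo⁺ d<n)) d∣n

  properDivisors-distinct : ∀ n → AllPairs _≢_ (properDivisors n)
  properDivisors-distinct n = Unique.filter⁺ (λ d → d ℕ.∣? n) (Unique.map⁺ ℕ.suc-injective (Unique.upTo⁺ (n ℕ.∸ 1)))

  pairs : ∀ {Q : ℕ → Set} {R S : ℕ → ℕ → Set} → (∀ {a b} → Q a → Q b → R a b → S a b) → ∀ {xs} → All Q xs → AllPairs R xs → AllPairs S xs
  pairs f []       []       = []
  pairs f (x ∷ xs) (r ∷ rs) = All.zipWith (λ { (y , r) → f x y r }) (xs , r) ∷ pairs f xs rs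

  Factorised : ℕ → Set
  Factorised n = φ n *ₚ properProduct n ≋ X n × Monic (φ n)

  -- The factorisations up to N give coprimality up to N, and this gives the factorisation for N +
  -- 1.
  module Below (N : ℕ) (factorised : ∀ m → 1 ≤ m → m ≤ N → Factorised m) where

    φ∣X : ∀ {d} → 1 ≤ d → d ≤ N → φ d ∣ X d
    φ∣X {d} 1≤d d≤N = properProduct d , ≋-trans (≋-sym (proj₁ (factorised d 1≤d d≤N))) (*-comm (φ d) _)

    φ-coprime-cofactor : ∀ {d i B} → φ d *ₚ B ≋ X (suc i) → Coprime (φ d) B
    φ-coprime-cofactor {i = i} = factors-coprime i

    Pairwise : ℕ → Set
    Pairwise a = 1 ≤ a → a ≤ N → ∀ b → 1 ≤ b → b ≤ N → a ≢ b → Coprime (φ a) (φ b)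

    -- q^g - 1 is the product of the pairwise coprime `φ e` over e ∣ g, and each such e is a proper
    -- divisor of d.
    X-∣-properProduct : ∀ {g d} → (∀ {a} → a < d → Pairwise a) → d ≤ N → ProperDivisor d g → X g ∣ properProduct d
    X-∣-properProduct {g} {d} pairwise d≤N (1≤g , g<d , g∣d) = ∣-trans (≋⇒∣ (≋-sym (proj₁ (factorised g 1≤g (ℕ.<⇒≤ (ℕ.<-≤-trans g<d d≤N))))))
      (product-∣ (g ∷ properDivisors g)
        (All.map (λ { {e} (1≤e , e<g , _) → coprime (1≤g , g<d) (1≤e , ℕ.<-trans e<g g<d) (ℕ.>⇒≢ e<g) }) (properDivisors-sound g)
          ∷ pairs coprime (All.map (λ { (1≤e , e<g , _) → 1≤e , ℕ.<-trans e<g g<d }) (properDivisors-sound g)) (properDivisors-distinct g))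
        (member-∣ (properDivisors-complete (1≤g , g<d , g∣d))
          ∷ All.map (λ { {e} (1≤e , e<g , e∣g) → member-∣ (properDivisors-complete (1≤e , ℕ.<-trans e<g g<d , ℕ.∣-trans e∣g g∣d)) }) (properDivisors-sound g)))
      where
      coprime : ∀ {a b} → 1 ≤ a × a < d → 1 ≤ b × b < d → a ≢ b → Coprime (φ a) (φ b)
      coprime (1≤a , a<d) (1≤b , b<d) a≢b = pairwise a<d 1≤a (ℕ.<⇒≤ (ℕ.<-≤-trans a<d d≤N)) _ 1≤b (ℕ.<⇒≤ (ℕ.<-≤-trans b<d d≤N)) a≢b

    -- If `φ d` divides f (q^i - 1), it also divides f (q^g - 1) for g = gcd(d, i). As g is a proper
    -- divisor of d, q^g - 1 divides the cofactor of `φ d` in q^d - 1, which is coprime with `φ d`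
    -- by squarefreeness.
    coprime-X′ : ∀ {d i} → (∀ {a} → a < d → Pairwise a) → 1 ≤ d → d ≤ N → ¬ (d ℕ.∣ i) → Coprime (φ d) (X i)
    coprime-X′ {suc d} {i} pairwise 1≤d d≤N d∤i f h = coprime-divisor (X-∣-properProduct pairwise d≤N proper)
        (φ-coprime-cofactor {suc d} {d} (proj₁ (factorised (suc d) 1≤d d≤N))) f (X-gcd {f = f} (suc d) i (∣-*ˡ f (φ∣X 1≤d d≤N)) h)
      where
      g∣d = ℕ.gcd[m,n]∣m (suc d) i
      proper : ProperDivisor (suc d) (ℕ.gcd (suc d) i)
      proper = ℕ.n≢0⇒n>0 (λ g≡0 → ℕ.1+n≢0 (ℕ.gcd[m,n]≡0⇒m≡0 {suc d} {i} g≡0)) ,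
        ℕ.≤∧≢⇒< (ℕ.∣⇒≤ g∣d) (λ g≡d → d∤i (subst (ℕ._∣ i) g≡d (ℕ.gcd[m,n]∣n (suc d) i))) , g∣d

    -- If a ∤ b, then `φ b` divides q^b - 1, with which `φ a` is coprime. If a ∣ b, then `φ a` and
    -- `φ b` are complementary parts of the squarefree q^b - 1.
    pairwise : ∀ a → Pairwise a
    pairwise = <-rec Pairwise step
      where
      step : ∀ a → (∀ {b} → b < a → Pairwise b) → Pairwise a
      step a ih 1≤a a≤N b 1≤b b≤N a≢b with a ℕ.∣? b
      ... | no a∤b = coprime-divisor (φ∣X 1≤b b≤N) (coprime-X′ ih 1≤a a≤N a∤b)
      step a ih 1≤a a≤N (suc b) 1≤b b≤N a≢b | yes a∣b with member-∣ (properDivisors-complete (1≤a , ℕ.≤∧≢⇒< (ℕ.∣⇒≤ a∣b) a≢b , a∣b))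
      ...   | c , P≋cφ = coprime-divisor {t = c *ₚ φ (suc b)} (c , ≋-refl) (φ-coprime-cofactor {a} {b} (begin
        φ a *ₚ (c *ₚ φ (suc b))     ≈⟨ PS.solve 3 (λ x c y → x PS.:* (c PS.:* y) PS.:= y PS.:* (c PS.:* x)) P.refl (φ a) c (φ (suc b)) ⟩
        φ (suc b) *ₚ (c *ₚ φ a)     ≈⟨ *-congˡ (φ (suc b)) P≋cφ ⟨
        φ (suc b) *ₚ properProduct (suc b) ≈⟨ proj₁ (factorised (suc b) 1≤b b≤N) ⟩
        X (suc b)                   ∎))

    coprime-X : ∀ {d i} → 1 ≤ d → d ≤ N → ¬ (d ℕ.∣ i) → Coprime (φ d) (X i)
    coprime-X = coprime-X′ (λ {a} _ → pairwise a)

    next : Factorised (suc N)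
    next = eq , monic-quotient eq monic (monic-X N)
      where
      sound = properDivisors-sound (suc N)
      monic-product : ∀ {ds} → All (λ d → Monic (φ d)) ds → Monic (product ds)
      monic-product []       = monic-1
      monic-product (m ∷ ms) = monic-* m (monic-product ms)
      monic : Monic (properProduct (suc N))
      monic = monic-product (All.map (λ { {d} (1≤d , s≤s d≤N , _) → proj₂ (factorised d 1≤d d≤N) }) sound)
      divides : properProduct (suc N) ∣ X (suc N)
      divides = product-∣ (properDivisors (suc N))
        (pairs (λ { {a} {b} (1≤a , s≤s a≤N , _) (1≤b , s≤s b≤N , _) a≢b → pairwise a 1≤a a≤N b 1≤b b≤N a≢b }) sound (properDivisors-distinct (suc N)))
        (All.map (λ { {d} (1≤d , s≤s d≤N , d∣n) → ∣-trans (φ∣X 1≤d d≤N) (X-∣ d∣n) }) sound)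
      eq = φ-exact N monic divides

  factorised : ∀ n → 1 ≤ n → Factorised n
  factorised = <-rec (λ n → 1 ≤ n → Factorised n) step
    where
    step : ∀ n → (∀ {m} → m < n → 1 ≤ m → Factorised m) → 1 ≤ n → Factorised n
    step (suc n) ih _ = Below.next n (λ m 1≤m m≤n → ih (s≤s m≤n) 1≤m)

-- Roots modulo p by counting cycles of length three

module CycleCounting where
  open import Defs
  open import Data.Integer.DivMod using (_%ℕ_; _/ℕ_; a≡a%ℕn+[a/ℕn]*n; n%ℕd<d)
  open import Data.Integer.Divisibility.Signed using (_∣_; divides; ∣m∣n⇒∣m+n; ∣n⇒∣m*n; ∣m⇒∣-m; ∣⇒∣ᵤ)
  open ≡ hiding ([_])
  open NaturalSums using (sumℕ; skip; sumℕ-skip; sumℕ-cong)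
  open import Data.Nat.Primality using (Prime)
  open import Data.Nat.Coprimality using (Coprime; coprime-Bézout)
  import Data.Nat.Coprimality as Coprimality
  open import Data.Nat.GCD using (module Bézout)
  open import Data.Nat.Base using (NonZero)

  skip-≡ : ∀ i f → skip i f i ≡ 0
  skip-≡ i f with i ℕ.≟ i
  ... | yes _  = refl
  ... | no i≢i = ⊥-elim (i≢i refl)

  skip-≢ : ∀ {i j} f → i ≢ j → skip i f j ≡ f j
  skip-≢ {i} {j} f i≢j with i ℕ.≟ j
  ... | yes i≡j = ⊥-elim (i≢j i≡j)
  ... | no _    = refl

  skip-member : ∀ i f {j} → skip i f j ≡ 1 → i ≢ j × f j ≡ 1
  skip-member i f {j} h with i ℕ.≟ j
  skip-member i f {j} () | yes _
  ... | no i≢j = i≢j , h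

  sumℕ-witness : ∀ f n {k} → sumℕ f n ≡ suc k → ∃ λ i → i < n × f i ≢ 0
  sumℕ-witness f (suc n) eq with f n in fn
  ... | suc _ = n , ℕ.≤-refl , λ fn≡0 → ℕ.0≢1+n (trans (sym fn≡0) fn)
  ... | zero with sumℕ-witness f n (trans (sym (ℕ.+-identityʳ _)) eq)
  ...   | i , i<n , fi = i , ℕ.m<n⇒m<1+n i<n , fi

  -- A fixed-point-free map of order 3 permutes the set with indicator f in cycles of length 3.
  3∣orbits : ∀ (σ : ℕ → ℕ) p fuel f → sumℕ f p ≤ fuel → (∀ y → f y ≡ 0 ⊎ f y ≡ 1) →
    (∀ y → y < p → f y ≡ 1 → σ y < p × f (σ y) ≡ 1) →
    (∀ y → y < p → f y ≡ 1 → σ (σ (σ y)) ≡ y) →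
    (∀ y → y < p → f y ≡ 1 → σ y ≢ y) → 3 ℕ.∣ sumℕ f p
  3∣orbits σ p fuel f bound bits closed order free with sumℕ f p in total
  ... | zero = 3 ℕ.∣0
  3∣orbits σ p (suc fuel) f bound bits closed order free | suc k with sumℕ-witness f p total
  ... | x , x<p , fx≢0 = subst (3 ℕ.∣_) (sym total₃) (ℕ.∣m∣n⇒∣m+n (ℕ.∣-refl {3}) rest)
    where
    member : ∀ {z} → f z ≢ 0 → f z ≡ 1
    member {z} fz≢0 with bits z
    ... | inj₁ e = ⊥-elim (fz≢0 e)
    ... | inj₂ e = e
    fx = member fx≢0
    y = σ x
    y<p = proj₁ (closed x x<p fx)
    fy = proj₂ (closed x x<p fx)
    z = σ y
    z<p = proj₁ (closed y y<p fy)
    fz = proj₂ (closed y y<p fy)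
    x≢y : x ≢ y
    x≢y e = free x x<p fx (sym e)
    y≢z : y ≢ z
    y≢z e = free y y<p fy (sym e)
    x≢z : x ≢ z
    x≢z e = free z z<p fz (trans (order x x<p fx) e)
    f₁ = skip x f
    f₂ = skip y f₁
    f₃ = skip z f₂
    total₃ : suc k ≡ 3 ℕ.+ sumℕ f₃ p
    total₃ = trans (sym total) (trans (sumℕ-skip p f x<p) (cong₂ ℕ._+_ fx
      (trans (sumℕ-skip p f₁ y<p) (cong₂ ℕ._+_ (trans (skip-≢ f x≢y) fy)
        (trans (sumℕ-skip p f₂ z<p) (cong (λ v → v ℕ.+ sumℕ f₃ p) (trans (skip-≢ f₁ y≢z) (trans (skip-≢ f x≢z) fz))))))))
    out : ∀ {w} → f₃ w ≡ 1 → (z ≢ w) × (y ≢ w) × (x ≢ w) × f w ≡ 1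
    out h with skip-member z f₂ h
    ... | z≢w , h₂ with skip-member y f₁ h₂
    ...   | y≢w , h₁ with skip-member x f h₁
    ...     | x≢w , fw = z≢w , y≢w , x≢w , fw
    bits₃ : ∀ i {g} → (∀ w → g w ≡ 0 ⊎ g w ≡ 1) → ∀ w → skip i g w ≡ 0 ⊎ skip i g w ≡ 1
    bits₃ i b w with i ℕ.≟ w
    ... | yes _ = inj₁ refl
    ... | no _  = b w
    -- σ is injective on the set because its cube is the identity there; so a point outside the
    -- cycle x, y, z is not mapped into it.
    closed₃ : ∀ w → w < p → f₃ w ≡ 1 → σ w < p × f₃ (σ w) ≡ 1
    closed₃ w w<p h with out h
    ... | z≢w , y≢w , x≢w , fw = proj₁ (closed w w<p fw) ,
      trans (skip-≢ f₂ λ z≡σw → y≢w (back y<p fy z≡σw)) (trans (skip-≢ f₁ λ y≡σw → x≢w (back x<p fx y≡σw))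
        (trans (skip-≢ f λ x≡σw → z≢w (back z<p fz (trans (order x x<p fx) x≡σw))) (proj₂ (closed w w<p fw))))
      where
      back : ∀ {v} → v < p → f v ≡ 1 → σ v ≡ σ w → v ≡ w
      back v<p fv e = trans (sym (order _ v<p fv)) (trans (cong (λ t → σ (σ t)) e) (order w w<p fw))
    rest : 3 ℕ.∣ sumℕ f₃ p
    rest = 3∣orbits σ p fuel f₃ (ℕ.≤-pred (ℕ.≤-trans (s≤s (ℕ.m≤n+m _ 2)) (subst (ℕ._≤ suc fuel) total₃ bound))) (bits₃ z (bits₃ y (bits₃ x bits))) closed₃
      (λ w w<p h → order w w<p (proj₂ (proj₂ (proj₂ (out h))))) (λ w w<p h → free w w<p (proj₂ (proj₂ (proj₂ (out h)))))

  module Residues (p : ℕ) .{{_ : NonZero p}} where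

    reduce-∣ : ∀ z → + p ∣ z ℤ.- + (z %ℕ p)
    reduce-∣ z = divides (z /ℕ p) (trans (cong (λ w → w ℤ.- + (z %ℕ p)) (a≡a%ℕn+[a/ℕn]*n z p)) (lemma (+ (z %ℕ p)) ((z /ℕ p) ℤ.* + p)))
      where
      lemma : ∀ a b → (a ℤ.+ b) ℤ.- a ≡ b
      lemma = solve-∀

    small-multiple : ∀ {z} → z < p → + p ∣ + z → z ≡ 0
    small-multiple {zero}  _   _ = refl
    small-multiple {suc z} z<p h = ⊥-elim (ℕ.<⇒≱ z<p (ℕ.∣⇒≤ (∣⇒∣ᵤ h)))

    ordered-representative-unique : ∀ {y z} → z ≤ y → y < p → + p ∣ + y ℤ.- + z → y ≡ z
    ordered-representative-unique {y} {z} z≤y y<p h = ℕ.≤-antisym (ℕ.m∸n≡0⇒m≤n (small-multiple (ℕ.≤-<-trans (ℕ.m∸n≤m y z) y<p)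
      (subst (+ p ∣_) (trans (ℤ.m-n≡m⊖n y z) (ℤ.⊖-≥ z≤y)) h))) z≤y

    representative-unique : ∀ {y z} → y < p → z < p → + p ∣ + y ℤ.- + z → y ≡ z
    representative-unique {y} {z} y<p z<p h with ℕ.≤-total z y
    ... | inj₁ z≤y = ordered-representative-unique z≤y y<p h
    ... | inj₂ y≤z = sym (ordered-representative-unique y≤z z<p (subst (+ p ∣_) (lemma (+ y) (+ z)) (∣m⇒∣-m h)))
      where
      lemma : ∀ y z → ℤ.- (y ℤ.- z) ≡ z ℤ.- y
      lemma = solve-∀

    combine : ∀ {a b} c d {z} → + p ∣ a → + p ∣ b → z ≡ c ℤ.* a ℤ.+ d ℤ.* b → + p ∣ z
    combine c d ha hb refl = ∣m∣n⇒∣m+n (∣n⇒∣m*n c ha) (∣n⇒∣m*n d hb)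

    above : ℕ → ℕ → ℕ
    above m y with m ℕ.≤? y
    ... | yes _ = 1
    ... | no _  = 0

    above-bits : ∀ m y → above m y ≡ 0 ⊎ above m y ≡ 1
    above-bits m y with m ℕ.≤? y
    ... | yes _ = inj₂ refl
    ... | no _  = inj₁ refl

    above-≥ : ∀ {m y} → m ≤ y → above m y ≡ 1
    above-≥ {m} {y} m≤y with m ℕ.≤? y
    ... | yes _   = refl
    ... | no ¬m≤y = ⊥-elim (¬m≤y m≤y)

    above-member : ∀ {m y} → above m y ≡ 1 → m ≤ y
    above-member {m} {y} h with m ℕ.≤? y
    above-member {m} {y} h  | yes m≤y = m≤y
    above-member {m} {y} () | no _

    sum-above : ∀ m k → sumℕ (above m) (m ℕ.+ k) ≡ k
    sum-above m zero    = trans (cong (sumℕ (above m)) (ℕ.+-identityʳ m)) (below m ℕ.≤-refl)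
      where
      below : ∀ k → k ≤ m → sumℕ (above m) k ≡ 0
      below zero    _   = refl
      below (suc k) k<m = cong₂ ℕ._+_ (below k (ℕ.<⇒≤ k<m)) (zero′ k<m)
        where
        zero′ : k < m → above m k ≡ 0
        zero′ k<m with m ℕ.≤? k
        ... | yes m≤k = ⊥-elim (ℕ.<⇒≱ k<m m≤k)
        ... | no _    = refl
    sum-above m (suc k) = trans (cong (sumℕ (above m)) (ℕ.+-suc m k)) (trans (cong₂ ℕ._+_ (sum-above m k) (above-≥ (ℕ.m≤m+n m k))) (ℕ.+-comm k 1))

    -- Multiplication by a primitive cube root of unity w acts freely on the nonzero residues.
    no-root : ∀ k t → p ≡ 2 ℕ.+ 3 ℕ.* k → p ≡ 1 ℕ.+ 2 ℕ.* t → ∀ x → ¬ (+ p ∣ x ℤ.* x ℤ.+ + 3)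
    no-root k t p≡3k+2 p≡2t+1 x h = 3∤1+3k (subst (3 ℕ.∣_) (trans (cong (sumℕ (above 1)) p≡3k+2) (sum-above 1 (suc (3 ℕ.* k))))
        (3∣orbits σ p _ (above 1) ℕ.≤-refl (above-bits 1) closed order free))
      where
      3∤1+3k : ¬ (3 ℕ.∣ suc (3 ℕ.* k))
      3∤1+3k h with ℕ.∣1⇒≡1 (ℕ.∣m+n∣m⇒∣n (subst (3 ℕ.∣_) (ℕ.+-comm 1 (3 ℕ.* k)) h) (ℕ.m∣m*n k))
      ... | ()
      P T w : ℤ
      P = + p
      T = + t
      -- Since 2(t + 1) = p + 1, this is (-1 + x)/2 modulo p with x² = -3, a cube root of unity.
      w = (x ℤ.- 1ℤ) ℤ.* (T ℤ.+ 1ℤ)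
      P≡ : P ≡ 1ℤ ℤ.+ + 2 ℤ.* T
      P≡ = trans (cong +_ p≡2t+1) (cong (λ z → 1ℤ ℤ.+ z) (ℤ.pos-* 2 t))
      P∣P : P ∣ P
      P∣P = divides 1ℤ (sym (ℤ.*-identityˡ P))
      P≡′ : P ≡ + 2 ℤ.+ + 3 ℤ.* + k
      P≡′ = trans (cong +_ p≡3k+2) (cong (λ z → + 2 ℤ.+ z) (ℤ.pos-* 3 k))
      cyclotomic : P ∣ w ℤ.* w ℤ.+ w ℤ.+ 1ℤ
      cyclotomic = combine ((T ℤ.+ 1ℤ) ℤ.* (T ℤ.+ 1ℤ)) (ℤ.- (w ℤ.+ (+ 2 ℤ.* T ℤ.+ + 3))) h P∣P
        (trans (lemma x T) (cong (λ z → (T ℤ.+ 1ℤ) ℤ.* (T ℤ.+ 1ℤ) ℤ.* (x ℤ.* x ℤ.+ + 3) ℤ.+ ℤ.- (w ℤ.+ (+ 2 ℤ.* T ℤ.+ + 3)) ℤ.* z) (sym P≡)))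
        where
        lemma : ∀ x t → let w = (x ℤ.- 1ℤ) ℤ.* (t ℤ.+ 1ℤ) in
          w ℤ.* w ℤ.+ w ℤ.+ 1ℤ ≡ (t ℤ.+ 1ℤ) ℤ.* (t ℤ.+ 1ℤ) ℤ.* (x ℤ.* x ℤ.+ + 3) ℤ.+ ℤ.- (w ℤ.+ (+ 2 ℤ.* t ℤ.+ + 3)) ℤ.* (1ℤ ℤ.+ + 2 ℤ.* t)
        lemma = solve-∀
      σ : ℕ → ℕ
      σ y = (w ℤ.* + y) %ℕ p
      σ-∣ : ∀ y → P ∣ w ℤ.* + y ℤ.- + σ y
      σ-∣ y = reduce-∣ (w ℤ.* + y)
      closed : ∀ y → y < p → above 1 y ≡ 1 → σ y < p × above 1 (σ y) ≡ 1
      closed y y<p h = n%ℕd<d (w ℤ.* + y) p , above-≥ (ℕ.n≢0⇒n>0 λ σy≡0 → ℕ.<⇒≱ (above-member h) (ℕ.≤-reflexive (small-multiple y<p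
        (combine (+ y) (ℤ.- (w ℤ.+ 1ℤ)) cyclotomic (subst (λ s → P ∣ w ℤ.* + y ℤ.- + s) σy≡0 (σ-∣ y)) (lemma w (+ y))))))
        where
        lemma : ∀ w y → y ≡ y ℤ.* (w ℤ.* w ℤ.+ w ℤ.+ 1ℤ) ℤ.+ ℤ.- (w ℤ.+ 1ℤ) ℤ.* (w ℤ.* y ℤ.- 0ℤ)
        lemma = solve-∀
      order : ∀ y → y < p → above 1 y ≡ 1 → σ (σ (σ y)) ≡ y
      order y y<p _ = representative-unique (n%ℕd<d (w ℤ.* + σ (σ y)) p) y<p
        (combine 1ℤ ((w ℤ.- 1ℤ) ℤ.* + y) (combine 1ℤ 1ℤ (combine (ℤ.- (w ℤ.* w)) (ℤ.- w) (σ-∣ y) (σ-∣ (σ y)) refl) (∣m⇒∣-m (σ-∣ (σ (σ y)))) refl) cyclotomic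
          (lemma w (+ y) (+ σ y) (+ σ (σ y)) (+ σ (σ (σ y)))))
        where
        lemma : ∀ w y a b c → c ℤ.- y ≡ 1ℤ ℤ.* (1ℤ ℤ.* (ℤ.- (w ℤ.* w) ℤ.* (w ℤ.* y ℤ.- a) ℤ.+ ℤ.- w ℤ.* (w ℤ.* a ℤ.- b)) ℤ.+ 1ℤ ℤ.* (ℤ.- (w ℤ.* b ℤ.- c)))
          ℤ.+ (w ℤ.- 1ℤ) ℤ.* y ℤ.* (w ℤ.* w ℤ.+ w ℤ.+ 1ℤ)
        lemma = solve-∀
      free : ∀ y → y < p → above 1 y ≡ 1 → σ y ≢ y
      free y y<p h σy≡y = ℕ.<⇒≱ (above-member h) (ℕ.≤-reflexive (small-multiple y<p
        (combine 1ℤ (ℤ.- + y) (combine (K ℤ.* + y) (ℤ.- (K ℤ.* (w ℤ.+ + 2))) cyclotomic (subst (λ s → P ∣ w ℤ.* + y ℤ.- + s) σy≡y (σ-∣ y)) refl) P∣P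
          (trans (lemma w (+ y) (+ k)) (cong (λ z → 1ℤ ℤ.* (K ℤ.* + y ℤ.* (w ℤ.* w ℤ.+ w ℤ.+ 1ℤ) ℤ.+ ℤ.- (K ℤ.* (w ℤ.+ + 2)) ℤ.* (w ℤ.* + y ℤ.- + y)) ℤ.+ ℤ.- + y ℤ.* z) (sym P≡′))))))
        where
        -- Since 3(k + 1) = p + 1, this is an inverse of 3. A fixed point would have w y = y, hence
        -- 3y = 0 from w² + w + 1 = 0.
        K = + k ℤ.+ 1ℤ
        lemma : ∀ w y k → y ≡ 1ℤ ℤ.* ((k ℤ.+ 1ℤ) ℤ.* y ℤ.* (w ℤ.* w ℤ.+ w ℤ.+ 1ℤ) ℤ.+ ℤ.- ((k ℤ.+ 1ℤ) ℤ.* (w ℤ.+ + 2)) ℤ.* (w ℤ.* y ℤ.- y)) ℤ.+ ℤ.- y ℤ.* (+ 2 ℤ.+ + 3 ℤ.* k)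
        lemma = solve-∀

    inverse : ∀ {z} → Coprime z p → ∃ λ v → + p ∣ + z ℤ.* v ℤ.- 1ℤ
    inverse {z} c with coprime-Bézout c
    ... | Bézout.+- x y eq = + x , divides (+ y) (trans (cong (λ w → w ℤ.- 1ℤ) (trans (sym (ℤ.pos-* z x)) (cong +_ (trans (ℕ.*-comm z x) (sym eq)))))
        (trans (lemma (+ (y ℕ.* p))) (ℤ.pos-* y p)))
      where
      lemma : ∀ a → (1ℤ ℤ.+ a) ℤ.- 1ℤ ≡ a
      lemma = solve-∀
    ... | Bézout.-+ x y eq = ℤ.- + x , divides (ℤ.- + y) (begin
        + z ℤ.* ℤ.- + x ℤ.- 1ℤ      ≡⟨ lemma (+ z) (+ x) ⟩
        ℤ.- (1ℤ ℤ.+ + x ℤ.* + z)    ≡⟨ cong (λ a → ℤ.- (1ℤ ℤ.+ a)) (ℤ.pos-* x z) ⟨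
        ℤ.- + (1 ℕ.+ x ℕ.* z)       ≡⟨ cong (λ a → ℤ.- + a) eq ⟩
        ℤ.- + (y ℕ.* p)             ≡⟨ trans (cong ℤ.-_ (ℤ.pos-* y p)) (ℤ.neg-distribˡ-* (+ y) (+ p)) ⟩
        ℤ.- + y ℤ.* + p             ∎)
      where
      open ≡-Reasoning
      lemma : ∀ z x → z ℤ.* ℤ.- x ℤ.- 1ℤ ≡ ℤ.- (1ℤ ℤ.+ x ℤ.* z)
      lemma = solve-∀

    -- y ↦ 1/(1 − y) has order 3 on the residues other than 0 and 1; its fixed points are the roots of y² − y + 1.
    root : Prime p → ∀ k → p ≡ 4 ℕ.+ 3 ℕ.* k → ¬ (∀ y → ¬ (+ p ∣ y ℤ.* y ℤ.- y ℤ.+ 1ℤ))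
    root prime-p k p≡3k+4 no-roots = 3∤2+3k (subst (3 ℕ.∣_) (trans (cong (sumℕ (above 2)) p≡3k+4) (sum-above 2 (2 ℕ.+ 3 ℕ.* k)))
        (3∣orbits σ p _ (above 2) ℕ.≤-refl (above-bits 2) closed order free))
      where
      3∤2+3k : ¬ (3 ℕ.∣ 2 ℕ.+ 3 ℕ.* k)
      3∤2+3k h with ℕ.∣⇒≤ (ℕ.∣m+n∣m⇒∣n (subst (3 ℕ.∣_) (ℕ.+-comm 2 (3 ℕ.* k)) h) (ℕ.m∣m*n k))
      ... | s≤s (s≤s ())
      P = + p
      1<p : 1 < p
      1<p = subst (1 <_) (sym p≡3k+4) (s≤s (s≤s z≤n))
      -- The value is 0 outside 0 < z < p, which makes `σ` a function on all of ℕ.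
      inverse? : ∀ z → ∃ λ v → 0 < z → z < p → P ∣ + z ℤ.* v ℤ.- 1ℤ
      inverse? zero = 0ℤ , λ ()
      inverse? (suc z) with suc z ℕ.<? p
      ... | yes z<p = proj₁ inv , λ _ _ → proj₂ inv
        where inv = inverse (Coprimality.sym (Coprimality.prime⇒coprime prime-p z<p))
      ... | no z≮p = 0ℤ , λ _ z<p → ⊥-elim (z≮p z<p)
      σ : ℕ → ℕ
      -- p + 1 - y represents 1 - y, and it lies strictly between 0 and p when 2 ≤ y < p.
      σ y = proj₁ (inverse? (suc p ℕ.∸ y)) %ℕ p
      σ-∣ : ∀ {y} → 2 ≤ y → y < p → P ∣ (1ℤ ℤ.- + y) ℤ.* + σ y ℤ.- 1ℤ
      σ-∣ {y} 2≤y y<p = combine 1ℤ (ℤ.- (1ℤ ℤ.- + y)) (combine 1ℤ (ℤ.- v) (proj₂ (inverse? z) 0<z z<p) (divides 1ℤ (sym (ℤ.*-identityˡ P))) refl) (reduce-∣ v)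
          (trans (lemma (+ y) P v (+ (v %ℕ p))) (cong (λ a → 1ℤ ℤ.* (1ℤ ℤ.* (a ℤ.* v ℤ.- 1ℤ) ℤ.+ ℤ.- v ℤ.* P) ℤ.+ ℤ.- (1ℤ ℤ.- + y) ℤ.* (v ℤ.- + (v %ℕ p))) (sym z≡)))
        where
        z = suc p ℕ.∸ y
        v = proj₁ (inverse? z)
        0<z : 0 < z
        0<z = ℕ.m<n⇒0<n∸m (ℕ.m<n⇒m<1+n y<p)
        z<p : z < p
        z<p = ℕ.≤-<-trans (ℕ.∸-monoʳ-≤ (suc p) 2≤y) (ℕ.∸-monoʳ-< {p} {1} {0} (s≤s z≤n) (ℕ.<⇒≤ 1<p))
        z≡ : + z ≡ (1ℤ ℤ.+ P) ℤ.- + y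
        z≡ = trans (sym (ℤ.⊖-≥ (ℕ.<⇒≤ (ℕ.m<n⇒m<1+n y<p)))) (sym (ℤ.m-n≡m⊖n (suc p) y))
        lemma : ∀ y P v s → (1ℤ ℤ.- y) ℤ.* s ℤ.- 1ℤ ≡ 1ℤ ℤ.* (1ℤ ℤ.* (((1ℤ ℤ.+ P) ℤ.- y) ℤ.* v ℤ.- 1ℤ) ℤ.+ ℤ.- v ℤ.* P) ℤ.+ ℤ.- (1ℤ ℤ.- y) ℤ.* (v ℤ.- s)
        lemma = solve-∀
      P∤1 : ¬ (P ∣ 1ℤ)
      P∤1 h with small-multiple 1<p h
      ... | ()
      closed′ : ∀ {y} → 2 ≤ y → y < p → σ y < p × 2 ≤ σ y
      closed′ {y} 2≤y y<p = n%ℕd<d (proj₁ (inverse? (suc p ℕ.∸ y))) p , big (σ y) refl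
        where
        big : ∀ s → σ y ≡ s → 2 ≤ s
        big 0 e = ⊥-elim (P∤1 (subst (P ∣_) (lemma (+ y)) (∣m⇒∣-m (subst (λ s → P ∣ (1ℤ ℤ.- + y) ℤ.* + s ℤ.- 1ℤ) e (σ-∣ 2≤y y<p)))))
          where
          lemma : ∀ y → ℤ.- ((1ℤ ℤ.- y) ℤ.* 0ℤ ℤ.- 1ℤ) ≡ 1ℤ
          lemma = solve-∀
        big 1 e = ⊥-elim (ℕ.<⇒≱ 2≤y (ℕ.≤-trans (ℕ.≤-reflexive (small-multiple y<p
            (subst (P ∣_) (lemma (+ y)) (∣m⇒∣-m (subst (λ s → P ∣ (1ℤ ℤ.- + y) ℤ.* + s ℤ.- 1ℤ) e (σ-∣ 2≤y y<p)))))) z≤n))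
          where
          lemma : ∀ y → ℤ.- ((1ℤ ℤ.- y) ℤ.* 1ℤ ℤ.- 1ℤ) ≡ y
          lemma = solve-∀
        big (suc (suc s)) _ = s≤s (s≤s z≤n)
      closed : ∀ y → y < p → above 2 y ≡ 1 → σ y < p × above 2 (σ y) ≡ 1
      closed y y<p h = proj₁ (closed′ (above-member h) y<p) , above-≥ (proj₂ (closed′ (above-member h) y<p))
      order : ∀ y → y < p → above 2 y ≡ 1 → σ (σ (σ y)) ≡ y
      order y y<p h = representative-unique (proj₁ (closed′ (proj₂ c₂) (proj₁ c₂))) y<p
          (combine (+ y) (ℤ.- e) (σ-∣ (proj₂ c₂) (proj₁ c₂)) W-∣ (lemma₂ (+ y) c e))
        where
        2≤y = above-member h
        c₁ = closed′ 2≤y y<p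
        c₂ = closed′ (proj₂ c₁) (proj₁ c₁)
        b = + σ y
        c = + σ (σ y)
        e = + σ (σ (σ y))
        -- The square of `σ` is y ↦ 1 - 1/y, so 1 - c is the inverse of y.
        W-∣ : P ∣ + y ℤ.* (1ℤ ℤ.- c) ℤ.- 1ℤ
        W-∣ = combine ((1ℤ ℤ.- + y) ℤ.* (c ℤ.- 1ℤ) ℤ.- (+ y ℤ.* (1ℤ ℤ.- c) ℤ.- 1ℤ)) (1ℤ ℤ.- + y) (σ-∣ 2≤y y<p) (σ-∣ (proj₂ c₁) (proj₁ c₁)) (lemma₁ (+ y) b c)
          where
          lemma₁ : ∀ a b c → a ℤ.* (1ℤ ℤ.- c) ℤ.- 1ℤ ≡ ((1ℤ ℤ.- a) ℤ.* (c ℤ.- 1ℤ) ℤ.- (a ℤ.* (1ℤ ℤ.- c) ℤ.- 1ℤ)) ℤ.* ((1ℤ ℤ.- a) ℤ.* b ℤ.- 1ℤ)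
            ℤ.+ (1ℤ ℤ.- a) ℤ.* ((1ℤ ℤ.- b) ℤ.* c ℤ.- 1ℤ)
          lemma₁ = solve-∀
        lemma₂ : ∀ a c e → e ℤ.- a ≡ a ℤ.* ((1ℤ ℤ.- c) ℤ.* e ℤ.- 1ℤ) ℤ.+ ℤ.- e ℤ.* (a ℤ.* (1ℤ ℤ.- c) ℤ.- 1ℤ)
        lemma₂ = solve-∀
      free : ∀ y → y < p → above 2 y ≡ 1 → σ y ≢ y
      free y y<p h σy≡y = no-roots (+ y) (subst (P ∣_) (lemma (+ y)) (∣m⇒∣-m (subst (λ s → P ∣ (1ℤ ℤ.- + y) ℤ.* + s ℤ.- 1ℤ) σy≡y (σ-∣ (above-member h) y<p))))
        where
        lemma : ∀ y → ℤ.- ((1ℤ ℤ.- y) ℤ.* y ℤ.- 1ℤ) ≡ y ℤ.* y ℤ.- y ℤ.+ 1ℤ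
        lemma = solve-∀

-- The Jacobi symbol (-3/n)

module JacobiSymbol where
  open import Defs
  open import Data.Nat.Base using (n>1⇒nonTrivial)
  open import Data.Nat.Primality using (Prime; _Rough_; rough∧∣⇒prime; 2-rough; ∤⇒rough-suc)
  open import Data.Integer.DivMod using (_%ℕ_; n%ℕd<d)
  open import Data.Integer.Divisibility.Signed using (_∣_; divides; ∣m∣n⇒∣m-n; ∣⇒∣ᵤ)
  open import Data.Bool using (true; false; T)
  open import Data.Bool.ListAction using (any)
  open import Data.Bool.Properties using (T-≡)
  open import Data.List using (upTo)
  open import Data.List.Relation.Unary.Any.Properties using (any⁺; any⁻)
  open import Data.List.Membership.Propositional.Properties using (∈-upTo⁺)
  open import Data.List.Membership.Propositional using (lose; find)
  open import Function.Bundles using (Equivalence)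
  open ≡ hiding ([_])
  open CycleCounting

  -- The character (n/3), which equals (-3/n) for n coprime with 6.
  ψ : ℕ → ℤ
  ψ 0 = 0ℤ
  ψ 1 = 1ℤ
  ψ 2 = -1ℤ
  ψ (suc (suc (suc n))) = ψ n

  ψ-+3* : ∀ k n → ψ (3 ℕ.* k ℕ.+ n) ≡ ψ n
  ψ-+3* zero    n = refl
  ψ-+3* (suc k) n = trans (cong ψ (lemma k n)) (ψ-+3* k n)
    where
    lemma : ∀ k n → 3 ℕ.* suc k ℕ.+ n ≡ 3 ℕ.+ (3 ℕ.* k ℕ.+ n)
    lemma = solveℕ-∀

  ψ-2* : ∀ n → ψ (2 ℕ.* n) ≡ -1ℤ ℤ.* ψ n
  ψ-2* 0 = refl
  ψ-2* 1 = refl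
  ψ-2* 2 = refl
  ψ-2* (suc (suc (suc n))) = trans (cong ψ (lemma n)) (ψ-2* n)
    where
    lemma : ∀ n → 2 ℕ.* (3 ℕ.+ n) ≡ 6 ℕ.+ 2 ℕ.* n
    lemma = solveℕ-∀

  ψ-* : ∀ m n → ψ (m ℕ.* n) ≡ ψ m ℤ.* ψ n
  ψ-* 0 n = refl
  ψ-* 1 n = trans (cong ψ (ℕ.*-identityˡ n)) (sym (ℤ.*-identityˡ (ψ n)))
  ψ-* 2 n = ψ-2* n
  ψ-* (suc (suc (suc m))) n = trans (cong ψ (lemma m n)) (trans (ψ-+3* n (m ℕ.* n)) (ψ-* m n))
    where
    lemma : ∀ m n → (3 ℕ.+ m) ℕ.* n ≡ 3 ℕ.* n ℕ.+ m ℕ.* n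
    lemma = solveℕ-∀

  mod3 : ∀ n → ∃ λ k → n ≡ 3 ℕ.* k ⊎ n ≡ 1 ℕ.+ 3 ℕ.* k ⊎ n ≡ 2 ℕ.+ 3 ℕ.* k
  mod3 0 = 0 , inj₁ refl
  mod3 1 = 0 , inj₂ (inj₁ refl)
  mod3 2 = 0 , inj₂ (inj₂ refl)
  mod3 (suc (suc (suc n))) with mod3 n
  ... | k , inj₁ refl        = suc k , inj₁ (lemma k)
    where
    lemma : ∀ k → 3 ℕ.+ 3 ℕ.* k ≡ 3 ℕ.* suc k
    lemma = solveℕ-∀
  ... | k , inj₂ (inj₁ refl) = suc k , inj₂ (inj₁ (lemma k))
    where
    lemma : ∀ k → 4 ℕ.+ 3 ℕ.* k ≡ 1 ℕ.+ 3 ℕ.* suc k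
    lemma = solveℕ-∀
  ... | k , inj₂ (inj₂ refl) = suc k , inj₂ (inj₂ (lemma k))
    where
    lemma : ∀ k → 5 ℕ.+ 3 ℕ.* k ≡ 2 ℕ.+ 3 ℕ.* suc k
    lemma = solveℕ-∀

  -3ℤ : ℤ
  -3ℤ = ℤ.- (+ 3)

  module Legendre (m t : ℕ) (prime-p : Prime (suc m)) (p≡2t+1 : suc m ≡ 1 ℕ.+ 2 ℕ.* t) (3∤p : ¬ (3 ℕ.∣ suc m)) (1<p : 1 < suc m) where
    private
      p = suc m
    open Residues p

    vanishes⇒∣ : ∀ z → z %ℕ p ≡ 0 → + p ∣ z
    vanishes⇒∣ z e = subst (+ p ∣_) (trans (cong (λ r → z ℤ.- + r) e) (ℤ.+-identityʳ z)) (reduce-∣ z)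

    ∣⇒vanishes : ∀ z → + p ∣ z → z %ℕ p ≡ 0
    ∣⇒vanishes z h = small-multiple (n%ℕd<d z p) (subst (+ p ∣_) (lemma z (+ (z %ℕ p))) (∣m∣n⇒∣m-n h (reduce-∣ z)))
      where
      lemma : ∀ z r → z ℤ.- (z ℤ.- r) ≡ r
      lemma = solve-∀

    p∤3 : ¬ (-3ℤ %ℕ p ≡ 0)
    p∤3 e = cases p refl (ℕ.∣⇒≤ (∣⇒∣ᵤ (vanishes⇒∣ -3ℤ e)))
      where
      cases : ∀ r → p ≡ r → ¬ (r ≤ 3)
      cases 0 () _
      cases 1 e _ = ℕ.<-irrefl (sym e) 1<p
      cases 2 e _ = ℕ.even≢odd 1 t (trans (sym e) p≡2t+1)
      cases 3 e _ = 3∤p (ℕ.∣-reflexive (sym e))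
      cases (suc (suc (suc (suc r)))) _ (s≤s (s≤s (s≤s ())))

    test : ℕ → _
    test x = does (((+ (x ℕ.* x)) ℤ.- -3ℤ) %ℕ p ℕ.≟ 0)

    test-sound : ∀ x → T (test x) → + p ∣ + x ℤ.* + x ℤ.+ + 3
    test-sound x h = subst (λ z → + p ∣ z ℤ.+ + 3) (ℤ.pos-* x x)
      (vanishes⇒∣ (+ (x ℕ.* x) ℤ.- -3ℤ) (ℕ.≡ᵇ⇒≡ (((+ (x ℕ.* x)) ℤ.- -3ℤ) %ℕ p) 0 h))

    test-complete : ∀ x → + p ∣ + x ℤ.* + x ℤ.+ + 3 → T (test x)
    test-complete x h = Equivalence.from T-≡ (dec-true (((+ (x ℕ.* x)) ℤ.- -3ℤ) %ℕ p ℕ.≟ 0)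
      (∣⇒vanishes (+ (x ℕ.* x) ℤ.- -3ℤ) (subst (λ z → + p ∣ z ℤ.+ + 3) (sym (ℤ.pos-* x x)) h)))

    -- A root y of y² - y + 1 gives x = 2y - 1 with x² = -3, since 4(y² - y + 1) = (2y - 1)² + 3.
    residue : ∀ k → p ≡ 1 ℕ.+ 3 ℕ.* k → any test (upTo p) ≡ true
    residue zero    p≡1 = ⊥-elim (ℕ.<-irrefl (sym p≡1) 1<p)
    residue (suc k) p≡ with any test (upTo p) in eq
    ... | true  = refl
    -- `root` only refutes that there are no roots; this suffices, because the outcome of the search
    -- is decided.
    ... | false = ⊥-elim (root prime-p k (trans p≡ (lemma k)) λ y h → subst T eq (any⁺ test (lose (∈-upTo⁺ (n%ℕd<d (+ 2 ℤ.* y ℤ.- 1ℤ) p)) (test-complete ((+ 2 ℤ.* y ℤ.- 1ℤ) %ℕ p) (square y h)))))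
      where
      lemma : ∀ k → 1 ℕ.+ 3 ℕ.* suc k ≡ 4 ℕ.+ 3 ℕ.* k
      lemma = solveℕ-∀
      square : ∀ y → + p ∣ y ℤ.* y ℤ.- y ℤ.+ 1ℤ → let x = + ((+ 2 ℤ.* y ℤ.- 1ℤ) %ℕ p) in + p ∣ x ℤ.* x ℤ.+ + 3
      square y h = combine (+ 4) (ℤ.- (+ 2 ℤ.* y ℤ.- 1ℤ ℤ.+ x)) h (reduce-∣ (+ 2 ℤ.* y ℤ.- 1ℤ)) (identity y x)
        where
        x = + ((+ 2 ℤ.* y ℤ.- 1ℤ) %ℕ p)
        identity : ∀ y x → x ℤ.* x ℤ.+ + 3 ≡ + 4 ℤ.* (y ℤ.* y ℤ.- y ℤ.+ 1ℤ) ℤ.+ ℤ.- (+ 2 ℤ.* y ℤ.- 1ℤ ℤ.+ x) ℤ.* (+ 2 ℤ.* y ℤ.- 1ℤ ℤ.- x)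
        identity = solve-∀

    nonresidue : ∀ k → p ≡ 2 ℕ.+ 3 ℕ.* k → any test (upTo p) ≡ false
    nonresidue k p≡ with any test (upTo p) in eq
    ... | false = refl
    ... | true with find (any⁻ test (upTo p) (Equivalence.from T-≡ eq))
    ...   | x , _ , h = ⊥-elim (no-root k t p≡ p≡2t+1 (+ x) (test-sound x h))

    legendre-ψ : legendre -3ℤ p ≡ ψ p
    legendre-ψ rewrite dec-false (-3ℤ %ℕ p ℕ.≟ 0) p∤3 with mod3 p
    ... | k , inj₁ e        = ⊥-elim (3∤p (ℕ.divides k (trans e (ℕ.*-comm 3 k))))
    ... | k , inj₂ (inj₁ e) rewrite residue k e = sym (trans (cong ψ (trans e (ℕ.+-comm 1 (3 ℕ.* k)))) (ψ-+3* k 1))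
    ... | k , inj₂ (inj₂ e) rewrite nonresidue k e = sym (trans (cong ψ (trans e (ℕ.+-comm 2 (3 ℕ.* k)))) (ψ-+3* k 2))

  -- The roughness of n records that all candidates below d have failed, which later makes the
  -- divisor found a prime. If the fuel runs out, then d has reached n.
  leastDivF-spec : ∀ f d n → 2 ≤ d → d ≤ n → n ≤ d ℕ.+ f → d Rough n →
    let r = leastDivF f d n in r ℕ.∣ n × r Rough n × 2 ≤ r
  leastDivF-spec zero    d n 2≤d d≤n n≤d rough with ℕ.≤-antisym d≤n (ℕ.≤-trans n≤d (ℕ.≤-reflexive (ℕ.+-identityʳ d)))
  ... | refl = ℕ.∣-refl , rough , 2≤d
  leastDivF-spec (suc f) d n 2≤d d≤n n≤d+f rough with d ℕ.∣? n
  ... | yes d∣n = d∣n , rough , 2≤d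
  ... | no d∤n  = leastDivF-spec f (suc d) n (ℕ.m≤n⇒m≤1+n 2≤d) (ℕ.≤∧≢⇒< d≤n (λ { refl → d∤n ℕ.∣-refl }))
    (ℕ.≤-trans n≤d+f (ℕ.≤-reflexive (ℕ.+-suc d f))) (∤⇒rough-suc d∤n rough)

  odd-∣ : ∀ {d n} → ¬ (2 ℕ.∣ n) → d ℕ.∣ n → ∃ λ t → d ≡ 1 ℕ.+ 2 ℕ.* t
  odd-∣ {d} 2∤n d∣n with parity d
    where
    parity : ∀ d → ∃ λ t → d ≡ 2 ℕ.* t ⊎ d ≡ 1 ℕ.+ 2 ℕ.* t
    parity 0 = 0 , inj₁ refl
    parity (suc d) with parity d
    ... | t , inj₁ refl = t , inj₂ refl
    ... | t , inj₂ refl = suc t , inj₁ (lemma t)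
      where
      lemma : ∀ t → 2 ℕ.+ 2 ℕ.* t ≡ 2 ℕ.* suc t
      lemma = solveℕ-∀
  ... | t , inj₁ refl = ⊥-elim (2∤n (ℕ.∣-trans (ℕ.m∣m*n t) d∣n))
  ... | t , inj₂ e    = t , e

  -- `ψ` is completely multiplicative and equals the Legendre symbol at the least prime factor; the
  -- divisors of n are again prime to 2 and 3.
  jacobiF-ψ : ∀ f n → 1 ≤ n → n ≤ f → ¬ (2 ℕ.∣ n) → ¬ (3 ℕ.∣ n) → jacobiF f -3ℤ n ≡ ψ n
  jacobiF-ψ zero    n 1≤n n≤0 _ _ = ⊥-elim (ℕ.<⇒≱ 1≤n n≤0)
  jacobiF-ψ (suc f) n 1≤n n≤f 2∤n 3∤n with n ℕ.≤? 1
  ... | yes n≤1 rewrite dec-true (n ℕ.≤? 1) n≤1 = sym (cong ψ (ℕ.≤-antisym n≤1 1≤n))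
  ... | no n≰1 rewrite dec-false (n ℕ.≤? 1) n≰1 with leastPrimeDiv n | leastDivF-spec n 2 n (s≤s (s≤s z≤n)) (ℕ.≰⇒> n≰1) (ℕ.m≤n+m n 2) 2-rough
  ...   | zero  | _ , _ , ()
  ...   | suc m | p∣n , rough , 2≤p = trans (cong₂ ℤ._*_ (legendre-ψ) (jacobiF-ψ f (n ℕ./ suc m)
          (ℕ.n≢0⇒n>0 λ e → ℕ.<⇒≢ 1≤n (sym (trans (sym n≡) (trans (cong (suc m ℕ.*_) e) (ℕ.*-zeroʳ (suc m))))))
          (ℕ.≤-pred (ℕ.<-≤-trans (ℕ.m/n<m n (suc m) {{ℕ.>-nonZero 1≤n}} 2≤p) n≤f))
          (λ h → 2∤n (ℕ.∣-trans h q∣n)) (λ h → 3∤n (ℕ.∣-trans h q∣n))))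
        (trans (sym (ψ-* (suc m) (n ℕ./ suc m))) (cong ψ n≡))
    where
    n≡ : suc m ℕ.* (n ℕ./ suc m) ≡ n
    n≡ = trans (ℕ.*-comm (suc m) _) (ℕ.m/n*n≡m p∣n)
    q∣n : n ℕ./ suc m ℕ.∣ n
    q∣n = ℕ.divides (suc m) (sym n≡)
    odd = odd-∣ 2∤n p∣n
    open Legendre m (proj₁ odd) (rough∧∣⇒prime {{n>1⇒nonTrivial 2≤p}} rough p∣n) (proj₂ odd) (λ h → 3∤n (ℕ.∣-trans h p∣n)) 2≤p using (legendre-ψ)

  jacobi-ψ : ∀ n → 1 ≤ n → ¬ (2 ℕ.∣ n) → ¬ (3 ℕ.∣ n) → jacobi -3ℤ n ≡ ψ n
  jacobi-ψ n 1≤n = jacobiF-ψ n n 1≤n ℕ.≤-refl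

-- q-Pochhammer symbols and central q-binomial coefficients

module Pochhammer (R : CommutativeRing 0ℓ 0ℓ) (q : CommutativeRing.Carrier R) where
  open CommutativeRing R
  open IntegerCoefficients R
  open Ranges R
  open Localisation R using (Regular; regular-cancel; regular-*; regular-1)
  open CubicSum R q using (num; den)
  open import Algebra.Properties.Semiring.Exp semiring
  open import Relation.Binary.Reasoning.Setoid setoid

  -- (q;q)_k, (q;q²)_k, (q²;q²)_k, (q⁶;q⁶)_k, (q²;q²)_k / (q;q)_k and (q⁶;q⁶)_k / (q²;q²)_k
  F A B C E G : ℕ → Carrier
  F = ∏ (λ j → 1# - q ^ suc j)
  A = ∏ (λ j → 1# - q ^ (1 ℕ.+ 2 ℕ.* j))
  B = ∏ (λ j → 1# - q ^ (2 ℕ.* suc j))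
  C = ∏ (λ j → 1# - q ^ (6 ℕ.* suc j))
  E = ∏ (λ j → 1# + q ^ suc j)
  G = ∏ (λ j → 1# + q ^ (2 ℕ.* suc j) + q ^ (2 ℕ.* suc j) * q ^ (2 ℕ.* suc j))

  q^2* : ∀ k → q ^ (2 ℕ.* k) ≈ q ^ k * q ^ k
  q^2* k = trans (^-congʳ q (lemma k)) (^-homo-* q k k)
    where
    lemma : ∀ k → 2 ℕ.* k ≡ k ℕ.+ k
    lemma = solveℕ-∀

  B≈FE : ∀ k → B k ≈ F k * E k
  B≈FE k = trans (∏-cong k (λ j _ → trans (+-congˡ (-‿cong (q^2* (suc j))))
      (solve 1 (λ x → let i = con (+ 1) in i :- x :* x := (i :- x) :* (i :+ x)) refl (q ^ suc j))))
    (∏-* _ _ k)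

  C≈BG : ∀ k → C k ≈ B k * G k
  C≈BG k = trans (∏-cong k (λ j _ → trans (+-congˡ (-‿cong (q^6* (suc j))))
      (solve 1 (λ x → let i = con (+ 1) in i :- x :* (x :* x) := (i :- x) :* (i :+ x :+ x :* x)) refl (q ^ (2 ℕ.* suc j)))))
    (∏-* _ _ k)
    where
    q^6* : ∀ k → q ^ (6 ℕ.* k) ≈ q ^ (2 ℕ.* k) * (q ^ (2 ℕ.* k) * q ^ (2 ℕ.* k))
    q^6* k = trans (^-congʳ q (lemma k)) (trans (^-homo-* q (2 ℕ.* k) _) (*-congˡ (^-homo-* q (2 ℕ.* k) (2 ℕ.* k))))
      where
      lemma : ∀ k → 6 ℕ.* k ≡ 2 ℕ.* k ℕ.+ (2 ℕ.* k ℕ.+ 2 ℕ.* k)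
      lemma = solveℕ-∀

  F≈AB : ∀ k → F (k ℕ.+ k) ≈ A k * B k
  F≈AB zero    = sym (*-identityˡ 1#)
  F≈AB (suc k) = begin
    F (suc k ℕ.+ suc k)
      ≡⟨ ≡.cong F (≡.cong suc (ℕ.+-suc k k)) ⟩
    F (k ℕ.+ k) * (1# - q ^ suc (k ℕ.+ k)) * (1# - q ^ suc (suc (k ℕ.+ k)))
      ≈⟨ *-cong (*-cong (F≈AB k) (+-congˡ (-‿cong (^-congʳ q (lemma₁ k))))) (+-congˡ (-‿cong (^-congʳ q (lemma₂ k)))) ⟩
    A k * B k * (1# - q ^ (1 ℕ.+ 2 ℕ.* k)) * (1# - q ^ (2 ℕ.* suc k))
      ≈⟨ solve 4 (λ a b x y → a :* b :* x :* y := (a :* x) :* (b :* y)) refl _ _ _ _ ⟩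
    A (suc k) * B (suc k) ∎
    where
    lemma₁ : ∀ k → suc (k ℕ.+ k) ≡ 1 ℕ.+ 2 ℕ.* k
    lemma₁ = solveℕ-∀
    lemma₂ : ∀ k → suc (suc (k ℕ.+ k)) ≡ 2 ℕ.* suc k
    lemma₂ = solveℕ-∀

  -- The Gaussian binomial coefficient of a + b over a, by the q-Pascal rule, so that it is a
  -- polynomial in q by construction.
  gauss : ℕ → ℕ → Carrier
  gauss zero    b       = 1#
  gauss (suc a) zero    = 1#
  gauss (suc a) (suc b) = gauss a (suc b) + q ^ suc a * gauss (suc a) b

  gauss-F : ∀ a b → gauss a b * (F a * F b) ≈ F (a ℕ.+ b)
  gauss-F zero    b    = trans (*-identityˡ _) (*-identityˡ _)
  gauss-F (suc a) zero = trans (*-identityˡ _) (trans (*-identityʳ _) (reflexive (≡.cong F (≡.sym (ℕ.+-identityʳ (suc a))))))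
  gauss-F (suc a) (suc b) = begin
    (gauss a (suc b) + q ^ suc a * gauss (suc a) b) * ((F a * (1# - q ^ suc a)) * (F b * (1# - q ^ suc b)))
      ≈⟨ solve 6 (λ g h f k x y → let i = con (+ 1) in
           (g :+ x :* h) :* ((f :* (i :- x)) :* (k :* (i :- y)))
           := (i :- x) :* (g :* (f :* (k :* (i :- y)))) :+ x :* (i :- y) :* (h :* ((f :* (i :- x)) :* k))) refl _ _ _ _ _ _ ⟩
    (1# - q ^ suc a) * (gauss a (suc b) * (F a * F (suc b))) + q ^ suc a * (1# - q ^ suc b) * (gauss (suc a) b * (F (suc a) * F b))
      ≈⟨ +-cong (*-congˡ (trans (gauss-F a (suc b)) (reflexive (≡.cong F (ℕ.+-suc a b))))) (*-congˡ (gauss-F (suc a) b)) ⟩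
    (1# - q ^ suc a) * F (suc a ℕ.+ b) + q ^ suc a * (1# - q ^ suc b) * F (suc a ℕ.+ b)
      ≈⟨ solve 3 (λ x y f → let i = con (+ 1) in (i :- x) :* f :+ x :* (i :- y) :* f := f :* (i :- x :* y)) refl _ _ _ ⟩
    F (suc a ℕ.+ b) * (1# - q ^ suc a * q ^ suc b)
      ≈⟨ *-congˡ (+-congˡ (-‿cong (^-homo-* q (suc a) (suc b)))) ⟨
    F (suc a ℕ.+ b) * (1# - q ^ (suc a ℕ.+ suc b))
      ≡⟨ ≡.cong (λ k → F k * (1# - q ^ (suc a ℕ.+ suc b))) (≡.sym (ℕ.+-suc a b)) ⟩
    F (a ℕ.+ suc b) * (1# - q ^ (suc a ℕ.+ suc b)) ∎

  central : ℕ → Carrier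
  central k = gauss k k

  module _ (regular-1-q^ : ∀ i → Regular (1# - q ^ suc i)) where

    regular-F : ∀ k → Regular (F k)
    regular-F zero    = regular-1
    regular-F (suc k) = regular-* (regular-F k) (regular-1-q^ k)

    -- Both (q;q)_2k = (q;q²)_k (q²;q²)_k and (q²;q²)_k = (q;q)_k (-q;q)_k enter; the factors
    -- (q;q)_k cancel because they are regular.
    central-B : ∀ k → central k * B k ≈ A k * (E k * E k)
    central-B k = begin
      central k * B k           ≈⟨ *-congˡ (B≈FE k) ⟩
      central k * (F k * E k)   ≈⟨ *-assoc _ _ _ ⟨
      central k * F k * E k     ≈⟨ *-congʳ (regular-cancel (regular-F k) (begin
        central k * F k * F k     ≈⟨ *-assoc _ _ _ ⟩
        central k * (F k * F k)   ≈⟨ gauss-F k k ⟩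
        F (k ℕ.+ k)               ≈⟨ F≈AB k ⟩
        A k * B k                 ≈⟨ *-congˡ (B≈FE k) ⟩
        A k * (F k * E k)         ≈⟨ solve 3 (λ a f e → a :* (f :* e) := a :* e :* f) refl _ _ _ ⟩
        A k * E k * F k           ∎)) ⟩
      A k * E k * E k           ≈⟨ *-assoc _ _ _ ⟩
      A k * (E k * E k)         ∎

    -- This rests on (q;q²)_k / (q⁶;q⁶)_k = `central k` / (`E k`² `G k`) and (q;q²)_2k / (q²;q²)_2k
    -- = `central (2 ℕ.* k)` / `E (2 ℕ.* k)`². The factors 1 - q^j disappear from the denominators.
    reduce : ∀ k w z →
      (A k * A k) * A (2 ℕ.* k) * w * z * ((E k * E k) * (E k * E k) * (E (2 ℕ.* k) * E (2 ℕ.* k)) * (G k * G k))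
      ≈ (central k * central k) * central (2 ℕ.* k) * w * z * (B (2 ℕ.* k) * (C k * C k))
    reduce k w z = sym (begin
      (central k * central k) * central (2 ℕ.* k) * w * z * (B (2 ℕ.* k) * (C k * C k))
        ≈⟨ *-congˡ (*-congˡ (*-cong (C≈BG k) (C≈BG k))) ⟩
      (central k * central k) * central (2 ℕ.* k) * w * z * (B (2 ℕ.* k) * ((B k * G k) * (B k * G k)))
        ≈⟨ solve 7 (λ g h w z b c x → (g :* g) :* h :* w :* z :* (b :* ((c :* x) :* (c :* x)))
             := (g :* c) :* (g :* c) :* (h :* b) :* w :* z :* (x :* x)) refl _ _ _ _ _ _ _ ⟩
      (central k * B k) * (central k * B k) * (central (2 ℕ.* k) * B (2 ℕ.* k)) * w * z * (G k * G k)
        ≈⟨ *-congʳ (*-congʳ (*-congʳ (*-cong (*-cong (central-B k) (central-B k)) (central-B (2 ℕ.* k))))) ⟩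
      (A k * (E k * E k)) * (A k * (E k * E k)) * (A (2 ℕ.* k) * (E (2 ℕ.* k) * E (2 ℕ.* k))) * w * z * (G k * G k)
        ≈⟨ solve 7 (λ a e b f w z x → (a :* (e :* e)) :* (a :* (e :* e)) :* (b :* (f :* f)) :* w :* z :* (x :* x)
             := (a :* a) :* b :* w :* z :* ((e :* e) :* (e :* e) :* (f :* f) :* (x :* x))) refl _ _ _ _ _ _ _ ⟩
      (A k * A k) * A (2 ℕ.* k) * w * z * ((E k * E k) * (E k * E k) * (E (2 ℕ.* k) * E (2 ℕ.* k)) * (G k * G k)) ∎)

  numer denom : ℕ → Carrier
  numer k = (A k * A k) * A (2 ℕ.* k) * q ^ (2 ℕ.* k ℕ.* k)
  denom k = B (2 ℕ.* k) * (C k * C k)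

  private
    T = q ^_
    q^ : ∀ a b k → q ^ (a ℕ.+ b ℕ.* k) ≈ q ^ a * T k ^ b
    q^ a b k = trans (^-homo-* q a (b ℕ.* k)) (*-congˡ (trans (^-congʳ q (ℕ.*-comm b k)) (sym (^-assocʳ q k b))))

    double : ∀ (f : ℕ → Carrier) k → ∏ f (2 ℕ.* suc k) ≈ ∏ f (2 ℕ.* k) * f (2 ℕ.* k) * f (suc (2 ℕ.* k))
    double f k = reflexive (≡.cong (∏ f) (lemma k))
      where
      lemma : ∀ k → 2 ℕ.* suc k ≡ suc (suc (2 ℕ.* k))
      lemma = solveℕ-∀

  numer-suc : ∀ k → numer (suc k) ≈ numer k * num 1# (T k)
  numer-suc k = begin
    (A k * (1# - q ^ (1 ℕ.+ 2 ℕ.* k))) * (A k * (1# - q ^ (1 ℕ.+ 2 ℕ.* k))) * A (2 ℕ.* suc k) * q ^ (2 ℕ.* suc k ℕ.* suc k)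
      ≈⟨ *-cong (*-cong (*-cong (*-congˡ e₁) (*-congˡ e₁)) (trans (double _ k) (*-cong (*-congˡ e₂) e₃))) e₄ ⟩
    (A k * (1# - q ^ 1 * T k ^ 2)) * (A k * (1# - q ^ 1 * T k ^ 2)) * (A (2 ℕ.* k) * (1# - q ^ 1 * T k ^ 4) * (1# - q ^ 3 * T k ^ 4))
      * (q ^ (2 ℕ.* k ℕ.* k) * (q ^ 2 * T k ^ 4))
      ≈⟨ solve 5 (λ a b z q t → let i = con (+ 1) in
           (a :* (i :- q :^ 1 :* t :^ 2)) :* (a :* (i :- q :^ 1 :* t :^ 2)) :* (b :* (i :- q :^ 1 :* t :^ 4) :* (i :- q :^ 3 :* t :^ 4)) :* (z :* (q :^ 2 :* t :^ 4))
           := (a :* a) :* b :* z :* (q :^ 2 :* t :^ 4 :* ((i :- q :* t :^ 4) :* (i :- q :^ 3 :* t :^ 4)) :* ((i :- q :* t :^ 2) :* (i :- i :* (q :* t :^ 2))))) refl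
           (A k) (A (2 ℕ.* k)) (q ^ (2 ℕ.* k ℕ.* k)) q (T k) ⟩
    numer k * num 1# (T k) ∎
    where
    e₁ = +-congˡ (-‿cong (q^ 1 2 k))
    e₂ = +-congˡ (-‿cong (trans (^-congʳ q (≡.cong suc (≡.sym (ℕ.*-assoc 2 2 k)))) (q^ 1 4 k)))
    e₃ = +-congˡ (-‿cong (trans (^-congʳ q (lemma k)) (q^ 3 4 k)))
      where
      lemma : ∀ k → 1 ℕ.+ 2 ℕ.* suc (2 ℕ.* k) ≡ 3 ℕ.+ 4 ℕ.* k
      lemma = solveℕ-∀
    e₄ = trans (^-congʳ q (lemma k)) (trans (^-homo-* q (2 ℕ.* k ℕ.* k) _) (*-congˡ (q^ 2 4 k)))
      where
      lemma : ∀ k → 2 ℕ.* suc k ℕ.* suc k ≡ 2 ℕ.* k ℕ.* k ℕ.+ (2 ℕ.+ 4 ℕ.* k)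
      lemma = solveℕ-∀

  denom-suc : ∀ k → denom (suc k) ≈ denom k * den 1# (T k)
  denom-suc k = begin
    B (2 ℕ.* suc k) * ((C k * (1# - q ^ (6 ℕ.* suc k))) * (C k * (1# - q ^ (6 ℕ.* suc k))))
      ≈⟨ *-cong (trans (double _ k) (*-cong (*-congˡ e₁) e₂)) (*-cong (*-congˡ e₃) (*-congˡ e₃)) ⟩
    (B (2 ℕ.* k) * (1# - q ^ 2 * T k ^ 4) * (1# - q ^ 4 * T k ^ 4)) * ((C k * (1# - q ^ 6 * T k ^ 6)) * (C k * (1# - q ^ 6 * T k ^ 6)))
      ≈⟨ solve 4 (λ b c q t → let i = con (+ 1) in
           (b :* (i :- q :^ 2 :* t :^ 4) :* (i :- q :^ 4 :* t :^ 4)) :* ((c :* (i :- q :^ 6 :* t :^ 6)) :* (c :* (i :- q :^ 6 :* t :^ 6)))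
           := b :* (c :* c) :* ((i :- q :^ 2 :* t :^ 4) :* (i :- q :^ 4 :* t :^ 4) :* ((i :- q :^ 6 :* t :^ 6) :* (i :- i :* (q :^ 6 :* t :^ 6))))) refl
           (B (2 ℕ.* k)) (C k) q (T k) ⟩
    denom k * den 1# (T k) ∎
    where
    e₁ = +-congˡ (-‿cong (trans (^-congʳ q (lemma k)) (q^ 2 4 k)))
      where
      lemma : ∀ k → 2 ℕ.* suc (2 ℕ.* k) ≡ 2 ℕ.+ 4 ℕ.* k
      lemma = solveℕ-∀
    e₂ = +-congˡ (-‿cong (trans (^-congʳ q (lemma k)) (q^ 4 4 k)))
      where
      lemma : ∀ k → 2 ℕ.* suc (suc (2 ℕ.* k)) ≡ 4 ℕ.+ 4 ℕ.* k
      lemma = solveℕ-∀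
    e₃ = +-congˡ (-‿cong (trans (^-congʳ q (lemma k)) (q^ 6 6 k)))
      where
      lemma : ∀ k → 6 ℕ.* suc k ≡ 6 ℕ.+ 6 ℕ.* k
      lemma = solveℕ-∀

-- The original summands as the deformed ones at m = 0

module LocalSummand (R : CommutativeRing 0ℓ 0ℓ) (q : CommutativeRing.Carrier R) where
  open CommutativeRing R
  open Localisation R
  open Pochhammer R q
  open Algebra.Properties.Semiring.Exp semiring using (_^_)
  module K = CommutativeRing fractions
  module EK = Algebra.Properties.Semiring.Exp K.semiring
  module KS = IntegerCoefficients fractions
  module RS = IntegerCoefficients R
  module CR = CubicSum R q
  module CK = CubicSum fractions (ι q)
  open Ranges fractions using (unit-cancel)
  open Relation.Binary.Reasoning.Setoid K.setoid

  ι-*′ : ∀ {x y x′ y′} → ι x ≃ x′ → ι y ≃ y′ → ι (x * y) ≃ x′ K.* y′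
  ι-*′ {x} {y} e f = K.trans (ι-* x y) (K.*-cong e f)

  ι-1-′ : ∀ {x x′} → ι x ≃ x′ → ι (1# - x) ≃ K.1# K.- x′
  ι-1-′ {x} e = K.trans (ι-+ 1# (- x)) (K.+-congˡ (K.trans (ι-- x) (K.-‿cong e)))

  ι-^^ : ∀ k m → ι ((q ^ k) ^ m) ≃ (ι q EK.^ k) EK.^ m
  ι-^^ k m = K.trans (ι-^ (q ^ k) m) (EK.^-congˡ m (ι-^ q k))

  ι-q^t^ : ∀ i k m → ι (q ^ i * (q ^ k) ^ m) ≃ ι q EK.^ i K.* (ι q EK.^ k) EK.^ m
  ι-q^t^ i k m = ι-*′ (ι-^ q i) (ι-^^ k m)

  ι-qt^ : ∀ k m → ι (q * (q ^ k) ^ m) ≃ ι q K.* (ι q EK.^ k) EK.^ m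
  ι-qt^ k m = ι-*′ K.refl (ι-^^ k m)

  ι-num : ∀ k → ι (CR.num 1# (q ^ k)) ≃ CK.num K.1# (ι q EK.^ k)
  ι-num k = ι-*′ (ι-*′ (ι-q^t^ 2 k 4) (ι-*′ (ι-1-′ (ι-qt^ k 4)) (ι-1-′ (ι-q^t^ 3 k 4))))
    (ι-*′ (ι-1-′ (ι-qt^ k 2)) (ι-1-′ (ι-*′ K.refl (ι-qt^ k 2))))

  ι-den : ∀ k → ι (CR.den 1# (q ^ k)) ≃ CK.den K.1# (ι q EK.^ k)
  ι-den k = ι-*′ (ι-*′ (ι-1-′ (ι-q^t^ 2 k 4)) (ι-1-′ (ι-q^t^ 4 k 4)))
    (ι-*′ (ι-1-′ (ι-q^t^ 6 k 6)) (ι-1-′ (ι-*′ K.refl (ι-q^t^ 6 k 6))))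

  module _ (regular-denom : ∀ k → Regular (denom k)) where

    summand : ℕ → Fraction
    summand k = fraction (numer k) (denom k) (regular-denom k)

    private
      module H = CK.HTerm

    -- At y = 1 the bracket with x is (1 - x)², so the squares of the original summand reappear.
    summand-hterm : CK.Summand K.1# summand
    summand-hterm = record
      { h-zero = cross zeroth
      ; h-suc  = λ k → unit-cancel (unit-ι (regular-denom k)) (unit-cancel (unit-ι (regular-denom (suc k))) (step k)) }
      where
      zeroth : numer 0 * 1# ≈ 1# * denom 0
      zeroth = RS.solve 1 (λ x → let i = RS.con (+ 1) in (i RS.:* i RS.:* i RS.:* i) RS.:* i RS.:= i RS.:* (i RS.:* (i RS.:* i))) refl 1#
      step : ∀ k → summand (suc k) K.* CK.den K.1# (ι q EK.^ k) K.* ι (denom k) K.* ι (denom (suc k))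
                 ≃ summand k K.* CK.num K.1# (ι q EK.^ k) K.* ι (denom k) K.* ι (denom (suc k))
      step k = begin
        summand (suc k) K.* d K.* ι (denom k) K.* ι (denom (suc k))
          ≈⟨ KS.solve 4 (λ s d b c → s KS.:* d KS.:* b KS.:* c KS.:= (s KS.:* c) KS.:* (b KS.:* d)) K.refl (summand (suc k)) d (ι (denom k)) (ι (denom (suc k))) ⟩
        (summand (suc k) K.* ι (denom (suc k))) K.* (ι (denom k) K.* d)
          ≈⟨ K.*-cong (bot*fraction (summand (suc k))) (K.sym (K.trans (ι-cong (denom-suc k)) (ι-*′ K.refl (ι-den k)))) ⟩
        ι (numer (suc k)) K.* ι (denom (suc k))
          ≈⟨ K.*-congʳ (K.trans (ι-cong (numer-suc k)) (ι-*′ K.refl (ι-num k))) ⟩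
        (ι (numer k) K.* n) K.* ι (denom (suc k))
          ≈⟨ K.*-congʳ (K.*-congʳ (bot*fraction (summand k))) ⟨
        ((summand k K.* ι (denom k)) K.* n) K.* ι (denom (suc k))
          ≈⟨ KS.solve 4 (λ s n b c → ((s KS.:* b) KS.:* n) KS.:* c KS.:= s KS.:* n KS.:* b KS.:* c) K.refl (summand k) n (ι (denom k)) (ι (denom (suc k))) ⟩
        summand k K.* n K.* ι (denom k) K.* ι (denom (suc k)) ∎
        where
        d = CK.den K.1# (ι q EK.^ k)
        n = CK.num K.1# (ι q EK.^ k)

-- Terms of the theorem with reduced denominators

module ReducedTerms where
  open import Defs
  open import Data.List using (List; []; _∷_; map; upTo; applyUpTo)
  open import Data.List.Properties using (map-upTo)
  open ≡ hiding ([_])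
  open PolynomialRing
  open Squarefreeness
  open ExactDivision
  open Cyclotomic
  open Localisation polyRing
  open Algebra.Properties.Semiring.Exp P.semiring using (_^_; ^-assocʳ; ^-congˡ)
  open Ranges polyRing using (∑; ∏; ∏-cong; ∑-front; ∏-front)
  open Pochhammer polyRing q
  open LocalSummand polyRing q
  open Relation.Binary.Reasoning.Setoid P.setoid

  prodₚ-∏ : ∀ f n → prodₚ (map f (upTo n)) ≋ ∏ f n
  prodₚ-∏ f n = subst (λ ps → prodₚ ps ≋ ∏ f n) (sym (map-upTo f n)) (go f n)
    where
    go : ∀ f n → prodₚ (applyUpTo f n) ≋ ∏ f n
    go f zero    = ≋-refl
    go f (suc n) = ≋-trans (*-congˡ (f 0) (go (λ i → f (suc i)) n)) (≋-sym (∏-front f n))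

  sumₚ-∑ : ∀ f n → sumₚ (map f (upTo n)) ≋ ∑ f n
  sumₚ-∑ f n = subst (λ ps → sumₚ ps ≋ ∑ f n) (sym (map-upTo f n)) (go f n)
    where
    go : ∀ f n → sumₚ (applyUpTo f n) ≋ ∑ f n
    go f zero    = ≋-refl
    go f (suc n) = ≋-trans (+-cong ≋-refl (go (λ i → f (suc i)) n)) (≋-sym (∑-front f n))

  ^ₚ-^ : ∀ p j → p ^ₚ j ≡ p ^ j
  ^ₚ-^ p zero    = refl
  ^ₚ-^ p (suc j) = cong (p *ₚ_) (^ₚ-^ p j)

  poch-∏ : ∀ a b (e : ℕ → ℕ) → (∀ j → a *ₚ (b ^ j) ≋ q ^ e j) → ∀ k → poch a b k ≋ ∏ (λ j → 1ₚ -ₚ q ^ e j) k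
  poch-∏ a b e eq k = ≋-trans (prodₚ-∏ _ k) (∏-cong k (λ j _ → +-cong (≋-refl {1ₚ}) (neg-cong (subst (λ x → a *ₚ x ≋ q ^ e j) (sym (^ₚ-^ b j)) (eq j)))))

  poch-A : ∀ k → poch q¹ q² k ≋ A k
  poch-A = poch-∏ q¹ q² (λ j → 1 ℕ.+ 2 ℕ.* j) (λ j → *-congˡ q (≋-trans (^-congˡ j (qpow-≋ 2)) (^-assocʳ q 2 j)))

  poch-power : ∀ a j → qpow a *ₚ (qpow a ^ j) ≋ q ^ (a ℕ.* suc j)
  poch-power a j = ≋-trans (^-congˡ (suc j) (qpow-≋ a)) (^-assocʳ q a (suc j))

  poch-B : ∀ k → poch q² q² k ≋ B k
  poch-B = poch-∏ q² q² (λ j → 2 ℕ.* suc j) (poch-power 2)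

  poch-C : ∀ k → poch q⁶ q⁶ k ≋ C k
  poch-C = poch-∏ q⁶ q⁶ (λ j → 6 ℕ.* suc j) (poch-power 6)

  qint-X : ∀ m → qint m *ₚ X 1 ≋ X m
  qint-X m = ≋-trans (*-congʳ (X 1) (sumₚ-∑ qpow m)) (go m)
    where
    go : ∀ m → ∑ qpow m *ₚ X 1 ≋ X m
    go zero    = ≋-sym X-0
    go (suc m) = begin
      (∑ qpow m +ₚ qpow m) *ₚ X 1
        ≈⟨ *-distribʳ (X 1) (∑ qpow m) (qpow m) ⟩
      ∑ qpow m *ₚ X 1 +ₚ qpow m *ₚ X 1
        ≈⟨ +-cong (go m) (*-congʳ (X 1) (qpow-≋ m)) ⟩
      X m +ₚ q ^ m *ₚ X 1
        ≈⟨ PS.solve 2 (λ x q → let i = PS.con (+ 1) in (x PS.:- i) PS.:+ x PS.:* (q PS.:* i PS.:- i) PS.:= q PS.:* x PS.:- i) P.refl (q ^ m) q ⟩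
      X (suc m) ∎

  regular-1-q^ : ∀ i → Regular (1ₚ -ₚ q ^ suc i)
  regular-1-q^ i = regular-constant λ e → absurd (trans (sym constant) e)
    where
    absurd : ¬ (1ℤ ≡ 0ℤ)
    absurd ()
    constant : coeff (1ₚ -ₚ q ^ suc i) 0 ≡ 1ℤ
    constant = trans (coeff-+ 1ₚ (-ₚ (q ^ suc i)) 0) (cong (λ z → 1ℤ ℤ.+ z) (trans (coeff-neg (q ^ suc i) 0) (cong ℤ.-_ (trans (coeff-*-zero q (q ^ i)) (ℤ.*-zeroˡ (coeff (q ^ i) 0))))))

  regular-neg : ∀ {p} → Regular p → Regular (-ₚ p)
  regular-neg {p} r y h = r y (≋-trans (PS.solve 2 (λ y p → y PS.:* p PS.:= PS.:- (y PS.:* (PS.:- p))) P.refl y p) (≋-trans (neg-cong h) ≋-refl))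

  neg-X : ∀ i → 1ₚ -ₚ q ^ i ≋ -ₚ X i
  neg-X i = PS.solve 1 (λ x → let o = PS.con (+ 1) in o PS.:- x PS.:= PS.:- (x PS.:- o)) P.refl (q ^ i)

  regular-X : ∀ i → Regular (X (suc i))
  regular-X i = regular-resp (≋-trans (neg-cong (neg-X (suc i))) (PS.solve 1 (λ x → PS.:- (PS.:- x) PS.:= x) P.refl (X (suc i)))) (regular-neg (regular-1-q^ i))

  regular-∏ : ∀ f n → (∀ i → Regular (f i)) → Regular (∏ f n)
  regular-∏ f zero    r = regular-1
  regular-∏ f (suc n) r = regular-* (regular-∏ f n r) (r n)

  regular-denom : ∀ k → Regular (denom k)
  regular-denom k = regular-* (regular-∏ _ (2 ℕ.* k) (λ j → regular-1-q^ (j ℕ.+ 1 ℕ.* suc j))) (regular-* rC rC)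
    where
    rC = regular-∏ (λ j → 1ₚ -ₚ q ^ (6 ℕ.* suc j)) k (λ j → regular-1-q^ (j ℕ.+ 5 ℕ.* suc j))

  infix 4 _≈F_
  _≈F_ : Frac → Frac → Set
  x ≈F y = num x *ₚ den y ≋ num y *ₚ den x

  +f-cong : ∀ {x x′ y y′} → x ≈F x′ → y ≈F y′ → (x +f y) ≈F (x′ +f y′)
  +f-cong {a ／ b} {a′ ／ b′} {c ／ d} {c′ ／ d′} e f = begin
    (a *ₚ d +ₚ c *ₚ b) *ₚ (b′ *ₚ d′)
      ≈⟨ PS.solve 6 (λ a b c d b′ d′ → (a PS.:* d PS.:+ c PS.:* b) PS.:* (b′ PS.:* d′) PS.:= (a PS.:* b′) PS.:* (d PS.:* d′) PS.:+ (c PS.:* d′) PS.:* (b PS.:* b′)) P.refl a b c d b′ d′ ⟩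
    (a *ₚ b′) *ₚ (d *ₚ d′) +ₚ (c *ₚ d′) *ₚ (b *ₚ b′)
      ≈⟨ +-cong (*-congʳ (d *ₚ d′) e) (*-congʳ (b *ₚ b′) f) ⟩
    (a′ *ₚ b) *ₚ (d *ₚ d′) +ₚ (c′ *ₚ d) *ₚ (b *ₚ b′)
      ≈⟨ PS.solve 6 (λ a b c d b′ d′ → (a PS.:* b′) PS.:* (d′ PS.:* d) PS.:+ (c PS.:* d′) PS.:* (b′ PS.:* b) PS.:= (a PS.:* d PS.:+ c PS.:* b) PS.:* (b′ PS.:* d′)) P.refl a′ b′ c′ d′ b d ⟩
    (a′ *ₚ d′ +ₚ c′ *ₚ b′) *ₚ (b *ₚ d) ∎

  -f-cong : ∀ {x x′} y → x ≈F x′ → (x -f y) ≈F (x′ -f y)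
  -f-cong {a ／ b} {a′ ／ b′} (c ／ d) e = begin
    (a *ₚ d -ₚ c *ₚ b) *ₚ (b′ *ₚ d)
      ≈⟨ PS.solve 5 (λ a b c d b′ → (a PS.:* d PS.:- c PS.:* b) PS.:* (b′ PS.:* d) PS.:= (a PS.:* b′) PS.:* (d PS.:* d) PS.:- (c PS.:* d) PS.:* (b PS.:* b′)) P.refl a b c d b′ ⟩
    (a *ₚ b′) *ₚ (d *ₚ d) -ₚ (c *ₚ d) *ₚ (b *ₚ b′)
      ≈⟨ +-cong (*-congʳ (d *ₚ d) e) ≋-refl ⟩
    (a′ *ₚ b) *ₚ (d *ₚ d) -ₚ (c *ₚ d) *ₚ (b *ₚ b′)
      ≈⟨ PS.solve 5 (λ a b c d b′ → (a PS.:* b′) PS.:* (d PS.:* d) PS.:- (c PS.:* d) PS.:* (b′ PS.:* b) PS.:= (a PS.:* d PS.:- c PS.:* b) PS.:* (b′ PS.:* d)) P.refl a′ b′ c d b ⟩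
    (a′ *ₚ d -ₚ c *ₚ b′) *ₚ (b *ₚ d) ∎

  sumF-cong : ∀ (f g : ℕ → Frac) → (∀ k → f k ≈F g k) → ∀ ks → sumF (map f ks) ≈F sumF (map g ks)
  sumF-cong f g e []       = ≋-refl {[]}
  sumF-cong f g e (k ∷ ks) = +f-cong {f k} {g k} {sumF (map f ks)} {sumF (map g ks)} (e k)
    (sumF-cong f g e ks)

  reducedNum reducedDen : ℕ → Poly
  reducedNum k = (central k *ₚ central k) *ₚ central (2 ℕ.* k) *ₚ qint (8 ℕ.* k ℕ.+ 1) *ₚ q ^ (2 ℕ.* k ℕ.* k)
  reducedDen k = (E k *ₚ E k) *ₚ (E k *ₚ E k) *ₚ (E (2 ℕ.* k) *ₚ E (2 ℕ.* k)) *ₚ (G k *ₚ G k)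

  reduced : ℕ → Frac
  reduced k = reducedNum k ／ reducedDen k

  square-^ₚ : ∀ p → p ^ₚ 2 ≋ p *ₚ p
  square-^ₚ p = PS.solve 1 (λ p → p PS.:* (p PS.:* PS.con (+ 1)) PS.:= p PS.:* p) P.refl p

  term-reduced : ∀ k → term k ≈F reduced k
  term-reduced k = begin
    (((poch q¹ q² k) ^ₚ 2) *ₚ poch q¹ q² (2 ℕ.* k) *ₚ w *ₚ qpow (2 ℕ.* k ℕ.* k)) *ₚ reducedDen k
      ≈⟨ *-congʳ (reducedDen k) (P.*-cong (P.*-congʳ (P.*-cong (≋-trans (square-^ₚ (poch q¹ q² k)) (P.*-cong (poch-A k) (poch-A k))) (poch-A (2 ℕ.* k)))) (qpow-≋ (2 ℕ.* k ℕ.* k))) ⟩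
    ((A k *ₚ A k) *ₚ A (2 ℕ.* k) *ₚ w *ₚ q ^ (2 ℕ.* k ℕ.* k)) *ₚ reducedDen k
      ≈⟨ reduce regular-1-q^ k w (q ^ (2 ℕ.* k ℕ.* k)) ⟩
    reducedNum k *ₚ (B (2 ℕ.* k) *ₚ (C k *ₚ C k))
      ≈⟨ *-congˡ (reducedNum k) (P.*-cong (poch-B (2 ℕ.* k)) (≋-trans (square-^ₚ (poch q⁶ q⁶ k)) (P.*-cong (poch-C k) (poch-C k)))) ⟨
    reducedNum k *ₚ (poch q² q² (2 ℕ.* k) *ₚ ((poch q⁶ q⁶ k) ^ₚ 2)) ∎
    where
    w = qint (8 ℕ.* k ℕ.+ 1)

-- Formal fractions as elements of the ring of fractions

module Representation where
  open import Defs
  import Data.Integer.Divisibility.Signed as ℤ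
  open import Data.List using (map; upTo; applyUpTo)
  open import Data.List.Properties using (map-upTo)
  open ≡ hiding ([_])
  open PolynomialRing
  open Squarefreeness
  open ExactDivision
  open Cyclotomic
  open ReducedTerms
  open Localisation polyRing
  open Algebra.Properties.Semiring.Exp P.semiring using (_^_; ^-assocʳ; ^-congʳ)
  open Pochhammer polyRing q
  open LocalSummand polyRing q
  open Ranges fractions using (Unit; unit-cancel; unit-resp; ∑; ∑-front)

  unit-q : Unit (ι q)
  unit-q = unit-ι regular-q

  unit-1-q^ : ∀ i → Unit (K.1# K.- ι q EK.^ suc i)
  unit-1-q^ i = unit-resp (ι-1-^ q (suc i)) (unit-ι (regular-1-q^ i))

  -- Cross-multiplied, because a `Frac` carries no proof that its denominator is regular.
  Represents : Fraction → Frac → Set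
  Represents z f = z K.* ι (den f) ≃ ι (num f)

  module _ where
    open Relation.Binary.Reasoning.Setoid K.setoid

    represents-+ : ∀ {z w f g} → Represents z f → Represents w g → Represents (z K.+ w) (f +f g)
    represents-+ {z} {w} {a ／ b} {c ／ d} e e′ = begin
      (z K.+ w) K.* ι (b *ₚ d)
        ≈⟨ K.*-congˡ (ι-* b d) ⟩
      (z K.+ w) K.* (ι b K.* ι d)
        ≈⟨ KS.solve 4 (λ z w b d → (z KS.:+ w) KS.:* (b KS.:* d) KS.:= (z KS.:* b) KS.:* d KS.:+ (w KS.:* d) KS.:* b) K.refl z w (ι b) (ι d) ⟩
      (z K.* ι b) K.* ι d K.+ (w K.* ι d) K.* ι b
        ≈⟨ K.+-cong (K.*-congʳ e) (K.*-congʳ e′) ⟩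
      ι a K.* ι d K.+ ι c K.* ι b
        ≈⟨ K.+-cong (ι-* a d) (ι-* c b) ⟨
      ι (a *ₚ d) K.+ ι (c *ₚ b)
        ≈⟨ ι-+ (a *ₚ d) (c *ₚ b) ⟨
      ι (a *ₚ d +ₚ c *ₚ b) ∎

    represents-- : ∀ {z w f g} → Represents z f → Represents w g → Represents (z K.- w) (f -f g)
    represents-- {z} {w} {a ／ b} {c ／ d} e e′ = begin
      (z K.- w) K.* ι (b *ₚ d)
        ≈⟨ K.*-congˡ (ι-* b d) ⟩
      (z K.- w) K.* (ι b K.* ι d)
        ≈⟨ KS.solve 4 (λ z w b d → (z KS.:- w) KS.:* (b KS.:* d) KS.:= (z KS.:* b) KS.:* d KS.:- (w KS.:* d) KS.:* b) K.refl z w (ι b) (ι d) ⟩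
      (z K.* ι b) K.* ι d K.- (w K.* ι d) K.* ι b
        ≈⟨ K.+-cong (K.*-congʳ e) (K.-‿cong (K.*-congʳ e′)) ⟩
      ι a K.* ι d K.- ι c K.* ι b
        ≈⟨ K.+-cong (ι-* a d) (K.trans (ι-- (c *ₚ b)) (K.-‿cong (ι-* c b))) ⟨
      ι (a *ₚ d) K.+ ι (-ₚ (c *ₚ b))
        ≈⟨ ι-+ (a *ₚ d) (-ₚ (c *ₚ b)) ⟨
      ι (a *ₚ d -ₚ c *ₚ b) ∎

    represents-sum : ∀ (z : ℕ → Fraction) (f : ℕ → Frac) → (∀ k → Represents (z k) (f k)) → ∀ n → Represents (∑ z n) (sumF (map f (upTo n)))
    represents-sum z f e n = subst (λ fs → Represents (∑ z n) (sumF fs)) (sym (map-upTo f n)) (go z f e n)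
      where
      go : ∀ z (f : ℕ → Frac) → (∀ k → Represents (z k) (f k)) → ∀ n → Represents (∑ z n) (sumF (applyUpTo f n))
      go z f e zero    = K.zeroˡ (ι 1ₚ)
      go z f e (suc n) = K.trans (K.*-congʳ (∑-front z n))
        (represents-+ {z 0} {∑ (λ i → z (suc i)) n} {f 0} {sumF (applyUpTo (λ i → f (suc i)) n)} (e 0)
          (go (λ i → z (suc i)) (λ i → f (suc i)) (λ k → e (suc k)) n))

    summand₁ : ℕ → Fraction
    summand₁ = summand regular-denom

    1-q : Fraction
    1-q = K.1# K.- ι q EK.^ 1

    [1-q]⁻¹ : Fraction
    [1-q]⁻¹ = proj₁ (unit-1-q^ 0)

    ι[1-q] : ι (1ₚ -ₚ q ^ 1) ≃ 1-q
    ι[1-q] = ι-1-^ q 1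

    qint-1-q : ∀ m → (1ₚ -ₚ q ^ 1) *ₚ qint m ≋ 1ₚ -ₚ q ^ m
    qint-1-q m = ≋-trans (PS.solve 2 (λ x q → let o = PS.con (+ 1) in (o PS.:- q) PS.:* x PS.:= PS.:- (x PS.:* (q PS.:- o))) P.refl (qint m) (q ^ 1))
      (≋-trans (neg-cong (qint-X m)) (≋-sym (neg-X m)))

    weight-qint : ∀ k → CK.weight k ≃ 1-q K.* ι (qint (8 ℕ.* k ℕ.+ 1))
    weight-qint k = begin
      K.1# K.- ι q K.* (ι q EK.^ k) EK.^ 8
        ≈⟨ ι-1-′ (ι-qt^ k 8) ⟨
      ι (1ₚ -ₚ q *ₚ (q ^ k) ^ 8)
        ≈⟨ ι-cong (+-cong (≋-refl {1ₚ}) (neg-cong exponent-eq)) ⟩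
      ι (1ₚ -ₚ q ^ (8 ℕ.* k ℕ.+ 1))
        ≈⟨ ι-cong (qint-1-q (8 ℕ.* k ℕ.+ 1)) ⟨
      ι ((1ₚ -ₚ q ^ 1) *ₚ qint (8 ℕ.* k ℕ.+ 1))
        ≈⟨ ι-*′ ι[1-q] K.refl ⟩
      1-q K.* ι (qint (8 ℕ.* k ℕ.+ 1)) ∎
      where
      exponent-eq : q *ₚ (q ^ k) ^ 8 ≋ q ^ (8 ℕ.* k ℕ.+ 1)
      exponent-eq = ≋-trans (*-congˡ q (^-assocʳ q k 8)) (^-congʳ q (trans (cong suc (ℕ.*-comm k 8)) (ℕ.+-comm 1 (8 ℕ.* k))))

    scaled : ℕ → Fraction
    scaled k = [1-q]⁻¹ K.* (CK.weight k K.* summand₁ k)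

    1-q-cancel : ∀ x → 1-q K.* ([1-q]⁻¹ K.* x) ≃ x
    1-q-cancel x = K.trans (K.sym (K.*-assoc 1-q [1-q]⁻¹ x)) (K.trans (K.*-congʳ (proj₂ (unit-1-q^ 0))) (K.*-identityˡ x))

    scaled-represents : ∀ k → Represents (scaled k) (reduced k)
    scaled-represents k = unit-cancel (unit-ι (regular-denom k)) (begin
      [1-q]⁻¹ K.* (CK.weight k K.* summand₁ k) K.* ι (reducedDen k) K.* ι (denom k)
        ≈⟨ K.*-congʳ (K.*-congʳ (K.*-congˡ (K.*-congʳ (weight-qint k)))) ⟩
      [1-q]⁻¹ K.* ((1-q K.* w) K.* summand₁ k) K.* ι (reducedDen k) K.* ι (denom k)
        ≈⟨ KS.solve 6 (λ v u w s d b → v KS.:* ((u KS.:* w) KS.:* s) KS.:* d KS.:* b KS.:= (u KS.:* (v KS.:* w)) KS.:* ((s KS.:* b) KS.:* d)) K.refl [1-q]⁻¹ 1-q w (summand₁ k) (ι (reducedDen k)) (ι (denom k)) ⟩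
      (1-q K.* ([1-q]⁻¹ K.* w)) K.* ((summand₁ k K.* ι (denom k)) K.* ι (reducedDen k))
        ≈⟨ K.*-cong (1-q-cancel w) (K.*-congʳ (bot*fraction (summand₁ k))) ⟩
      w K.* (ι (numer k) K.* ι (reducedDen k))
        ≈⟨ K.trans (ι-* (qint (8 ℕ.* k ℕ.+ 1)) (numer k *ₚ reducedDen k)) (K.*-congˡ (ι-* (numer k) (reducedDen k))) ⟨
      ι (qint (8 ℕ.* k ℕ.+ 1) *ₚ (numer k *ₚ reducedDen k))
        ≈⟨ ι-cong (≋-trans (PS.solve 5 (λ w a b z d → w PS.:* (((a PS.:* a) PS.:* b PS.:* z) PS.:* d) PS.:= (a PS.:* a) PS.:* b PS.:* w PS.:* z PS.:* d) P.refl
             (qint (8 ℕ.* k ℕ.+ 1)) (A k) (A (2 ℕ.* k)) (q ^ (2 ℕ.* k ℕ.* k)) (reducedDen k)) (reduce regular-1-q^ k (qint (8 ℕ.* k ℕ.+ 1)) (q ^ (2 ℕ.* k ℕ.* k)))) ⟩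
      ι (reducedNum k *ₚ denom k)
        ≈⟨ ι-* (reducedNum k) (denom k) ⟩
      ι (reducedNum k) K.* ι (denom k) ∎)
      where
      w = ι (qint (8 ℕ.* k ℕ.+ 1))

-- Orders of 1 - q^i at the cyclotomic polynomials

module CyclotomicOrders where
  open import Defs
  import Data.Integer.Divisibility.Signed as ℤ
  open ≡ hiding ([_])
  open NaturalSums
  open CubicCongruence
  open PolynomialRing
  open Squarefreeness
  open ExactDivision
  open Cyclotomic
  open ReducedTerms
  open Representation
  open Localisation polyRing
  open Algebra.Properties.Semiring.Exp P.semiring using (_^_)
  open Pochhammer polyRing q
  open LocalSummand polyRing q

  φ-constant : ∀ d → coeff (φ (suc d)) 0 ≢ 0ℤ
  φ-constant d φ₀≡0 = absurd (trans (sym (coeff-X-0 d)) (trans (sym (at (proj₁ (factorised (suc d) (s≤s z≤n))) 0))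
      (trans (coeff-*-zero (φ (suc d)) (properProduct (suc d))) (trans (cong (λ z → z ℤ.* coeff (properProduct (suc d)) 0) φ₀≡0) (ℤ.*-zeroˡ (coeff (properProduct (suc d)) 0))))))
    where
    absurd : ¬ (-1ℤ ≡ 0ℤ)
    absurd ()

  regular-φ : ∀ d → Regular (φ (suc d))
  regular-φ d = regular-constant (φ-constant d)

  module Factors {N} = Below N (λ m 1≤m _ → factorised m 1≤m)

  φ∣X : ∀ {d} → 1 ≤ d → φ d ∣ X d
  φ∣X {d} 1≤d = Factors.φ∣X {d} 1≤d ℕ.≤-refl

  coprime-φ-X : ∀ {d i} → 1 ≤ d → ¬ (d ℕ.∣ i) → Coprime (φ d) (X i)
  coprime-φ-X {d} 1≤d = Factors.coprime-X {d} 1≤d ℕ.≤-refl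

  coprime-neg : ∀ {p r} → Coprime p r → Coprime p (-ₚ r)
  coprime-neg {p} {r} c f h = c f (∣-resp (PS.solve 2 (λ f r → PS.:- (f PS.:* (PS.:- r)) PS.:= f PS.:* r) P.refl f r) (∣-neg h))

  -- Modulo `φ d` the power q^(d-1) is an inverse of q.
  coprime-φ-q : ∀ {d} → 1 ≤ d → Coprime (φ d) q
  coprime-φ-q {suc d} 1≤d f h = ∣-resp (PS.solve 3 (λ f q x → f PS.:* q PS.:* x PS.:- f PS.:* (q PS.:* x PS.:- PS.con (+ 1)) PS.:= f) P.refl f q (q ^ d))
    (∣-+ (∣-*ʳ (q ^ d) h) (∣-neg (∣-*ˡ f (φ∣X 1≤d))))

  module AtDivisor (h e : ℕ) (d∣n : suc (suc e) ℕ.∣ suc (2 ℕ.* h)) (s6 : ℤ) (d∣1+6s : + suc (suc e) ℤ.∣ + 1 ℤ.+ + 6 ℤ.* s6) where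
    d n : ℕ
    d = suc (suc e)
    n = suc (2 ℕ.* h)

    d∣n′ : + d ℤ.∣ + n
    d∣n′ = ℤ.∣ᵤ⇒∣ d∣n

    open LocalRing polyRing (φ d) (regular-φ (suc e)) using (Local; local; ι∈; invertible-ι; Order≥⇒∣)
    open Counting d n d∣n′ using (δ; δ-yes; δ-no)
    open Valuation fractions Local local (ι (φ d)) (ι∈ (φ d)) (unit-ι (regular-φ (suc e)))

    invertible-q : Invertible (ι q)
    invertible-q = invertible-ι regular-q (coprime-φ-q {d} (s≤s z≤n))

    1-q^≃ : ∀ i → ι (-ₚ X (suc i)) ≃ K.1# K.- ι q EK.^ suc i
    1-q^≃ i = K.trans (ι-cong (≋-sym (neg-X (suc i)))) (ι-1-^ q (suc i))

    order-nonmultiple : ∀ i → ¬ (d ℕ.∣ suc i) → Order 0 (K.1# K.- ι q EK.^ suc i)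
    order-nonmultiple i d∤i = Order-resp (1-q^≃ i)
      (Invertible⇒Order (invertible-ι (regular-neg (regular-X i)) (coprime-neg (coprime-φ-X {d} (s≤s z≤n) d∤i))))

    -- The order is exactly 1 since, by squarefreeness, the cofactor c is coprime with `φ d` and
    -- hence invertible locally.
    order-multiple : ∀ i → φ d ∣ X (suc i) → Order 1 (K.1# K.- ι q EK.^ suc i)
    order-multiple i (c , X≋cφ) = Order-resp (1-q^≃ i)
      (order (ι (-ₚ c)) (invertible-ι (regular-neg regular-c) (coprime-neg coprime-c))
        (K.trans (ι-cong -X≋) (K.trans (ι-* (φ d) (-ₚ c)) (K.*-congʳ (K.sym (K.*-identityʳ (ι (φ d))))))))
      where
      regular-c : Regular c
      regular-c y yc≋0 = regular-X i y (≋-trans (*-congˡ y X≋cφ) (≋-trans (≋-sym (*-assoc y c (φ d))) (*-congʳ (φ d) yc≋0)))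
      coprime-c : Coprime (φ d) c
      coprime-c = factors-coprime i {φ d} {c} (≋-trans (*-comm (φ d) c) (≋-sym X≋cφ))
      -X≋ : -ₚ X (suc i) ≋ φ d *ₚ (-ₚ c)
      -X≋ = ≋-trans (neg-cong X≋cφ) (PS.solve 2 (λ c f → PS.:- (c PS.:* f) PS.:= f PS.:* (PS.:- c)) P.refl c (φ d))

    order-1-q^ : ∀ i → Order (δ (+ suc i)) (K.1# K.- ι q EK.^ suc i)
    order-1-q^ i = case d ℕ.∣? suc i of λ
      { (no d∤i)  → subst (λ k → Order k (K.1# K.- ι q EK.^ suc i)) (sym (δ-no (λ h → d∤i (ℤ.∣⇒∣ᵤ h)))) (order-nonmultiple i d∤i)
      ; (yes d∣i) → subst (λ k → Order k (K.1# K.- ι q EK.^ suc i)) (sym (δ-yes (ℤ.∣ᵤ⇒∣ d∣i))) (order-multiple i (∣-trans (φ∣X {d} (s≤s z≤n)) (X-∣ d∣i))) }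

    open Congruence fractions Local local (ι (φ d)) (ι∈ (φ d)) (unit-ι (regular-φ (suc e))) (ι q) unit-q unit-1-q^ h d d∣n′ s6 d∣1+6s invertible-q order-1-q^
      using (congruence₁; congruence₃) public

    δ-1 : δ (+ 1) ≡ 0
    δ-1 = δ-no {+ 1} λ h → absurd (ℕ.∣1⇒≡1 (ℤ.∣⇒∣ᵤ h))
      where
      absurd : ¬ (suc (suc e) ≡ 1)
      absurd ()

    Order-1-q : Order 0 1-q
    Order-1-q = subst (λ k → Order k 1-q) δ-1 (order-1-q^ 0)

    module _ (v w : Fraction) (wv : 1-q K.* w ≃ v) (z : Fraction) (w≃z : w ≃ z) where
      -- As d > 1, the factor 1 - q has order 0, so removing it from v keeps the order; the order
      -- then passes to the numerator of any fraction equal to w.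
      order⇒∣ : ∀ {k} → Order≥ k v → φ d ^ k ∣ Fraction.top z
      order⇒∣ {k} o = Order≥⇒∣ k z (Order≥-resp w≃z (Order≥-quotient (K.trans (K.*-comm w 1-q) wv) Order-1-q o refl))

-- Coprimality of the reduced denominators with the modulus

module InvertibleDenominators where
  open import Defs
  import Data.Integer.Divisibility.Signed as ℤ
  open ≡ hiding ([_])
  open PolynomialRing
  open Squarefreeness
  open ExactDivision
  open Cyclotomic
  open JacobiSymbol
  open ReducedTerms
  open Representation
  open CyclotomicOrders
  open Localisation polyRing
  open Algebra.Properties.Semiring.Exp P.semiring using (_^_; ^-homo-*; ^-assocʳ; ^-congʳ)
  open Pochhammer polyRing q
  open LocalSummand polyRing q
  open CubicSum fractions (ι q) using (χ)

  χ-ψ : ∀ h → χ h ≡ ψ (suc (2 ℕ.* h))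
  χ-ψ 0 = refl
  χ-ψ 1 = refl
  χ-ψ 2 = refl
  χ-ψ (suc (suc (suc h))) = trans (χ-ψ h) (sym (cong ψ (lemma h)))
    where
    lemma : ∀ h → suc (2 ℕ.* (3 ℕ.+ h)) ≡ 6 ℕ.+ suc (2 ℕ.* h)
    lemma = solveℕ-∀

  ι-χ : ∀ h → KS.⟦ χ h ⟧ℤ ≃ ι (const (χ h))
  ι-χ 0 = K.refl
  ι-χ 1 = ι-cong (pointwise λ { zero → refl ; (suc i) → refl })
  ι-χ 2 = K.sym (ι-- 1ₚ)
  ι-χ (suc (suc (suc h))) = ι-χ h

  -- Invertibility modulo qⁿ - 1 over ℚ, kept in ℤ[q] as a nonzero integer in the ideal of p and qⁿ
  -- - 1. The integer is 2 or 3 for the factors of the reduced denominators, and the property passes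
  -- to products.
  record IntegrallyInvertible (n : ℕ) (p : Poly) : Set where
    constructor integrally-invertible
    field
      isRegular : Regular p
      inverse multiple : Poly
      constant : ℤ
      constant≢0 : constant ≢ 0ℤ
      equation : inverse *ₚ p +ₚ multiple *ₚ X n ≋ const constant

  const-*-const : ∀ a b → const (a ℤ.* b) ≋ const a *ₚ const b
  const-*-const a b = ≋-sym (const-* a (const b))

  invertible-* : ∀ {n p r} → IntegrallyInvertible n p → IntegrallyInvertible n r → IntegrallyInvertible n (p *ₚ r)
  invertible-* {n} {p} {r} (integrally-invertible rp u v a a≢0 e) (integrally-invertible rr u′ v′ b b≢0 e′) =
    integrally-invertible (regular-* rp rr) (u *ₚ u′) (v *ₚ const b +ₚ u *ₚ p *ₚ v′) (a ℤ.* b) ab≢0 (begin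
      u *ₚ u′ *ₚ (p *ₚ r) +ₚ (v *ₚ const b +ₚ u *ₚ p *ₚ v′) *ₚ X n
        ≈⟨ PS.solve 8 (λ u u′ p r v v′ b x → u PS.:* u′ PS.:* (p PS.:* r) PS.:+ (v PS.:* b PS.:+ u PS.:* p PS.:* v′) PS.:* x
             PS.:= u PS.:* p PS.:* (u′ PS.:* r PS.:+ v′ PS.:* x) PS.:+ v PS.:* b PS.:* x) P.refl u u′ p r v v′ (const b) (X n) ⟩
      u *ₚ p *ₚ (u′ *ₚ r +ₚ v′ *ₚ X n) +ₚ v *ₚ const b *ₚ X n
        ≈⟨ +-cong (*-congˡ (u *ₚ p) e′) ≋-refl ⟩
      u *ₚ p *ₚ const b +ₚ v *ₚ const b *ₚ X n
        ≈⟨ PS.solve 5 (λ u p b v x → u PS.:* p PS.:* b PS.:+ v PS.:* b PS.:* x PS.:= (u PS.:* p PS.:+ v PS.:* x) PS.:* b) P.refl u p (const b) v (X n) ⟩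
      (u *ₚ p +ₚ v *ₚ X n) *ₚ const b
        ≈⟨ *-congʳ (const b) e ⟩
      const a *ₚ const b
        ≈⟨ const-*-const a b ⟨
      const (a ℤ.* b) ∎)
    where
    open Relation.Binary.Reasoning.Setoid P.setoid
    ab≢0 : a ℤ.* b ≢ 0ℤ
    ab≢0 ab≡0 with ℤ.i*j≡0⇒i≡0∨j≡0 a ab≡0
    ... | inj₁ a≡0 = a≢0 a≡0
    ... | inj₂ b≡0 = b≢0 b≡0

  invertible-1 : ∀ {n} → IntegrallyInvertible n 1ₚ
  invertible-1 {n} = integrally-invertible regular-1 1ₚ 0ₚ 1ℤ (λ ()) (≋-trans (+-identityʳ (1ₚ *ₚ 1ₚ)) (*-identityˡ 1ₚ))

  invertible-∏ : ∀ {n} f k → (∀ j → IntegrallyInvertible n (f j)) → IntegrallyInvertible n (Ranges.∏ polyRing f k)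
  invertible-∏ f zero    i = invertible-1
  invertible-∏ f (suc k) i = invertible-* (invertible-∏ f k i) (i k)

  power-∣ : ∀ y m → ∃ λ g → y ^ m -ₚ 1ₚ ≋ (y -ₚ 1ₚ) *ₚ g
  power-∣ y zero    = 0ₚ , ≋-trans (P.-‿inverseʳ 1ₚ) (≋-sym (*-[] (y -ₚ 1ₚ)))
  power-∣ y (suc m) with power-∣ y m
  ... | g , e = g *ₚ y +ₚ 1ₚ , (begin
    y *ₚ y ^ m -ₚ 1ₚ                 ≈⟨ PS.solve 2 (λ y x → let o = PS.con (+ 1) in y PS.:* x PS.:- o PS.:= (x PS.:- o) PS.:* y PS.:+ (y PS.:- o)) P.refl y (y ^ m) ⟩
    (y ^ m -ₚ 1ₚ) *ₚ y +ₚ (y -ₚ 1ₚ)  ≈⟨ +-cong (*-congʳ y e) ≋-refl ⟩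
    (y -ₚ 1ₚ) *ₚ g *ₚ y +ₚ (y -ₚ 1ₚ) ≈⟨ PS.solve 3 (λ a g y → a PS.:* g PS.:* y PS.:+ a PS.:= a PS.:* (g PS.:* y PS.:+ PS.con (+ 1))) P.refl (y -ₚ 1ₚ) g y ⟩
    (y -ₚ 1ₚ) *ₚ (g *ₚ y +ₚ 1ₚ)      ∎)
    where open Relation.Binary.Reasoning.Setoid P.setoid

  q^n-1 : ∀ a n → ∃ λ c → (q ^ a) ^ n -ₚ 1ₚ ≋ c *ₚ X n
  q^n-1 a n with X-∣ {n} {a ℕ.* n} (ℕ.divides a refl)
  ... | c , e = c , ≋-trans (+-cong (^-assocʳ q a n) ≋-refl) e

  regular-positive : ∀ {p} → coeff p 0 ≡ 1ℤ → Regular p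
  regular-positive e = regular-constant λ z → absurd (trans (sym e) z)
    where
    absurd : ¬ (1ℤ ≡ 0ℤ)
    absurd ()

  q^suc-constant : ∀ a → coeff (q ^ suc a) 0 ≡ 0ℤ
  q^suc-constant a = trans (coeff-*-zero q (q ^ a)) (ℤ.*-zeroˡ (coeff (q ^ a) 0))

  -- 1 + y divides 1 + yⁿ ≡ 2 for odd n.
  invertible-1+q^ : ∀ h a → IntegrallyInvertible (suc (2 ℕ.* h)) (1ₚ +ₚ q ^ suc a)
  invertible-1+q^ h a = integrally-invertible
      (regular-positive (trans (coeff-+ 1ₚ (q ^ suc a) 0) (cong (λ z → 1ℤ ℤ.+ z) (q^suc-constant a))))
      -- With (y²)^h - 1 = (y² - 1) g, the first witness times 1 + y is 1 + yⁿ; subtracting yⁿ - 1 =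
      -- c (qⁿ - 1) leaves 2.
      (y *ₚ (y -ₚ 1ₚ) *ₚ g +ₚ 1ₚ) (-ₚ c) (+ 2) (λ ()) (begin
    (y *ₚ (y -ₚ 1ₚ) *ₚ g +ₚ 1ₚ) *ₚ (1ₚ +ₚ y) +ₚ (-ₚ c) *ₚ X n
      ≈⟨ PS.solve 4 (λ y g c x → let o = PS.con (+ 1) in
           (y PS.:* (y PS.:- o) PS.:* g PS.:+ o) PS.:* (o PS.:+ y) PS.:+ (PS.:- c) PS.:* x
           PS.:= y PS.:* ((y PS.:^ 2 PS.:- o) PS.:* g) PS.:+ o PS.:+ y PS.:- c PS.:* x) P.refl y g c (X n) ⟩
    y *ₚ ((y ^ 2 -ₚ 1ₚ) *ₚ g) +ₚ 1ₚ +ₚ y -ₚ c *ₚ X n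
      ≈⟨ +-cong (+-cong (+-cong (*-congˡ y (≋-sym eg)) ≋-refl) ≋-refl) (neg-cong (≋-sym ec)) ⟩
    y *ₚ ((y ^ 2) ^ h -ₚ 1ₚ) +ₚ 1ₚ +ₚ y -ₚ (y *ₚ y ^ (2 ℕ.* h) -ₚ 1ₚ)
      ≈⟨ +-cong ≋-refl (neg-cong (+-cong (*-congˡ y (≋-sym (^-assocʳ y 2 h))) ≋-refl)) ⟩
    y *ₚ ((y ^ 2) ^ h -ₚ 1ₚ) +ₚ 1ₚ +ₚ y -ₚ (y *ₚ (y ^ 2) ^ h -ₚ 1ₚ)
      ≈⟨ PS.solve 2 (λ y x → let o = PS.con (+ 1) in
           y PS.:* (x PS.:- o) PS.:+ o PS.:+ y PS.:- (y PS.:* x PS.:- o) PS.:= PS.con (+ 2)) P.refl y ((y ^ 2) ^ h) ⟩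
    const (+ 2) ∎)
    where
    open Relation.Binary.Reasoning.Setoid P.setoid
    n = suc (2 ℕ.* h)
    y = q ^ suc a
    g = proj₁ (power-∣ (y ^ 2) h)
    eg = proj₂ (power-∣ (y ^ 2) h)
    c = proj₁ (q^n-1 (suc a) n)
    ec = proj₂ (q^n-1 (suc a) n)

  -- 1 + y + y² divides 1 + yⁿ + y²ⁿ ≡ 3 for n prime to 3.
  module _ {n a : ℕ} where
    private
      y p Y : Poly
      y = q ^ suc a
      p = 1ₚ +ₚ y +ₚ y *ₚ y
      Y = y ^ n

    invertible-from : ∀ w → w *ₚ p ≋ 1ₚ +ₚ Y +ₚ Y *ₚ Y → IntegrallyInvertible n p
    invertible-from w e with q^n-1 (suc a) n
    ... | c , ec = integrally-invertible
      (regular-positive (trans (coeff-+ (1ₚ +ₚ y) (y *ₚ y) 0) (cong₂ ℤ._+_ (trans (coeff-+ 1ₚ y 0) (cong (λ z → 1ℤ ℤ.+ z) (q^suc-constant a)))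
        (trans (coeff-*-zero y y) (cong₂ ℤ._*_ (q^suc-constant a) (q^suc-constant a))))))
      w (-ₚ ((Y +ₚ const (+ 2)) *ₚ c)) (+ 3) (λ ()) (begin
        w *ₚ p +ₚ (-ₚ ((Y +ₚ const (+ 2)) *ₚ c)) *ₚ X n
          ≈⟨ +-cong e (PS.solve 3 (λ z c x → (PS.:- (z PS.:* c)) PS.:* x PS.:= PS.:- (z PS.:* (c PS.:* x))) P.refl (Y +ₚ const (+ 2)) c (X n)) ⟩
        1ₚ +ₚ Y +ₚ Y *ₚ Y -ₚ (Y +ₚ const (+ 2)) *ₚ (c *ₚ X n)
          ≈⟨ +-cong ≋-refl (neg-cong (*-congˡ (Y +ₚ const (+ 2)) (≋-sym ec))) ⟩
        1ₚ +ₚ Y +ₚ Y *ₚ Y -ₚ (Y +ₚ const (+ 2)) *ₚ (Y -ₚ 1ₚ)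
          ≈⟨ PS.solve 1 (λ y → let o = PS.con (+ 1) in
               o PS.:+ y PS.:+ y PS.:* y PS.:- (y PS.:+ PS.con (+ 2)) PS.:* (y PS.:- o) PS.:= PS.con (+ 3)) P.refl Y ⟩
        const (+ 3) ∎)
      where open Relation.Binary.Reasoning.Setoid P.setoid

    invertible-1+y+y² : ∀ k → n ≡ 1 ℕ.+ 3 ℕ.* k ⊎ n ≡ 2 ℕ.+ 3 ℕ.* k → IntegrallyInvertible n p
    invertible-1+y+y² k cases with power-∣ (y ^ 3) k
    -- With `Y` = yx for x = y^3k, the sum 1 + `Y` + `Y`² exceeds 1 + y + y² by (x - 1)(y + y²(x +
    -- 1)), and x - 1 = (y³ - 1) g is a multiple of `p`.
    invertible-1+y+y² k (inj₁ n≡) | g , e = invertible-from (1ₚ +ₚ (y -ₚ 1ₚ) *ₚ g *ₚ (y +ₚ y ^ 2 *ₚ (x +ₚ 1ₚ))) (begin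
      (1ₚ +ₚ (y -ₚ 1ₚ) *ₚ g *ₚ (y +ₚ y ^ 2 *ₚ (x +ₚ 1ₚ))) *ₚ p
        ≈⟨ PS.solve 3 (λ y g x → let o = PS.con (+ 1) in
             (o PS.:+ (y PS.:- o) PS.:* g PS.:* (y PS.:+ y PS.:^ 2 PS.:* (x PS.:+ o))) PS.:* (o PS.:+ y PS.:+ y PS.:* y)
             PS.:= o PS.:+ y PS.:+ y PS.:* y PS.:+ ((y PS.:^ 3 PS.:- o) PS.:* g) PS.:* (y PS.:+ y PS.:^ 2 PS.:* (x PS.:+ o))) P.refl y g x ⟩
      1ₚ +ₚ y +ₚ y *ₚ y +ₚ ((y ^ 3 -ₚ 1ₚ) *ₚ g) *ₚ (y +ₚ y ^ 2 *ₚ (x +ₚ 1ₚ))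
        ≈⟨ +-cong ≋-refl (*-congʳ (y +ₚ y ^ 2 *ₚ (x +ₚ 1ₚ)) (≋-sym e)) ⟩
      1ₚ +ₚ y +ₚ y *ₚ y +ₚ (x -ₚ 1ₚ) *ₚ (y +ₚ y ^ 2 *ₚ (x +ₚ 1ₚ))
        ≈⟨ PS.solve 2 (λ y x → let o = PS.con (+ 1) in
             o PS.:+ y PS.:+ y PS.:* y PS.:+ (x PS.:- o) PS.:* (y PS.:+ y PS.:^ 2 PS.:* (x PS.:+ o))
             PS.:= o PS.:+ y PS.:* x PS.:+ (y PS.:* x) PS.:* (y PS.:* x)) P.refl y x ⟩
      1ₚ +ₚ y *ₚ x +ₚ (y *ₚ x) *ₚ (y *ₚ x)
        ≈⟨ +-cong (+-cong (≋-refl {1ₚ}) Y≋) (P.*-cong Y≋ Y≋) ⟨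
      1ₚ +ₚ Y +ₚ Y *ₚ Y ∎)
      where
      open Relation.Binary.Reasoning.Setoid P.setoid
      x = (y ^ 3) ^ k
      Y≋ : Y ≋ y *ₚ x
      Y≋ = ≋-trans (^-congʳ y n≡) (*-congˡ y (≋-sym (^-assocʳ y 3 k)))
    -- Now `Y` = y²x, and the comparison is with 1 + y² + y⁴ = (1 - y + y²)(1 + y + y²).
    invertible-1+y+y² k (inj₂ n≡) | g , e = invertible-from ((1ₚ -ₚ y +ₚ y *ₚ y) +ₚ (y -ₚ 1ₚ) *ₚ g *ₚ (y ^ 2 +ₚ y ^ 4 *ₚ (x +ₚ 1ₚ))) (begin
      ((1ₚ -ₚ y +ₚ y *ₚ y) +ₚ (y -ₚ 1ₚ) *ₚ g *ₚ (y ^ 2 +ₚ y ^ 4 *ₚ (x +ₚ 1ₚ))) *ₚ p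
        ≈⟨ PS.solve 3 (λ y g x → let o = PS.con (+ 1) in
             ((o PS.:- y PS.:+ y PS.:* y) PS.:+ (y PS.:- o) PS.:* g PS.:* (y PS.:^ 2 PS.:+ y PS.:^ 4 PS.:* (x PS.:+ o))) PS.:* (o PS.:+ y PS.:+ y PS.:* y)
             PS.:= o PS.:+ y PS.:^ 2 PS.:+ y PS.:^ 4 PS.:+ ((y PS.:^ 3 PS.:- o) PS.:* g) PS.:* (y PS.:^ 2 PS.:+ y PS.:^ 4 PS.:* (x PS.:+ o))) P.refl y g x ⟩
      1ₚ +ₚ y ^ 2 +ₚ y ^ 4 +ₚ ((y ^ 3 -ₚ 1ₚ) *ₚ g) *ₚ (y ^ 2 +ₚ y ^ 4 *ₚ (x +ₚ 1ₚ))
        ≈⟨ +-cong ≋-refl (*-congʳ (y ^ 2 +ₚ y ^ 4 *ₚ (x +ₚ 1ₚ)) (≋-sym e)) ⟩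
      1ₚ +ₚ y ^ 2 +ₚ y ^ 4 +ₚ (x -ₚ 1ₚ) *ₚ (y ^ 2 +ₚ y ^ 4 *ₚ (x +ₚ 1ₚ))
        ≈⟨ PS.solve 2 (λ y x → let o = PS.con (+ 1) in
             o PS.:+ y PS.:^ 2 PS.:+ y PS.:^ 4 PS.:+ (x PS.:- o) PS.:* (y PS.:^ 2 PS.:+ y PS.:^ 4 PS.:* (x PS.:+ o))
             PS.:= o PS.:+ y PS.:* (y PS.:* x) PS.:+ (y PS.:* (y PS.:* x)) PS.:* (y PS.:* (y PS.:* x))) P.refl y x ⟩
      1ₚ +ₚ y *ₚ (y *ₚ x) +ₚ (y *ₚ (y *ₚ x)) *ₚ (y *ₚ (y *ₚ x))
        ≈⟨ +-cong (+-cong (≋-refl {1ₚ}) Y≋) (P.*-cong Y≋ Y≋) ⟨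
      1ₚ +ₚ Y +ₚ Y *ₚ Y ∎)
      where
      open Relation.Binary.Reasoning.Setoid P.setoid
      x = (y ^ 3) ^ k
      Y≋ : Y ≋ y *ₚ (y *ₚ x)
      Y≋ = ≋-trans (^-congʳ y n≡) (*-congˡ y (*-congˡ y (≋-sym (^-assocʳ y 3 k))))

  regular-q^ : ∀ k → Regular (q ^ k)
  regular-q^ zero    = regular-1
  regular-q^ (suc k) = regular-* regular-q (regular-q^ k)

  invertible-resp : ∀ {n p r} → p ≋ r → IntegrallyInvertible n p → IntegrallyInvertible n r
  invertible-resp {n} {p} {r} e (integrally-invertible rp u v c c≢0 eq) = integrally-invertible (regular-resp e rp) u v c c≢0 (≋-trans (+-cong (*-congˡ u (≋-sym e)) ≋-refl) eq)

  -- The inverse of q^h modulo qⁿ - 1 is q^(h+1), as n = 2h + 1.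
  invertible-qpow : ∀ h → IntegrallyInvertible (suc (2 ℕ.* h)) (qpow h)
  invertible-qpow h = invertible-resp (≋-sym (qpow-≋ h)) (integrally-invertible (regular-q^ h) (q ^ suc h) (-ₚ 1ₚ) 1ℤ (λ ()) (begin
    q ^ suc h *ₚ q ^ h +ₚ (-ₚ 1ₚ) *ₚ (q ^ suc (2 ℕ.* h) -ₚ 1ₚ)
      ≈⟨ +-cong (≋-sym (^-homo-* q (suc h) h)) ≋-refl ⟩
    q ^ (suc h ℕ.+ h) +ₚ (-ₚ 1ₚ) *ₚ (q ^ suc (2 ℕ.* h) -ₚ 1ₚ)
      ≡⟨ cong (λ k → q ^ k +ₚ (-ₚ 1ₚ) *ₚ (q ^ suc (2 ℕ.* h) -ₚ 1ₚ)) (lemma h) ⟩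
    q ^ suc (2 ℕ.* h) +ₚ (-ₚ 1ₚ) *ₚ (q ^ suc (2 ℕ.* h) -ₚ 1ₚ)
      ≈⟨ PS.solve 1 (λ x → let o = PS.con (+ 1) in x PS.:+ (PS.:- o) PS.:* (x PS.:- o) PS.:= o) P.refl (q ^ suc (2 ℕ.* h)) ⟩
    1ₚ ∎))
    where
    open Relation.Binary.Reasoning.Setoid P.setoid
    lemma : ∀ h → suc h ℕ.+ h ≡ suc (2 ℕ.* h)
    lemma = solveℕ-∀

  ∣ₚ⇒∣ : ∀ {p r} → p ∣ₚ r → p ∣ r
  ∣ₚ⇒∣ (c , e) = c , pointwise e

  ∣⇒∣ₚ : ∀ {p r} → p ∣ r → p ∣ₚ r
  ∣⇒∣ₚ (c , e) = c , at e

  divisor-of-constant : ∀ {d c} → c ≢ 0ℤ → d ∣ const c → ∃ λ d₀ → d ≋ const d₀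
  divisor-of-constant {d} {c} c≢0 (w , e) with lead? d | lead? w
  ... | inj₁ d≋[] | _ = ⊥-elim (c≢0 (at (≋-trans e (≋-trans (*-congˡ w d≋[]) (*-[] w))) 0))
  ... | inj₂ _ | inj₁ w≋[] = ⊥-elim (c≢0 (at (≋-trans e (*-congʳ d w≋[])) 0))
  ... | inj₂ (k , x , ld) | inj₂ (l , y , lw) = x , result (ℕ.m+n≡0⇒n≡0 l (proj₁ (lead-unique (lead-* lw ld) (lead-resp e lc))))
    where
    lc : Lead (const c) 0 c
    lc = lead refl c≢0 λ { (suc i) _ → refl }
    result : k ≡ 0 → d ≋ const x
    result refl = pointwise λ { zero → Lead.leading ld ; (suc i) → Lead.vanishes ld (suc i) (s≤s z≤n) }

  -- Cubing u p + v x = c, where x = `X (suc n)`, puts c³ into the ideal of p and x³, so d divides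
  -- c³ and is constant by degree. A constant that divides x³ divides its constant term -1.
  unit-of : ∀ {n p d} → IntegrallyInvertible (suc n) p → d ∣ p → d ∣ X (suc n) *ₚ (X (suc n) *ₚ X (suc n)) → IsUnitₚ d
  unit-of {n} {p} {d} (integrally-invertible _ u v c c≢0 eq) d∣p d∣X³ = unit (divisor-of-constant c³≢0 d∣c³)
    where
    open Relation.Binary.Reasoning.Setoid P.setoid
    x = X (suc n)
    c³≢0 : c ℤ.* (c ℤ.* c) ≢ 0ℤ
    c³≢0 e with ℤ.i*j≡0⇒i≡0∨j≡0 c e
    ... | inj₁ c≡0 = c≢0 c≡0
    ... | inj₂ cc≡0 with ℤ.i*j≡0⇒i≡0∨j≡0 c cc≡0
    ...   | inj₁ c≡0 = c≢0 c≡0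
    ...   | inj₂ c≡0 = c≢0 c≡0
    d∣c³ : d ∣ const (c ℤ.* (c ℤ.* c))
    d∣c³ = ∣-resp (begin
      (u *ₚ (u *ₚ p *ₚ (u *ₚ p) +ₚ const (+ 3) *ₚ (u *ₚ p) *ₚ (v *ₚ x) +ₚ const (+ 3) *ₚ (v *ₚ x) *ₚ (v *ₚ x))) *ₚ p +ₚ (v *ₚ (v *ₚ v)) *ₚ (x *ₚ (x *ₚ x))
        ≈⟨ PS.solve 4 (λ u p v x → let t = PS.con (+ 3) in
             (u PS.:* (u PS.:* p PS.:* (u PS.:* p) PS.:+ t PS.:* (u PS.:* p) PS.:* (v PS.:* x) PS.:+ t PS.:* (v PS.:* x) PS.:* (v PS.:* x))) PS.:* p PS.:+ (v PS.:* (v PS.:* v)) PS.:* (x PS.:* (x PS.:* x))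
             PS.:= (u PS.:* p PS.:+ v PS.:* x) PS.:* ((u PS.:* p PS.:+ v PS.:* x) PS.:* (u PS.:* p PS.:+ v PS.:* x))) P.refl u p v x ⟩
      (u *ₚ p +ₚ v *ₚ x) *ₚ ((u *ₚ p +ₚ v *ₚ x) *ₚ (u *ₚ p +ₚ v *ₚ x))
        ≈⟨ P.*-cong eq (P.*-cong eq eq) ⟩
      const c *ₚ (const c *ₚ const c)
        ≈⟨ ≋-trans (const-*-const c (c ℤ.* c)) (*-congˡ (const c) (const-*-const c c)) ⟨
      const (c ℤ.* (c ℤ.* c)) ∎)
      (∣-+ (∣-*ˡ (u *ₚ (u *ₚ p *ₚ (u *ₚ p) +ₚ const (+ 3) *ₚ (u *ₚ p) *ₚ (v *ₚ x) +ₚ const (+ 3) *ₚ (v *ₚ x) *ₚ (v *ₚ x))) d∣p) (∣-*ˡ (v *ₚ (v *ₚ v)) d∣X³))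
    unit : (∃ λ d₀ → d ≋ const d₀) → IsUnitₚ d
    unit (d₀ , d≋) = decide (unit-ℤ d₀ (coeff (proj₁ d∣X³) 0) (inj₂ (trans (ℤ.*-comm d₀ _) (trans (sym (trans (at (proj₂ d∣X³) 0)
        (trans (coeff-*-zero (proj₁ d∣X³) d) (cong (coeff (proj₁ d∣X³) 0 ℤ.*_) (at d≋ 0)))))
        (trans (coeff-*-zero x (x *ₚ x)) (trans (cong (coeff x 0 ℤ.*_) (coeff-*-zero x x)) (cong (λ z → z ℤ.* (z ℤ.* z)) (coeff-X-0 n))))))))
      where
      decide : d₀ ≡ 1ℤ ⊎ d₀ ≡ -1ℤ → IsUnitₚ d
      decide (inj₁ refl) = inj₁ (at d≋)
      decide (inj₂ refl) = inj₂ (at d≋)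

-- Assembling the divisors of the modulus

module Conclusion where
  open import Defs
  import Data.Integer.Divisibility.Signed as ℤ
  open import Data.Nat.Coprimality using (Coprime)
  open import Data.List using ([]; _∷_; map; upTo)
  import Data.List.Relation.Unary.All as All
  open ≡ hiding ([_])
  open PolynomialRing
  open Squarefreeness
  open ExactDivision
  open Cyclotomic
  open JacobiSymbol
  open ReducedTerms
  open Representation
  open CyclotomicOrders
  open InvertibleDenominators
  open Localisation polyRing renaming (Coprime to CoprimeTo)
  open Algebra.Properties.Semiring.Exp P.semiring using (_^_)
  open Pochhammer polyRing q
  open LocalSummand polyRing q
  open Ranges fractions using (unit-cancel; ∑; ∑-cong; *-distribˡ-∑)
  open CubicSum fractions (ι q) using (χ; module Evaluation; cubicSum)
  open InterpolatedSum fractions (ι q) unit-q unit-1-q^ using (nodeValue)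

  half : ∀ h → (suc (2 ℕ.* h) ℕ.∸ 1) ℕ./ 2 ≡ h
  half h = trans (cong (ℕ._/ 2) (ℕ.*-comm 2 h)) (ℕ.m*n/n≡m h 2)

  module Odd (h : ℕ) (k : ℕ) (n-mod-3 : suc (2 ℕ.* h) ≡ 1 ℕ.+ 3 ℕ.* k ⊎ suc (2 ℕ.* h) ≡ 2 ℕ.+ 3 ℕ.* k) where
    n : ℕ
    n = suc (2 ℕ.* h)

    3∤n : ¬ (3 ℕ.∣ n)
    3∤n 3∣n = case n-mod-3 of λ
      { (inj₁ e) → ℕ.<⇒≱ (s≤s (s≤s z≤n)) (ℕ.∣⇒≤ (ℕ.∣m+n∣m⇒∣n (subst (3 ℕ.∣_) (trans e (ℕ.+-comm 1 (3 ℕ.* k))) 3∣n) (ℕ.m∣m*n k)))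
      ; (inj₂ e) → ℕ.<⇒≱ (s≤s (s≤s (s≤s z≤n))) (ℕ.∣⇒≤ (ℕ.∣m+n∣m⇒∣n (subst (3 ℕ.∣_) (trans e (ℕ.+-comm 2 (3 ℕ.* k))) 3∣n) (ℕ.m∣m*n k))) }

    2∤n : ¬ (2 ℕ.∣ n)
    2∤n (ℕ.divides c e) = ℕ.even≢odd c h (trans (ℕ.*-comm 2 c) (sym e))

    -- Every d ∣ n divides n² = 1 + 6s, so a single s serves as minus an inverse of 6 for all of
    -- them.
    square : ∃ λ s → n ℕ.* n ≡ 1 ℕ.+ 6 ℕ.* s
    square = case mod3 h of λ
      { (j , inj₁ e)        → 6 ℕ.* j ℕ.* j ℕ.+ 2 ℕ.* j , trans (cong (λ h → suc (2 ℕ.* h) ℕ.* suc (2 ℕ.* h)) e) (lemma₁ j)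
      ; (j , inj₂ (inj₁ e)) → ⊥-elim (3∤n (ℕ.divides (1 ℕ.+ 2 ℕ.* j) (trans (cong (λ h → suc (2 ℕ.* h)) e) (lemma₂ j))))
      ; (j , inj₂ (inj₂ e)) → 6 ℕ.* j ℕ.* j ℕ.+ 10 ℕ.* j ℕ.+ 4 , trans (cong (λ h → suc (2 ℕ.* h) ℕ.* suc (2 ℕ.* h)) e) (lemma₃ j) }
      where
      lemma₁ : ∀ j → suc (2 ℕ.* (3 ℕ.* j)) ℕ.* suc (2 ℕ.* (3 ℕ.* j)) ≡ 1 ℕ.+ 6 ℕ.* (6 ℕ.* j ℕ.* j ℕ.+ 2 ℕ.* j)
      lemma₁ = solveℕ-∀
      lemma₂ : ∀ j → suc (2 ℕ.* (1 ℕ.+ 3 ℕ.* j)) ≡ (1 ℕ.+ 2 ℕ.* j) ℕ.* 3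
      lemma₂ = solveℕ-∀
      lemma₃ : ∀ j → suc (2 ℕ.* (2 ℕ.+ 3 ℕ.* j)) ℕ.* suc (2 ℕ.* (2 ℕ.+ 3 ℕ.* j)) ≡ 1 ℕ.+ 6 ℕ.* (6 ℕ.* j ℕ.* j ℕ.+ 10 ℕ.* j ℕ.+ 4)
      lemma₃ = solveℕ-∀

    jacobi-χ : jacobi (ℤ.- (+ 3)) n ≡ χ h
    jacobi-χ = trans (jacobi-ψ n (s≤s z≤n) 2∤n 3∤n) (sym (χ-ψ h))

    -- Built from the reduced terms, so that its denominator is coprime with the modulus;
    -- `congruence` returns to `lhs n` by cross-multiplication.
    difference : Frac
    difference = sumF (map reduced (upTo n)) -f rhs n

    invertible-difference : IntegrallyInvertible n (den difference)
    invertible-difference = invertible-* (invertible-sum (upTo n)) (subst (λ m → IntegrallyInvertible n (qpow m)) (sym (half h)) (invertible-qpow h))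
      where
      invertible-E : ∀ k → IntegrallyInvertible n (E k)
      invertible-E k = invertible-∏ _ k (invertible-1+q^ h)
      invertible-G : ∀ j → IntegrallyInvertible n (G j)
      invertible-G j = invertible-∏ _ j (λ i → invertible-1+y+y² {n} {i ℕ.+ 1 ℕ.* suc i} k n-mod-3)
      invertible-reduced : ∀ k → IntegrallyInvertible n (reducedDen k)
      invertible-reduced k = invertible-* (invertible-* (invertible-* (invertible-* e e) (invertible-* e e)) (invertible-* e₂ e₂)) (invertible-* (invertible-G k) (invertible-G k))
        where
        e = invertible-E k
        e₂ = invertible-E (2 ℕ.* k)
      invertible-sum : ∀ ks → IntegrallyInvertible n (den (sumF (map reduced ks)))
      invertible-sum []       = invertible-1
      invertible-sum (k ∷ ks) = invertible-* (invertible-reduced k) (invertible-sum ks)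

    regular-difference : Regular (den difference)
    regular-difference = IntegrallyInvertible.isRegular invertible-difference

    module _ where
      open Relation.Binary.Reasoning.Setoid K.setoid
      open Evaluation unit-q unit-1-q^ using (unit-q^; node)

      rhs-represents : Represents ([1-q]⁻¹ K.* nodeValue h) (rhs n)
      rhs-represents = subst (λ m → [1-q]⁻¹ K.* nodeValue h K.* ι (qpow m) ≃ ι (num (rhs n))) (sym (half h)) (begin
        [1-q]⁻¹ K.* (KS.⟦ χ h ⟧ℤ K.* (K.1# K.- node h) K.* v) K.* ι (qpow h)
          ≈⟨ K.*-cong (K.*-congˡ (K.*-congʳ (K.*-congˡ 1-node))) (K.trans (ι-cong (qpow-≋ h)) (ι-^ q h)) ⟩
        [1-q]⁻¹ K.* (KS.⟦ χ h ⟧ℤ K.* (1-q K.* ι (qint n)) K.* v) K.* ι q EK.^ h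
          ≈⟨ KS.solve 6 (λ i c u w v y → i KS.:* (c KS.:* (u KS.:* w) KS.:* v) KS.:* y KS.:= c KS.:* (u KS.:* (i KS.:* w)) KS.:* (y KS.:* v)) K.refl
               [1-q]⁻¹ KS.⟦ χ h ⟧ℤ 1-q (ι (qint n)) v (ι q EK.^ h) ⟩
        KS.⟦ χ h ⟧ℤ K.* (1-q K.* ([1-q]⁻¹ K.* ι (qint n))) K.* (ι q EK.^ h K.* v)
          ≈⟨ K.*-cong (K.*-cong (ι-χ h) (1-q-cancel (ι (qint n)))) (proj₂ (unit-q^ h)) ⟩
        ι (const (χ h)) K.* ι (qint n) K.* K.1#
          ≈⟨ K.*-identityʳ _ ⟩
        ι (const (χ h)) K.* ι (qint n)
          ≈⟨ ι-* (const (χ h)) (qint n) ⟨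
        ι (const (χ h) *ₚ qint n)
          ≡⟨ cong (λ c → ι (const c *ₚ qint n)) (sym jacobi-χ) ⟩
        ι (num (rhs n)) ∎)
        where
        v = proj₁ (unit-q^ h)
        1-node : K.1# K.- node h ≃ 1-q K.* ι (qint n)
        1-node = begin
          K.1# K.- ι q EK.^ n                ≈⟨ ι-1-^ q n ⟨
          ι (1ₚ -ₚ q ^ n)                    ≈⟨ ι-cong (qint-1-q n) ⟨
          ι ((1ₚ -ₚ q ^ 1) *ₚ qint n)        ≈⟨ ι-*′ ι[1-q] K.refl ⟩
          1-q K.* ι (qint n)                 ∎

      w : Fraction
      w = ∑ scaled n K.- [1-q]⁻¹ K.* nodeValue h

      z : Fraction
      z = fraction (num difference) (den difference) regular-difference

      w≃z : w ≃ z
      w≃z = unit-cancel (unit-ι regular-difference) (K.trans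
        (represents-- {∑ scaled n} {[1-q]⁻¹ K.* nodeValue h} {sumF (map reduced (upTo n))} {rhs n} (represents-sum scaled reduced scaled-represents n) rhs-represents)
        (K.sym (bot*fraction z)))

      1-q*w : 1-q K.* w ≃ cubicSum summand₁ n K.- nodeValue h
      1-q*w = begin
        1-q K.* (∑ scaled n K.- [1-q]⁻¹ K.* nodeValue h)
          ≈⟨ KS.solve 3 (λ u x y → u KS.:* (x KS.:- y) KS.:= u KS.:* x KS.:- u KS.:* y) K.refl 1-q (∑ scaled n) ([1-q]⁻¹ K.* nodeValue h) ⟩
        1-q K.* ∑ scaled n K.- 1-q K.* ([1-q]⁻¹ K.* nodeValue h)
          ≈⟨ K.+-cong (K.trans (*-distribˡ-∑ 1-q scaled n) (∑-cong n (λ k _ → 1-q-cancel (CK.weight k K.* summand₁ k)))) (K.-‿cong (1-q-cancel (nodeValue h))) ⟩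
        cubicSum summand₁ n K.- nodeValue h ∎

    module Divisor (e : ℕ) (d∣n : suc (suc e) ℕ.∣ n) where
      d∣1+6s : + suc (suc e) ℤ.∣ + 1 ℤ.+ + 6 ℤ.* + proj₁ square
      d∣1+6s = subst (+ suc (suc e) ℤ.∣_) (trans (cong +_ (proj₂ square)) (cong (λ z → + 1 ℤ.+ z) (ℤ.pos-* 6 (proj₁ square))))
        (ℤ.∣ᵤ⇒∣ (ℕ.∣m⇒∣m*n n d∣n))
      open AtDivisor h e d∣n (+ proj₁ square) d∣1+6s using (order⇒∣; congruence₁; congruence₃)

      φ∣difference : φ (suc (suc e)) ^ 1 ∣ num difference
      φ∣difference = order⇒∣ (cubicSum summand₁ n K.- nodeValue h) w 1-q*w z w≃z (congruence₁ (summand-hterm regular-denom))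

      φ³∣difference : suc (suc e) ≡ n → φ (suc (suc e)) ^ 3 ∣ num difference
      φ³∣difference d≡n = order⇒∣ (cubicSum summand₁ n K.- nodeValue h) w 1-q*w z w≃z (congruence₃ d≡n (summand-hterm regular-denom))

    module _ (1≤h : 1 ≤ h) where
      private
        A₁ = num difference

      2≤n : 2 ≤ n
      2≤n = s≤s (ℕ.≤-trans 1≤h (ℕ.m≤m+n h (h ℕ.+ 0)))

      -- The order argument covers d > 1. For d = 1 the factor q - 1 is supplied by hand, to be
      -- cancelled again in `combine-divisors`.
      φ-∣-X*A₁ : ∀ {d} → ProperDivisor n d → φ d ∣ X 1 *ₚ A₁
      φ-∣-X*A₁ {1}           _             = ∣-*ʳ A₁ (φ∣X {1} (s≤s z≤n))
      φ-∣-X*A₁ {suc (suc e)} (_ , _ , d∣n) = ∣-*ˡ (X 1) (∣-trans (≋⇒∣ (≋-sym (P.*-identityʳ (φ (suc (suc e)))))) (Divisor.φ∣difference e d∣n))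

      φₙ³-∣ : ∀ m → m ≡ n → 2 ≤ m → φ m ^ 3 ∣ A₁
      φₙ³-∣ (suc (suc e)) m≡n _ = Divisor.φ³∣difference e (subst (ℕ._∣ n) (sym m≡n) ℕ.∣-refl) m≡n
      φₙ³-∣ (suc zero) _ (s≤s ())

      pairwise-coprime : ∀ {a b} → ProperDivisor n a → ProperDivisor n b → a ≢ b → CoprimeTo (φ a) (φ b)
      pairwise-coprime (1≤a , a<n , _) (1≤b , b<n , _) a≢b = Factors.pairwise {n} _ 1≤a (ℕ.<⇒≤ a<n) _ 1≤b (ℕ.<⇒≤ b<n) a≢b

      properProduct-∣ : properProduct n ∣ X 1 *ₚ A₁
      properProduct-∣ = product-∣ (properDivisors n) (pairs pairwise-coprime (properDivisors-sound n) (properDivisors-distinct n))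
        (All.map φ-∣-X*A₁ (properDivisors-sound n))

    -- φ³ and the product of the proper φ_d both divide (q − 1) a and are coprime; together they make (q − 1) [n] φ².
    combine-divisors : ∀ a → properProduct n ∣ X 1 *ₚ a → φ n ^ 3 ∣ X 1 *ₚ a → qint n *ₚ (Φ n ^ₚ 2) ∣ a
    combine-divisors a (c , Xa≋cP) φ³∣Xa = finish (coprime-∣^ (regular-φ (2 ℕ.* h)) (factors-coprime (2 ℕ.* h) (proj₁ (factorised n (s≤s z≤n)))) 3 c (∣-resp Xa≋cP φ³∣Xa))
      where
      open Relation.Binary.Reasoning.Setoid P.setoid
      finish : φ n ^ 3 ∣ c → qint n *ₚ (Φ n ^ₚ 2) ∣ a
      finish (e , c≋eφ³) = e , regular-cancel (regular-X 0) (begin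
        a *ₚ X 1
          ≈⟨ *-comm a (X 1) ⟩
        X 1 *ₚ a
          ≈⟨ Xa≋cP ⟩
        c *ₚ properProduct n
          ≈⟨ *-congʳ (properProduct n) c≋eφ³ ⟩
        e *ₚ φ n ^ 3 *ₚ properProduct n
          ≈⟨ PS.solve 3 (λ e f p → e PS.:* f PS.:^ 3 PS.:* p PS.:= e PS.:* f PS.:^ 2 PS.:* (f PS.:* p)) P.refl e (φ n) (properProduct n) ⟩
        e *ₚ φ n ^ 2 *ₚ (φ n *ₚ properProduct n)
          ≈⟨ *-congˡ (e *ₚ φ n ^ 2) (≋-trans (proj₁ (factorised n (s≤s z≤n))) (≋-sym (qint-X n))) ⟩
        e *ₚ φ n ^ 2 *ₚ (qint n *ₚ X 1)
          ≈⟨ *-congʳ (qint n *ₚ X 1) (*-congˡ e (P.*-cong (Φ-φ n) (P.*-congʳ (Φ-φ n)))) ⟨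
        e *ₚ (Φ n ^ₚ 2) *ₚ (qint n *ₚ X 1)
          ≈⟨ PS.solve 4 (λ e f i x → e PS.:* f PS.:* (i PS.:* x) PS.:= e PS.:* (i PS.:* f) PS.:* x) P.refl e (Φ n ^ₚ 2) (qint n) (X 1) ⟩
        e *ₚ (qint n *ₚ (Φ n ^ₚ 2)) *ₚ X 1 ∎)

    -- This reduces coprimality with the modulus to the identities modulo qⁿ - 1.
    modulus-∣-X³ : qint n *ₚ (Φ n ^ₚ 2) ∣ X n *ₚ (X n *ₚ X n)
    modulus-∣-X³ = ∣-* (X 1 , ≋-trans (≋-sym (qint-X n)) (*-comm (qint n) (X 1)))
        (∣-* Φ∣X (∣-trans (≋⇒∣ (P.*-identityʳ (Φ n))) Φ∣X))
      where
      open Relation.Binary.Reasoning.Setoid P.setoid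
      Φ∣X : Φ n ∣ X n
      Φ∣X = ∣-trans (≋⇒∣ (Φ-φ n)) (φ∣X {n} (s≤s z≤n))
      ∣-* : ∀ {a b c d} → a ∣ b → c ∣ d → a *ₚ c ∣ b *ₚ d
      ∣-* {a} {b} {c} {d} (x , e) (y , f) = x *ₚ y , ≋-trans (P.*-cong e f)
        (PS.solve 4 (λ x a y c → (x PS.:* a) PS.:* (y PS.:* c) PS.:= (x PS.:* y) PS.:* (a PS.:* c)) P.refl x a y c)

    congruence : 1 ≤ h → lhs n ≡ rhs n modₚ (qint n *ₚ (Φ n ^ₚ 2))
    congruence 1≤h = num difference , den difference ,
      (λ e → absurd (at (regular-difference 1ₚ (≋-trans (*-identityˡ (den difference)) (pointwise e))) 0)) ,
      ∣⇒∣ₚ (combine-divisors (num difference) (properProduct-∣ 1≤h) (∣-*ˡ (X 1) (φₙ³-∣ 1≤h n refl (2≤n 1≤h)))) ,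
      (λ d d∣P d∣A₂ → unit-of invertible-difference (∣ₚ⇒∣ d∣A₂) (∣-trans (∣ₚ⇒∣ d∣P) modulus-∣-X³)) ,
      at (-f-cong {sumF (map term (upTo n))} {sumF (map reduced (upTo n))} (rhs n) (sumF-cong term reduced term-reduced (upTo n)))
      where
      absurd : ¬ (1ℤ ≡ 0ℤ)
      absurd ()

  1-∣ : ∀ p → 1ₚ ∣ p
  1-∣ p = p , ≋-sym (P.*-identityʳ p)

  -- For n = 1 there is no divisor d > 1 to work with, but the two sides are equal, and the
  -- numerator of their difference computes to zero coefficients.
  congruence-1 : lhs 1 ≡ rhs 1 modₚ (qint 1 *ₚ (Φ 1 ^ₚ 2))
  congruence-1 = 0ₚ , 1ₚ , (λ e → absurd (e 0)) , ([] , λ i → refl) ,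
      (λ d _ d∣1 → unit-of {0} invertible-1 (∣ₚ⇒∣ d∣1) (∣-trans (∣ₚ⇒∣ d∣1) (1-∣ (X 1 *ₚ (X 1 *ₚ X 1))))) ,
      zeros
    where
    absurd : ¬ (1ℤ ≡ 0ℤ)
    absurd ()
    zeros : num (lhs 1 -f rhs 1) *ₚ 1ₚ ≈ₚ 0ₚ *ₚ den (lhs 1 -f rhs 1)
    zeros 0 = refl
    zeros (suc i) = refl

  coprime-6 : ∀ {n} → Coprime n 6 → ∀ {p} → 1 < p → p ℕ.∣ 6 → ¬ (p ℕ.∣ n)
  coprime-6 c 1<p p∣6 p∣n = ℕ.<-irrefl (sym (c (p∣n , p∣6))) 1<p

  odd-cases : (Q : ℕ → Set) → Q 1 → (∀ h k → 1 ≤ h → suc (2 ℕ.* h) ≡ 1 ℕ.+ 3 ℕ.* k ⊎ suc (2 ℕ.* h) ≡ 2 ℕ.+ 3 ℕ.* k → Q (suc (2 ℕ.* h))) →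
              ∀ n → Coprime n 6 → Q n
  odd-cases Q q₁ q₂ n c with odd-∣ (coprime-6 c {2} (s≤s (s≤s z≤n)) (ℕ.divides 3 refl)) (ℕ.∣-refl {n}) | mod3 n
  ... | zero  , refl | _ = q₁
  ... | suc h , refl | k , inj₁ e = ⊥-elim (coprime-6 c {3} (s≤s (s≤s z≤n)) (ℕ.divides 2 refl) (ℕ.divides k (trans e (ℕ.*-comm 3 k))))
  ... | suc h , refl | k , inj₂ e = q₂ (suc h) k (s≤s z≤n) e

open Conclusion using (odd-cases; congruence-1; module Odd)
open import Defs
open import Data.Nat using (ℕ; _<_; _*_)
open import Data.Nat.Coprimality using (Coprime)

theorem4 : (n : ℕ) → 0 < n → Coprime n 6 →
    lhs n ≡ rhs n modₚ (qint n *ₚ (Φ n ^ₚ 2))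
theorem4 n 0<n = odd-cases (λ n → lhs n ≡ rhs n modₚ (qint n *ₚ (Φ n ^ₚ 2))) congruence-1 (λ h k 1≤h e → Odd.congruence h k e 1≤h) n
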